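{- For all $u,w\in S_\infty$, \[ \langle \mathfrak S_u,\ \mathfrak D_{1,w}\rangle=\delta_{uw}. \] Equivalently, the chain-defined polynomials $\mathfrak D_{1,w}$ coincide with the dual Schubert polynomials $\mathfrak D_w$, i.e. the polynomials dual to the Schubert polynomials under $\langle\cdot,\cdot\rangle$.
   Context: $S_\infty$ is the group of permutations of $\mathbb P=\{1,2,\dots\}$ fixing all but finitely many elements. It is generated by $s_i=(i,i+1)$. The length $\ell(w)$ is the minimal number of simple transpositions in an expression for $w$, and $\mathrm{Red}(w)$ is the set of reduced words $(a_1,\dots,a_p)$ with $w=s_{a_1}\cdots s_{a_p}$ and $p=\ell(w)$. Bruhat covers: $u\to v$ means $v=u\,(a,b)$ for some $a<b$ (right multiplication by the transposition $(a,b)$) and $\ell(v)=\ell(u)+1$. Set $\mu(u\to v)=x_a-x_b$. Schubert polynomials (Billey–Jockusch–Stanley): $\mathfrak S_w=\sum x_{i_1}\cdots x_{i_p}$. The sum runs over pairs consisting of $(a_1,\dots,a_p)\in\mathrm{Red}(w)$ and $i_1\le\dots\le i_p$ such that $i_j\le a_j$ for all $j$, and $i_j=i_{j+1}$ only if $a_j<a_{j+1}$. Inner product on $\mathbb C[x_1,x_2,\dots]$: \[ \langle f,g\rangle=f(\partial/\partial x_1,\partial/\partial x_2,\dots)\,g(x_1,x_2,\dots)\big|_{x_1=x_2=\dots=0}. \] For $u,w\in S_\infty$, the skew dual Schubert polynomial is \[ \mathfrak D_{u,w}=\frac1{p!}\sum_{u=v_0\to v_1\to\dots\to v_p=w}\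 \prod_{i=1}^p\mu(v_{i-1}\to v_i), \] summed over all saturated Bruhat chains from $u$ to $w$. Here $p=\ell(w)-\ell(u)$, and $\mathfrak D_{u,w}=0$ if there is no such chain.
   Formalization: In the Schubert polynomial formula, the condition "i_j=i_{j+1} only if a_j<a_{j+1}" is corrected to the Billey–Jockusch–Stanley condition "only if a_j>a_{j+1}"; as written it gives 𝔖_w=0 for w=s_2s_1, so the claim fails. -}

module Defs where

open import Algebra.Bundles using (CommutativeRing)
import Algebra.Definitions.RawMonoid as RawMult
open import Data.Bool.Base using (if_then_else_)
open import Data.Empty using (⊥-elim)
open import Data.List.Base
  using (List; []; _∷_; [_]; _++_; _∷ʳ_; length; map; foldr; filter; concatMap;
         upTo; zip; cartesianProduct; cartesianProductWith)
open import Data.List.Membership.Propositional using (_∈_)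
open import Data.List.Membership.Propositional.Properties
  using (∈-cartesianProductWith⁺; ∈-cartesianProduct⁺; ∈-upTo⁺; ∈-filter⁺; ∈-filter⁻; ∈-++⁺ˡ; ∈-++⁺ʳ)
open import Data.List.Properties using (length-++; ∷-injective; filter-none)
open import Data.List.Relation.Binary.Pointwise using (Pointwise; []; _∷_; Pointwise-length)
import Data.List.Relation.Binary.Pointwise.Properties as Pointwise
open import Data.List.Relation.Unary.All as All using (All; []; _∷_; all?)
open import Data.List.Relation.Unary.All.Properties using (∷ʳ⁺; ¬Any⇒All¬)
open import Data.List.Relation.Unary.Any using (here)
open import Data.List.Relation.Unary.AllPairs using ([]; _∷_)
open import Data.List.Relation.Unary.Linked using (Linked; linked?)
open import Data.List.Relation.Unary.Unique.Propositional using (Unique)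
import Data.List.Relation.Unary.Unique.Propositional.Properties as Unique
open import Data.List.Reverse using (Reverse; reverseView; _∶_∶ʳ_; [])
open import Data.Nat.Base
  using (ℕ; zero; suc; _+_; _∸_; _⊔_; _!; _≤_; _<_; _>_; z≤n; s≤s; NonZero)
open import Data.Nat.Properties
open import Data.List.Membership.DecPropositional _≟_ using (_∈?_)
open import Data.Product.Base using (∃; _×_; _,_; proj₁; proj₂)
open import Data.Sum.Base using (_⊎_; inj₁; inj₂)
open import Function.Base using (_∘_; id)
open import Function.Bundles using (_↔_; Inverse; mk↔ₛ′)
import Level
open import Relation.Binary.Definitions using (tri<; tri≈; tri>)
open import Relation.Binary.PropositionalEquality
  using (_≡_; _≢_; refl; sym; trans; cong; cong₂; subst; module ≡-Reasoning)
open import Relation.Nullary.Decidable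
  using (Dec; yes; no; does; map′; _×-dec_; _→-dec_)
open import Relation.Nullary.Negation using (¬_; contradiction)
open import Relation.Unary using (Decidable)

-- The ground set ℙ = {1,2,…} is represented by ℕ, with n ∈ ℕ standing for n + 1 ∈ ℙ.
-- All conditions on indices below are invariant under this shift.

record S∞ : Set where
  constructor mkS∞
  field
    perm  : ℕ ↔ ℕ
    bound : ℕ
    fixes : ∀ n → bound ≤ n → Inverse.to perm n ≡ n

  open Inverse perm public using (to; from; strictlyInverseˡ; strictlyInverseʳ)

open S∞ public using (to; from; bound; fixes)

-- Elements of S∞ carry a (non-unique) bound on their support, so the group is considered
-- up to pointwise equality.

infix 4 _≈ₛ_ _≟ₛ_

_≈ₛ_ : S∞ → S∞ → Set
u ≈ₛ v = ∀ n → to u n ≡ to v n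

_≟ₛ_ : ∀ u v → Dec (u ≈ₛ v)
u ≟ₛ v = map′ extend (λ eq {n} _ → eq n)
              (allUpTo? (λ n → to u n ≟ to v n) (bound u ⊔ bound v))
  where
  extend : (∀ {n} → n < bound u ⊔ bound v → to u n ≡ to v n) → u ≈ₛ v
  extend eq n with n <? bound u ⊔ bound v
  ... | yes n<N = eq n<N
  ... | no  n≮N = trans (fixes u n (≤-trans (m≤m⊔n _ _) (≮⇒≥ n≮N)))
                        (sym (fixes v n (≤-trans (m≤n⊔m _ _) (≮⇒≥ n≮N))))

ε : S∞
ε = mkS∞ (mk↔ₛ′ id id (λ _ → refl) (λ _ → refl)) 0 (λ _ _ → refl)

infixl 7 _·_

_·_ : S∞ → S∞ → S∞
u · v = mkS∞
  (mk↔ₛ′ (to u ∘ to v) (from v ∘ from u)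
    (λ n → trans (cong (to u) (S∞.strictlyInverseˡ v (from u n))) (S∞.strictlyInverseˡ u n))
    (λ n → trans (cong (from v) (S∞.strictlyInverseʳ u (to v n))) (S∞.strictlyInverseʳ v n)))
  (bound u ⊔ bound v)
  (λ n N≤n → trans (cong (to u) (fixes v n (≤-trans (m≤n⊔m _ _) N≤n)))
                   (fixes u n (≤-trans (m≤m⊔n _ _) N≤n)))

swap : ℕ → ℕ → ℕ → ℕ
swap a b n with n ≟ a | n ≟ b
... | yes _ | _     = b
... | no _  | yes _ = a
... | no _  | no _  = n

swap-l : ∀ a b → swap a b a ≡ b
swap-l a b with a ≟ a | a ≟ b
... | yes _  | _ = refl
... | no a≢a | _ = contradiction refl a≢a

swap-r : ∀ a b → swap a b b ≡ a
swap-r a b with b ≟ a | b ≟ b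
... | yes b≡a | _      = b≡a
... | no _    | yes _  = refl
... | no _    | no b≢b = contradiction refl b≢b

swap-≢ : ∀ a b {n} → n ≢ a → n ≢ b → swap a b n ≡ n
swap-≢ a b {n} n≢a n≢b with n ≟ a | n ≟ b
... | yes n≡a | _       = contradiction n≡a n≢a
... | no _    | yes n≡b = contradiction n≡b n≢b
... | no _    | no _    = refl

swap-involutive : ∀ a b n → swap a b (swap a b n) ≡ n
swap-involutive a b n with n ≟ a | n ≟ b
... | yes refl | _        = swap-r a b
... | no _     | yes refl = swap-l a b
... | no n≢a   | no n≢b   = swap-≢ a b n≢a n≢b

⦅_,_⦆ : ℕ → ℕ → S∞
⦅ a , b ⦆ = mkS∞
  (mk↔ₛ′ (swap a b) (swap a b) (swap-involutive a b) (swap-involutive a b))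
  (suc (a ⊔ b))
  (λ n N≤n → swap-≢ a b (λ { refl → <⇒≱ N≤n (m≤m⊔n a b) })
                        (λ { refl → <⇒≱ N≤n (m≤n⊔m a b) }))

s : ℕ → S∞
s i = ⦅ i , suc i ⦆

Word : Set
Word = List ℕ

wordProduct : Word → S∞
wordProduct = foldr (λ i w → s i · w) ε

-- The inversion count. It enters no definition below except through proofs: it shows that
-- a shortest expression exists and that the sets summed over are finite.

module Inversions where

  Σ< : ℕ → (ℕ → ℕ) → ℕ
  Σ< zero    f = 0
  Σ< (suc n) f = Σ< n f + f n

  Σ<-cong : ∀ n {f g : ℕ → ℕ} → (∀ i → i < n → f i ≡ g i) → Σ< n f ≡ Σ< n g
  Σ<-cong zero    eq = refl
  Σ<-cong (suc n) eq = cong₂ _+_ (Σ<-cong n λ i i<n → eq i (m<n⇒m<1+n i<n)) (eq n ≤-refl)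

  Σ<-0 : ∀ n {f : ℕ → ℕ} → (∀ i → i < n → f i ≡ 0) → Σ< n f ≡ 0
  Σ<-0 zero    eq = refl
  Σ<-0 (suc n) eq = cong₂ _+_ (Σ<-0 n λ i i<n → eq i (m<n⇒m<1+n i<n)) (eq n ≤-refl)

  Σ<-exchange : ∀ k r {c d} {f g : ℕ → ℕ} →
    (∀ i → i ≢ k → i ≢ suc k → f i ≡ g i) →
    f k + f (suc k) + c ≡ g k + g (suc k) + d →
    Σ< (r + suc (suc k)) f + c ≡ Σ< (r + suc (suc k)) g + d
  Σ<-exchange k zero {c} {d} {f} {g} off on = begin
    Σ< k f + f k + f (suc k) + c     ≡⟨ cong (_+ c) (+-assoc (Σ< k f) _ _) ⟩
    Σ< k f + (f k + f (suc k)) + c   ≡⟨ +-assoc (Σ< k f) _ c ⟩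
    Σ< k f + (f k + f (suc k) + c)   ≡⟨ cong₂ _+_ (Σ<-cong k λ i i<k → off i (<⇒≢ i<k) (<⇒≢ (m<n⇒m<1+n i<k))) on ⟩
    Σ< k g + (g k + g (suc k) + d)   ≡⟨ +-assoc (Σ< k g) _ d ⟨
    Σ< k g + (g k + g (suc k)) + d   ≡⟨ cong (_+ d) (+-assoc (Σ< k g) _ _) ⟨
    Σ< k g + g k + g (suc k) + d     ∎
    where open ≡-Reasoning
  Σ<-exchange k (suc r) {c} {d} {f} {g} off on = begin
    Σ< n f + f n + c     ≡⟨ +-assoc (Σ< n f) _ c ⟩
    Σ< n f + (f n + c)   ≡⟨ cong (Σ< n f +_) (+-comm (f n) c) ⟩
    Σ< n f + (c + f n)   ≡⟨ +-assoc (Σ< n f) c _ ⟨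
    Σ< n f + c + f n     ≡⟨ cong₂ _+_ (Σ<-exchange k r off on) (off n n≢k n≢1+k) ⟩
    Σ< n g + d + g n     ≡⟨ +-assoc (Σ< n g) d _ ⟩
    Σ< n g + (d + g n)   ≡⟨ cong (Σ< n g +_) (+-comm d (g n)) ⟩
    Σ< n g + (g n + d)   ≡⟨ +-assoc (Σ< n g) _ d ⟨
    Σ< n g + g n + d     ∎
    where
    open ≡-Reasoning
    n = r + suc (suc k)
    n≢1+k : n ≢ suc k
    n≢1+k eq = <⇒≢ (m≤n+m (suc (suc k)) r) (sym eq)
    n≢k : n ≢ k
    n≢k eq = <⇒≢ (≤-trans (n≤1+n _) (m≤n+m (suc (suc k)) r)) (sym eq)

  Σ<-exchange′ : ∀ {k n c d} {f g : ℕ → ℕ} → suc k < n →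
    (∀ i → i ≢ k → i ≢ suc k → f i ≡ g i) →
    f k + f (suc k) + c ≡ g k + g (suc k) + d →
    Σ< n f + c ≡ Σ< n g + d
  Σ<-exchange′ {k} {n} {c} {d} {f} {g} k<n off on =
    subst (λ n → Σ< n f + c ≡ Σ< n g + d) (m∸n+n≡m k<n)
          (Σ<-exchange k (n ∸ suc (suc k)) off on)

  gt : ℕ → ℕ → ℕ
  gt m n with n <? m
  ... | yes _ = 1
  ... | no  _ = 0

  gt-yes : ∀ {m n} → n < m → gt m n ≡ 1
  gt-yes {m} {n} p with n <? m
  ... | yes _ = refl
  ... | no  q = contradiction p q

  gt-no : ∀ {m n} → ¬ n < m → gt m n ≡ 0
  gt-no {m} {n} p with n <? m
  ... | yes q = contradiction q p
  ... | no  _ = refl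

  col : (ℕ → ℕ) → ℕ → ℕ
  col f j = Σ< j (λ i → gt (f i) (f j))

  inv : ℕ → (ℕ → ℕ) → ℕ
  inv M f = Σ< M (col f)

  inv-cong : ∀ M {f g : ℕ → ℕ} → (∀ n → f n ≡ g n) → inv M f ≡ inv M g
  inv-cong M eq = Σ<-cong M λ j _ → Σ<-cong j λ i _ → cong₂ gt (eq i) (eq j)

  module _ (f : ℕ → ℕ) (k : ℕ) where

    f′ : ℕ → ℕ
    f′ = f ∘ swap k (suc k)

    private
      f′k : f′ k ≡ f (suc k)
      f′k = cong f (swap-l k (suc k))

      f′1+k : f′ (suc k) ≡ f k
      f′1+k = cong f (swap-r k (suc k))

      f′off : ∀ {i} → i ≢ k → i ≢ suc k → f′ i ≡ f i
      f′off p q = cong f (swap-≢ k (suc k) p q)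

      f′< : ∀ {i} → i < k → f′ i ≡ f i
      f′< i<k = f′off (<⇒≢ i<k) (<⇒≢ (m<n⇒m<1+n i<k))

      col-off : ∀ j → j ≢ k → j ≢ suc k → col f′ j ≡ col f j
      col-off j j≢k j≢1+k with <-cmp j (suc k)
      ... | tri≈ _ j≡1+k _ = contradiction j≡1+k j≢1+k
      ... | tri< j<1+k _ _ = Σ<-cong j λ i i<j →
              cong₂ gt (f′< (≤-trans i<j (≤-pred j<1+k))) (f′off j≢k j≢1+k)
      ... | tri> _ _ 1+k<j = trans (sym (+-identityʳ _)) (trans
              (Σ<-exchange′ {k} {j} {0} {0} 1+k<j
                (λ i p q → cong₂ gt (f′off p q) (f′off j≢k j≢1+k))
                (cong (_+ 0) (trans (cong₂ _+_ (cong₂ gt f′k (f′off j≢k j≢1+k))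
                                               (cong₂ gt f′1+k (f′off j≢k j≢1+k)))
                                    (+-comm (gt (f (suc k)) (f j)) _))))
              (+-identityʳ _))

      col-k : col f′ k ≡ Σ< k (λ i → gt (f i) (f (suc k)))
      col-k = Σ<-cong k λ i i<k → cong₂ gt (f′< i<k) f′k

      col-1+k : col f′ (suc k) ≡ col f k + gt (f (suc k)) (f k)
      col-1+k = cong₂ _+_ (Σ<-cong k λ i i<k → cong₂ gt (f′< i<k) f′1+k)
                          (cong₂ gt f′k f′1+k)

      shuffle : ∀ p q x y → q + (p + x) + y ≡ p + (q + y) + x
      shuffle p q x y = begin
        q + (p + x) + y   ≡⟨ cong (_+ y) (+-assoc q p x) ⟨
        q + p + x + y     ≡⟨ cong (λ z → z + x + y) (+-comm q p) ⟩
        p + q + x + y     ≡⟨ +-assoc (p + q) x y ⟩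
        p + q + (x + y)   ≡⟨ cong (p + q +_) (+-comm x y) ⟩
        p + q + (y + x)   ≡⟨ +-assoc (p + q) y x ⟨
        p + q + y + x     ≡⟨ cong (_+ x) (+-assoc p q y) ⟩
        p + (q + y) + x   ∎
        where open ≡-Reasoning

    inv-swap : ∀ {M} → suc k < M →
      inv M f′ + gt (f k) (f (suc k)) ≡ inv M f + gt (f (suc k)) (f k)
    inv-swap {M} k<M = Σ<-exchange′ {k} {M} k<M col-off
      (trans (cong (_+ gt (f k) (f (suc k))) (cong₂ _+_ col-k col-1+k))
             (shuffle (col f k) (Σ< k (λ i → gt (f i) (f (suc k)))) _ _))

    inv-ascent : ∀ {M} → suc k < M → f k < f (suc k) → inv M f′ ≡ suc (inv M f)
    inv-ascent {M} k<M p = begin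
      inv M f′                            ≡⟨ +-identityʳ _ ⟨
      inv M f′ + 0                        ≡⟨ cong (inv M f′ +_) (gt-no (<-asym p)) ⟨
      inv M f′ + gt (f k) (f (suc k))     ≡⟨ inv-swap k<M ⟩
      inv M f + gt (f (suc k)) (f k)      ≡⟨ cong (inv M f +_) (gt-yes p) ⟩
      inv M f + 1                         ≡⟨ +-comm _ 1 ⟩
      suc (inv M f)                       ∎
      where open ≡-Reasoning

    inv-descent : ∀ {M} → suc k < M → f (suc k) < f k → suc (inv M f′) ≡ inv M f
    inv-descent {M} k<M p = begin
      suc (inv M f′)                      ≡⟨ +-comm 1 _ ⟩
      inv M f′ + 1                        ≡⟨ cong (inv M f′ +_) (gt-yes p) ⟨
      inv M f′ + gt (f k) (f (suc k))     ≡⟨ inv-swap k<M ⟩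
      inv M f + gt (f (suc k)) (f k)      ≡⟨ cong (inv M f +_) (gt-no (<-asym p)) ⟩
      inv M f + 0                         ≡⟨ +-identityʳ _ ⟩
      inv M f                             ∎
      where open ≡-Reasoning

    inv-step : ∀ {M} → suc k < M → inv M f′ ≤ suc (inv M f)
    inv-step {M} k<M = begin
      inv M f′                            ≤⟨ m≤m+n _ _ ⟩
      inv M f′ + gt (f k) (f (suc k))     ≡⟨ inv-swap k<M ⟩
      inv M f + gt (f (suc k)) (f k)      ≤⟨ +-monoʳ-≤ (inv M f) gt≤1 ⟩
      inv M f + 1                         ≡⟨ +-comm _ 1 ⟩
      suc (inv M f)                       ∎
      where
      open ≤-Reasoning
      gt≤1 : gt (f (suc k)) (f k) ≤ 1
      gt≤1 with f k <? f (suc k)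
      ... | yes _ = ≤-refl
      ... | no  _ = z≤n

  to-injective : ∀ w {m n} → to w m ≡ to w n → m ≡ n
  to-injective w {m} {n} eq = trans (sym (S∞.strictlyInverseʳ w m))
    (trans (cong (from w) eq) (S∞.strictlyInverseʳ w n))

  Fixes≥ : ℕ → S∞ → Set
  Fixes≥ N w = ∀ n → N ≤ n → to w n ≡ n

  preserves< : ∀ {N} w → Fixes≥ N w → ∀ {n} → n < N → to w n < N
  preserves< {N} w fix {n} n<N with to w n <? N
  ... | yes p = p
  ... | no  p = contradiction n<N
                  (≤⇒≯ (subst (N ≤_) (to-injective w (fix _ (≮⇒≥ p))) (≮⇒≥ p)))

  inv-fixed : ∀ {N} w → Fixes≥ N w → ∀ r → inv (r + N) (to w) ≡ inv N (to w)
  inv-fixed w fix zero    = refl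
  inv-fixed {N} w fix (suc r) = trans (cong₂ _+_ (inv-fixed w fix r) col≡0) (+-identityʳ _)
    where
    N≤ = m≤n+m N r
    col≡0 : col (to w) (r + N) ≡ 0
    col≡0 = Σ<-0 (r + N) λ i i<j → gt-no λ lt →
      <-asym lt (subst (to w i <_) (sym (fix _ N≤))
                       (preserves< w (λ n le → fix n (≤-trans N≤ le)) i<j))

  #inv : S∞ → ℕ
  #inv w = inv (bound w) (to w)

  inv≡#inv : ∀ w {M} → bound w ≤ M → inv M (to w) ≡ #inv w
  inv≡#inv w {M} le = subst (λ M → inv M (to w) ≡ #inv w) (m∸n+n≡m le)
                            (inv-fixed w (fixes w) (M ∸ bound w))

  #inv-cong : ∀ u v → u ≈ₛ v → #inv u ≡ #inv v
  #inv-cong u v eq = trans (sym (inv≡#inv u (m≤m⊔n _ (bound v))))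
    (trans (inv-cong (bound u ⊔ bound v) eq) (inv≡#inv v (m≤n⊔m (bound u) _)))

  descent-bound : ∀ {N} w → Fixes≥ N w → ∀ {k} → to w (suc k) < to w k → suc k < N
  descent-bound {N} w fix {k} p with suc k <? N
  ... | yes q = q
  ... | no  q with k <? N
  ...   | yes k<N = contradiction p (<⇒≯ (subst (to w k <_) (sym (fix _ (≮⇒≥ q)))
                      (<-≤-trans (preserves< w fix k<N) (≮⇒≥ q))))
  ...   | no  k≮N rewrite fix k (≮⇒≥ k≮N) | fix (suc k) (m≤n⇒m≤1+n (≮⇒≥ k≮N)) =
                    contradiction p (<⇒≯ ≤-refl)

  #inv-descent : ∀ w {k} → to w (suc k) < to w k → suc (#inv (w · s k)) ≡ #inv w
  #inv-descent w {k} p = trans (inv-descent (to w) k (m≤n⇒m≤o⊔n (bound w) (s≤s (m≤n⊔m k (suc k)))) p)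
                               (inv≡#inv w (m≤m⊔n _ _))

  #inv-ascent : ∀ w {k} → to w k < to w (suc k) → #inv (w · s k) ≡ suc (#inv w)
  #inv-ascent w {k} p = trans (inv-ascent (to w) k (m≤n⇒m≤o⊔n (bound w) (s≤s (m≤n⊔m k (suc k)))) p)
                              (cong suc (inv≡#inv w (m≤m⊔n _ _)))

  ascent⊎descent : ∀ w k → (to w k < to w (suc k)) ⊎ (to w (suc k) < to w k)
  ascent⊎descent w k with <-cmp (to w k) (to w (suc k))
  ... | tri< p _ _ = inj₁ p
  ... | tri> _ _ p = inj₂ p
  ... | tri≈ _ p _ = contradiction (to-injective w p) (<⇒≢ (n<1+n k))

  no-descent : ∀ w → (∀ k → to w k < to w (suc k)) → w ≈ₛ ε
  no-descent w asc n with n <? bound w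
  ... | no  p = fixes w n (≮⇒≥ p)
  ... | yes p = ≤-antisym (upper (bound w ∸ n) n (m+[n∸m]≡n (<⇒≤ p))) (lower n)
    where
    lower : ∀ n → n ≤ to w n
    lower zero    = z≤n
    lower (suc n) = ≤-<-trans (lower n) (asc n)
    upper : ∀ d n → n + d ≡ bound w → to w n ≤ n
    upper zero    n eq = ≤-reflexive (fixes w n (≤-reflexive (trans (sym eq) (+-identityʳ n))))
    upper (suc d) n eq = ≤-pred (<-≤-trans (asc n) (upper d (suc n) (trans (sym (+-suc n d)) eq)))

  wordProduct-∷ʳ : ∀ a k → wordProduct (a ∷ʳ k) ≈ₛ wordProduct a · s k
  wordProduct-∷ʳ []      k n = refl
  wordProduct-∷ʳ (i ∷ a) k n = cong (to (s i)) (wordProduct-∷ʳ a k n)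

  ·s·s : ∀ w k → w · s k · s k ≈ₛ w
  ·s·s w k n = cong (to w) (swap-involutive k (suc k) n)

  length-∷ʳ : ∀ (a : Word) k → length (a ∷ʳ k) ≡ suc (length a)
  length-∷ʳ a k = trans (length-++ a) (+-comm _ 1)

  sorting : ∀ n w → #inv w ≡ n → ∃ λ a → wordProduct a ≈ₛ w × length a ≡ n
  sorting n w eq with anyUpTo? (λ k → to w (suc k) <? to w k) (bound w)
  sorting zero w eq | yes (k , _ , p) = contradiction (trans (#inv-descent w p) eq) λ ()
  sorting (suc n) w eq | yes (k , _ , p)
    with sorting n (w · s k) (suc-injective (trans (#inv-descent w p) eq))
  ... | a , prod , len =
    a ∷ʳ k
    , (λ m → trans (wordProduct-∷ʳ a k m) (trans (prod (to (s k) m)) (·s·s w k m)))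
    , trans (length-∷ʳ a k) (cong suc len)
  sorting n w eq | no none = [] , (λ m → sym (w≈ε m))
                           , trans (sym (#inv-cong w ε w≈ε)) eq
    where
    asc : ∀ k → to w k < to w (suc k)
    asc k with ascent⊎descent w k
    ... | inj₁ p = p
    ... | inj₂ p = contradiction (k , <-trans ≤-refl (descent-bound w (fixes w) p) , p) none
    w≈ε = no-descent w asc

  inv-word : ∀ a f {M} → bound (wordProduct a) ≤ M → inv M (f ∘ to (wordProduct a)) ≤ inv M f + length a
  inv-word []      f     le = ≤-reflexive (sym (+-identityʳ _))
  inv-word (i ∷ a) f {M} le = begin
    inv M (f ∘ to (s i) ∘ to (wordProduct a))   ≤⟨ inv-word a (f ∘ to (s i)) (≤-trans (m≤n⊔m _ _) le) ⟩
    inv M (f ∘ to (s i)) + length a         ≤⟨ +-monoˡ-≤ (length a) (inv-step f i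
                                                 (≤-trans (s≤s (m≤n⊔m i (suc i)))
                                                    (≤-trans (m≤m⊔n _ (bound (wordProduct a))) le))) ⟩
    suc (inv M f) + length a                ≡⟨ +-suc (inv M f) (length a) ⟨
    inv M f + suc (length a)                ∎
    where open ≤-Reasoning

  #inv≤length : ∀ w a → wordProduct a ≈ₛ w → #inv w ≤ length a
  #inv≤length w a eq = begin
    #inv w                        ≡⟨ #inv-cong (wordProduct a) w eq ⟨
    #inv (wordProduct a)              ≤⟨ inv-word a id ≤-refl ⟩
    inv (bound (wordProduct a)) id + length a   ≡⟨ cong (_+ length a) (inv≡#inv ε {bound (wordProduct a)} z≤n) ⟩
    length a                      ∎
    where open ≤-Reasoning

  swap-conjugate : ∀ a d n → let b = suc (suc d) + a in
    swap a (suc a) (swap (suc a) b (swap a (suc a) n)) ≡ swap a b n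
  swap-conjugate a d n = split (n ≟ a) (n ≟ suc a) (n ≟ b)
    where
    b = suc (suc d) + a
    a<b : a < b
    a<b = s≤s (m≤n+m a (suc d))
    1+a<b : suc a < b
    1+a<b = s≤s (s≤s (m≤n+m a d))
    split : Dec (n ≡ a) → Dec (n ≡ suc a) → Dec (n ≡ b) →
            swap a (suc a) (swap (suc a) b (swap a (suc a) n)) ≡ swap a b n
    split (yes refl) _ _ = begin
      swap n (suc n) (swap (suc n) b (swap n (suc n) n))
        ≡⟨ cong (swap n (suc n) ∘ swap (suc n) b) (swap-l n (suc n)) ⟩
      swap n (suc n) (swap (suc n) b (suc n))
        ≡⟨ cong (swap n (suc n)) (swap-l (suc n) b) ⟩
      swap n (suc n) b   ≡⟨ swap-≢ n (suc n) (>⇒≢ a<b) (>⇒≢ 1+a<b) ⟩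
      b                  ≡⟨ swap-l n b ⟨
      swap n b n         ∎
      where open ≡-Reasoning
    split (no n≢a) (yes refl) _ = begin
      swap a (suc a) (swap (suc a) b (swap a (suc a) (suc a)))
        ≡⟨ cong (swap a (suc a) ∘ swap (suc a) b) (swap-r a (suc a)) ⟩
      swap a (suc a) (swap (suc a) b a)
        ≡⟨ cong (swap a (suc a)) (swap-≢ (suc a) b (<⇒≢ ≤-refl) (<⇒≢ a<b)) ⟩
      swap a (suc a) a   ≡⟨ swap-l a (suc a) ⟩
      suc a              ≡⟨ swap-≢ a b n≢a (<⇒≢ 1+a<b) ⟨
      swap a b (suc a)   ∎
      where open ≡-Reasoning
    split (no n≢a) (no n≢1+a) (yes refl) = begin
      swap a (suc a) (swap (suc a) b (swap a (suc a) b))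
        ≡⟨ cong (swap a (suc a) ∘ swap (suc a) b) (swap-≢ a (suc a) n≢a n≢1+a) ⟩
      swap a (suc a) (swap (suc a) b b)
        ≡⟨ cong (swap a (suc a)) (swap-r (suc a) b) ⟩
      swap a (suc a) (suc a)   ≡⟨ swap-r a (suc a) ⟩
      a                        ≡⟨ swap-r a b ⟨
      swap a b b               ∎
      where open ≡-Reasoning
    split (no n≢a) (no n≢1+a) (no n≢b) = begin
      swap a (suc a) (swap (suc a) b (swap a (suc a) n))
        ≡⟨ cong (swap a (suc a) ∘ swap (suc a) b) (swap-≢ a (suc a) n≢a n≢1+a) ⟩
      swap a (suc a) (swap (suc a) b n)
        ≡⟨ cong (swap a (suc a)) (swap-≢ (suc a) b n≢1+a n≢b) ⟩
      swap a (suc a) n   ≡⟨ swap-≢ a (suc a) n≢a n≢1+a ⟩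
      n                  ≡⟨ swap-≢ a b n≢a n≢b ⟨
      swap a b n         ∎
      where open ≡-Reasoning

  inv-transposition : ∀ d a w {M} → let b = suc d + a in b < M →
    to w a < to w b → inv M (to w) < inv M (to (w · ⦅ a , b ⦆))
  inv-transposition zero    a w b<M p = ≤-reflexive (sym (inv-ascent (to w) a b<M p))
  inv-transposition (suc d) a w {M} b<M p =
    subst (inv M (to w) <_) (inv-cong M λ n → cong (to w) (swap-conjugate a d n)) total
    where
    b = suc (suc d) + a
    a<b : a < b
    a<b = s≤s (m≤n+m a (suc d))
    1+a<b : suc a < b
    1+a<b = s≤s (s≤s (m≤n+m a d))
    1+a<M = <-trans 1+a<b b<M
    g = w · s a
    h = g · ⦅ suc a , b ⦆
    ga : to g (suc a) ≡ to w a
    ga = cong (to w) (swap-r a (suc a))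
    gb : to g b ≡ to w b
    gb = cong (to w) (swap-≢ a (suc a) (>⇒≢ a<b) (>⇒≢ 1+a<b))
    ha : to h a ≡ to w (suc a)
    ha = trans (cong (to g) (swap-≢ (suc a) b (<⇒≢ ≤-refl) (<⇒≢ a<b)))
               (cong (to w) (swap-l a (suc a)))
    h1+a : to h (suc a) ≡ to w b
    h1+a = trans (cong (to g) (swap-l (suc a) b)) gb
    eq : suc d + suc a ≡ b
    eq = +-suc (suc d) a
    IH : inv M (to g) < inv M (to h)
    IH = subst (λ b → to g (suc a) < to g b → b < M → inv M (to g) < inv M (to (g · ⦅ suc a , b ⦆)))
               eq (λ q b<M → inv-transposition d (suc a) g b<M q)
               (subst₂′ ga gb p) b<M
      where
      subst₂′ : ∀ {x x′ y y′} → x ≡ x′ → y ≡ y′ → x′ < y′ → x < y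
      subst₂′ refl refl q = q
    total : inv M (to w) < inv M (to (h · s a))
    total with ascent⊎descent w a | ascent⊎descent h a
    ... | inj₁ up | inj₁ up′ = begin-strict
      inv M (to w)         <⟨ n<1+n _ ⟩
      suc (inv M (to w))   ≡⟨ inv-ascent (to w) a 1+a<M up ⟨
      inv M (to g)         <⟨ IH ⟩
      inv M (to h)         <⟨ n<1+n _ ⟩
      suc (inv M (to h))   ≡⟨ inv-ascent (to h) a 1+a<M up′ ⟨
      inv M (to (h · s a)) ∎
      where open ≤-Reasoning
    ... | inj₁ up | inj₂ down′ = ≤-pred (begin-strict
      suc (inv M (to w))   ≡⟨ inv-ascent (to w) a 1+a<M up ⟨
      inv M (to g)         <⟨ IH ⟩
      inv M (to h)         ≡⟨ inv-descent (to h) a 1+a<M down′ ⟨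
      suc (inv M (to (h · s a))) ∎)
      where open ≤-Reasoning
    ... | inj₂ down | inj₁ up′ = begin-strict
      inv M (to w)         ≡⟨ inv-descent (to w) a 1+a<M down ⟨
      suc (inv M (to g))   <⟨ s≤s IH ⟩
      suc (inv M (to h))   ≡⟨ inv-ascent (to h) a 1+a<M up′ ⟨
      inv M (to (h · s a)) ∎
      where open ≤-Reasoning
    ... | inj₂ down | inj₂ down′ = ⊥-elim (<-irrefl refl
      (<-trans down (<-trans p (subst (_< to w (suc a)) h1+a (subst (to h (suc a) <_) ha down′)))))

  #inv-descending : ∀ w {a b} → a < b → to w b < to w a → #inv (w · ⦅ a , b ⦆) < #inv w
  #inv-descending w {a} {b} a<b p = begin-strict
    #inv v                         ≡⟨ inv≡#inv v ≤-refl ⟨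
    inv M (to v)                   <⟨ lemma (b ∸ suc a) eq p′ ⟩
    inv M (to (v · ⦅ a , b ⦆))     ≡⟨ inv-cong M (λ n → cong (to w) (swap-involutive a b n)) ⟩
    inv M (to w)                   ≡⟨ inv≡#inv w (m≤m⊔n _ _) ⟩
    #inv w                         ∎
    where
    open ≤-Reasoning
    v = w · ⦅ a , b ⦆
    M = bound v
    b<M : b < M
    b<M = m≤n⇒m≤o⊔n (bound w) (s≤s (m≤n⊔m a b))
    p′ : to v a < to v b
    p′ rewrite swap-l a b | swap-r a b = p
    eq : suc (b ∸ suc a) + a ≡ b
    eq = trans (sym (+-suc (b ∸ suc a) a)) (m∸n+n≡m a<b)
    lemma : ∀ d → suc d + a ≡ b → to v a < to v b → inv M (to v) < inv M (to (v · ⦅ a , b ⦆))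
    lemma d refl q = inv-transposition d a v b<M q

open Inversions using (sorting; #inv≤length; #inv)

-- ℓ w is the length of a shortest expression of w in the simple transpositions; `shortest`
-- proves that there is one.

Shortest : S∞ → Word → Set
Shortest w a = wordProduct a ≈ₛ w × (∀ b → wordProduct b ≈ₛ w → length a ≤ length b)

shortest : ∀ w → ∃ λ a → Shortest w a
shortest w with sorting (#inv w) w refl
... | a , a≈w , len = a , a≈w , λ b b≈w → ≤-trans (≤-reflexive len) (#inv≤length w b b≈w)

ℓ : S∞ → ℕ
ℓ w = length (proj₁ (shortest w))

-- Finite sums are taken over duplicate-free lists of exactly the elements satisfying a
-- predicate.

record Enumeration {A : Set} (P : A → Set) : Set where
  field
    elements : List A
    unique   : Unique elements
    sound    : ∀ {x} → x ∈ elements → P x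
    complete : ∀ {x} → P x → x ∈ elements

open Enumeration public using (elements)

select : {A : Set} {P : A → Set} → Decidable P →
         (xs : List A) → Unique xs → (∀ {x} → P x → x ∈ xs) → Enumeration P
select P? xs xs! P⊆xs = record
  { elements = filter P? xs
  ; unique   = Unique.filter⁺ P? xs!
  ; sound    = λ x∈ → proj₂ (∈-filter⁻ P? {xs = xs} x∈)
  ; complete = λ Px → ∈-filter⁺ P? (P⊆xs Px) Px
  }

tuples : {A : Set} → ℕ → List A → List (List A)
tuples zero    xs = [ [] ]
tuples (suc p) xs = cartesianProductWith _∷_ xs (tuples p xs)

tuples! : {A : Set} (p : ℕ) {xs : List A} → Unique xs → Unique (tuples p xs)
tuples! zero    xs! = [] ∷ []
tuples! (suc p) xs! = Unique.cartesianProductWith⁺ _∷_ ∷-injective xs! (tuples! p xs!)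

∈-tuples : {A : Set} {xs ys : List A} → All (_∈ xs) ys → ys ∈ tuples (length ys) xs
∈-tuples []           = here refl
∈-tuples (y∈xs ∷ ys⊆) = ∈-cartesianProductWith⁺ _∷_ y∈xs (∈-tuples ys⊆)

Reduced : S∞ → Word → Set
Reduced w a = wordProduct a ≈ₛ w × length a ≡ ℓ w

-- The condition on i₁,…,iₚ in the Billey–Jockusch–Stanley formula. The orientation
-- iⱼ = iⱼ₊₁ ⇒ aⱼ > aⱼ₊₁ (equivalently aⱼ < aⱼ₊₁ ⇒ iⱼ < iⱼ₊₁) is theirs; reversing it would
-- give 𝔖 = 0 for the permutation with the single reduced word (2,1).

Step : ℕ × ℕ → ℕ × ℕ → Set
Step (i , a) (i′ , a′) = i ≤ i′ × (i ≡ i′ → a > a′)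

Compatible : Word → List ℕ → Set
Compatible a i = Pointwise _≤_ i a × Linked Step (zip i a)

-- The saturated chain u = v₀ → v₁ → ⋯ → vₚ = w with vⱼ = vⱼ₋₁ (aⱼ,bⱼ) is recorded by the
-- list of pairs (aⱼ,bⱼ), aⱼ < bⱼ, which determines it and is determined by it.

Cover : S∞ → ℕ × ℕ → Set
Cover u (a , b) = a < b × ℓ (u · ⦅ a , b ⦆) ≡ suc (ℓ u)

data Chain (w : S∞) : S∞ → List (ℕ × ℕ) → Set where
  stop : ∀ {u} → u ≈ₛ w → Chain w u []
  step : ∀ {u a b τ} → Cover u (a , b) → Chain w (u · ⦅ a , b ⦆) τ → Chain w u ((a , b) ∷ τ)

module Finiteness where

  open Inversions

  ℓ≡#inv : ∀ w → ℓ w ≡ #inv w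
  ℓ≡#inv w with sorting (#inv w) w refl
  ... | _ , _ , len = len

  ℓ-cong : ∀ u v → u ≈ₛ v → ℓ u ≡ ℓ v
  ℓ-cong u v eq = trans (ℓ≡#inv u) (trans (#inv-cong u v eq) (sym (ℓ≡#inv v)))

  init≈ : ∀ a w k → wordProduct (a ∷ʳ k) ≈ₛ w → wordProduct a ≈ₛ w · s k
  init≈ a w k prod n = trans (sym (·s·s (wordProduct a) k n))
    (trans (sym (wordProduct-∷ʳ a k (to (s k) n))) (prod (to (s k) n)))

  reduced-letters : ∀ {a} → Reverse a → ∀ {N} w → Fixes≥ N w →
                    wordProduct a ≈ₛ w → length a ≡ #inv w → All (_< N) a
  reduced-letters []             w fix prod len = []
  reduced-letters (a ∶ ra ∶ʳ k) {N} w fix prod len with ascent⊎descent w k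
  ... | inj₁ up = ⊥-elim (<-irrefl refl (begin-strict
    length a              <⟨ n<1+n _ ⟩
    suc (length a)        ≡⟨ length-∷ʳ a k ⟨
    length (a ∷ʳ k)       ≡⟨ len ⟩
    #inv w                <⟨ n<1+n _ ⟩
    suc (#inv w)          ≡⟨ #inv-ascent w up ⟨
    #inv (w · s k)        ≤⟨ #inv≤length (w · s k) a (init≈ a w k prod) ⟩
    length a              ∎))
    where open ≤-Reasoning
  ... | inj₂ down = ∷ʳ⁺
    (reduced-letters ra (w · s k) fix′ (init≈ a w k prod)
      (suc-injective (trans (sym (length-∷ʳ a k)) (trans len (sym (#inv-descent w down))))))
    (<-trans (n<1+n k) 1+k<N)
    where
    1+k<N = descent-bound w fix down
    fix′ : Fixes≥ N (w · s k)
    fix′ n N≤n = trans (cong (to w) (swap-≢ k (suc k)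
                         (>⇒≢ (<-≤-trans (<-trans (n<1+n k) 1+k<N) N≤n)) (>⇒≢ (<-≤-trans 1+k<N N≤n))))
                       (fix n N≤n)

  letters< : ∀ w {a} → Reduced w a → All (_< bound w) a
  letters< w {a} (prod , len) =
    reduced-letters (reverseView a) w (fixes w) prod (trans len (ℓ≡#inv w))

  cover-bound : ∀ {N a b} u → Cover u (a , b) → Fixes≥ N (u · ⦅ a , b ⦆) → b < N
  cover-bound {N} {a} {b} u (a<b , len) fix with b <? N
  ... | yes b<N = b<N
  ... | no  b≮N = ⊥-elim (<-asym (#inv-descending u a<b ub<ua) (begin-strict
    #inv u         <⟨ n<1+n _ ⟩
    suc (#inv u)   ≡⟨ cong suc (ℓ≡#inv u) ⟨
    suc (ℓ u)      ≡⟨ len ⟨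
    ℓ v            ≡⟨ ℓ≡#inv v ⟩
    #inv v         ∎))
    where
    open ≤-Reasoning
    v = u · ⦅ a , b ⦆
    va<b : to v a < b
    va<b with a <? N
    ... | yes a<N = <-≤-trans (preserves< v fix a<N) (≮⇒≥ b≮N)
    ... | no  a≮N = subst (_< b) (sym (fix a (≮⇒≥ a≮N))) a<b
    ua≡b : to u a ≡ b
    ua≡b = trans (cong (to u) (sym (swap-r a b))) (fix b (≮⇒≥ b≮N))
    ub<ua : to u b < to u a
    ub<ua = begin-strict
      to u b   ≡⟨ cong (to u) (swap-l a b) ⟨
      to v a   <⟨ va<b ⟩
      b        ≡⟨ ua≡b ⟨
      to u a   ∎

  InRange : ℕ → ℕ × ℕ → Set
  InRange N (a , b) = a < N × b < N

  chain-bound : ∀ {N w u τ} → Fixes≥ N w → Chain w u τ → Fixes≥ N u × All (InRange N) τ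
  chain-bound fix (stop u≈w) = (λ n N≤n → trans (u≈w n) (fix n N≤n)) , []
  chain-bound {N} {u = u} fix (step {a = a} {b} c@(a<b , _) τ) with chain-bound fix τ
  ... | fixv , τ< = fixu , (<-trans a<b b<N , b<N) ∷ τ<
    where
    b<N = cover-bound u c fixv
    fixu : Fixes≥ N u
    fixu n N≤n = trans (cong (to u) (sym (swap-≢ a b (>⇒≢ (<-≤-trans (<-trans a<b b<N) N≤n))
                                                     (>⇒≢ (<-≤-trans b<N N≤n)))))
                       (fixv n N≤n)

  chain-length : ∀ {w u τ} → Chain w u τ → ℓ w ≡ length τ + ℓ u
  chain-length {w} {u} (stop u≈w) = sym (ℓ-cong u w u≈w)
  chain-length {w} {u} {_ ∷ τ} (step (_ , len) c) =
    trans (chain-length c) (trans (cong (length τ +_) len) (+-suc _ _))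

  chain-length′ : ∀ {w u τ} → Chain w u τ → length τ ≡ ℓ w ∸ ℓ u
  chain-length′ {w} {u} {τ} c =
    sym (trans (cong (_∸ ℓ u) (chain-length c)) (m+n∸n≡m (length τ) (ℓ u)))

  all-∈-upTo : ∀ {N ns} → All (_< N) ns → All (_∈ upTo N) ns
  all-∈-upTo = All.map ∈-upTo⁺

  bounded : ∀ {N i a} → Pointwise _≤_ i a → All (_< N) a → All (_< N) i
  bounded []            []          = []
  bounded (i≤a ∷ i≤as) (a<N ∷ as<N) = ≤-<-trans i≤a a<N ∷ bounded i≤as as<N

  step? : ∀ x y → Dec (Step x y)
  step? (i , a) (i′ , a′) = (i ≤? i′) ×-dec ((i ≟ i′) →-dec (a′ <? a))

  reduced? : ∀ w → Decidable (Reduced w)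
  reduced? w a = (wordProduct a ≟ₛ w) ×-dec (length a ≟ ℓ w)

  compatible? : ∀ a i → Dec (Compatible a i)
  compatible? a i = Pointwise.decidable _≤?_ i a ×-dec linked? step? (zip i a)

  cover? : ∀ u t → Dec (Cover u t)
  cover? u (a , b) = (a <? b) ×-dec (ℓ (u · ⦅ a , b ⦆) ≟ suc (ℓ u))

  chain? : ∀ w u → Decidable (Chain w u)
  chain? w u []            = map′ stop (λ { (stop u≈w) → u≈w }) (u ≟ₛ w)
  chain? w u ((a , b) ∷ τ) = map′ (λ { (c , r) → step c r }) (λ { (step c r) → c , r })
                                  (cover? u (a , b) ×-dec chain? w (u · ⦅ a , b ⦆) τ)

open Finiteness using (reduced?; compatible?; chain?; letters<; bounded; all-∈-upTo;
                       chain-length′; chain-bound)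

compatiblePairs : ∀ w → Enumeration (λ (a , i) → Reduced w a × Compatible a i)
compatiblePairs w = select (λ (a , i) → reduced? w a ×-dec compatible? a i)
  (cartesianProduct words words) (Unique.cartesianProduct⁺ words! words!)
  λ { {a , i} (red@(_ , len) , pw , _) →
      ∈-cartesianProduct⁺
        (subst (λ p → a ∈ tuples p letters) len (∈-tuples (all-∈-upTo (letters< w red))))
        (subst (λ p → i ∈ tuples p letters) (trans (Pointwise-length pw) len)
               (∈-tuples (all-∈-upTo (bounded pw (letters< w red))))) }
  where
  letters = upTo (bound w)
  words   = tuples (ℓ w) letters
  words!  = tuples! (ℓ w) (Unique.upTo⁺ (bound w))

chains : ∀ u w → Enumeration (Chain w u)
chains u w = select (chain? w u) (tuples (ℓ w ∸ ℓ u) pairs)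
  (tuples! (ℓ w ∸ ℓ u) (Unique.cartesianProduct⁺ (Unique.upTo⁺ N) (Unique.upTo⁺ N)))
  λ {τ} c → subst (λ p → τ ∈ tuples p pairs) (chain-length′ c)
    (∈-tuples (All.map (λ (a<N , b<N) → ∈-cartesianProduct⁺ (∈-upTo⁺ a<N) (∈-upTo⁺ b<N))
                       (proj₂ (chain-bound (fixes w) c))))
  where
  N     = bound w
  pairs = cartesianProduct (upTo N) (upTo N)

-- Commutative rings in which every positive integer is invertible. Every field of
-- characteristic 0, in particular ℂ, is one.

record ℚ-Algebra c r : Set (Level.suc (c Level.⊔ r)) where
  field
    commutativeRing : CommutativeRing c r

  open CommutativeRing commutativeRing public
    using (Carrier; _≈_; 0#; 1#)
    renaming (_+_ to _+ᴷ_; _*_ to _*ᴷ_; -_ to -ᴷ_)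

  open RawMult (CommutativeRing.+-rawMonoid commutativeRing) public
    using () renaming (_×_ to _×ᴷ_)

  field
    1/_     : (n : ℕ) .{{_ : NonZero n}} → Carrier
    n×1/n≈1 : (n : ℕ) .{{_ : NonZero n}} → (n ×ᴷ 1#) *ᴷ (1/ n) ≈ 1#

module Polynomials {c r} (K : ℚ-Algebra c r) where

  open ℚ-Algebra K public

  sumᴷ : List Carrier → Carrier
  sumᴷ = foldr _+ᴷ_ 0#

  -- x_{i₁}⋯x_{iₚ} is the list of indices i₁,…,iₚ; the order is immaterial.

  Monomial : Set
  Monomial = List ℕ

  exponent : ℕ → Monomial → ℕ
  exponent i m = length (filter (i ≟_) m)

  infix 4 _∼_ _∼?_

  _∼_ : Monomial → Monomial → Set
  m ∼ n = ∀ i → exponent i m ≡ exponent i n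

  _∼?_ : ∀ m n → Dec (m ∼ n)
  m ∼? n = map′ extend (λ m∼n → All.universal m∼n (m ++ n))
                (all? (λ i → exponent i m ≟ exponent i n) (m ++ n))
    where
    absent : ∀ {i} m → ¬ i ∈ m → exponent i m ≡ 0
    absent {i} m i∉m = cong length (filter-none (i ≟_) (¬Any⇒All¬ m i∉m))
    extend : All (λ i → exponent i m ≡ exponent i n) (m ++ n) → m ∼ n
    extend eq i with i ∈? (m ++ n)
    ... | yes i∈ = All.lookup eq i∈
    ... | no  i∉ = trans (absent m (i∉ ∘ ∈-++⁺ˡ)) (sym (absent n (i∉ ∘ ∈-++⁺ʳ m)))

  -- K[x₀,x₁,…]: formal sums of terms, identified when all their coefficients agree.

  Poly : Set c
  Poly = List (Carrier × Monomial)

  coeff : Monomial → Poly → Carrier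
  coeff m f = sumᴷ (map proj₁ (filter (λ t → proj₂ t ∼? m) f))

  infix 4 _≈ₚ_

  _≈ₚ_ : Poly → Poly → Set r
  f ≈ₚ g = ∀ m → coeff m f ≈ coeff m g

  monomial : Monomial → Poly
  monomial m = [ 1# , m ]

  var : ℕ → Poly
  var i = monomial [ i ]

  infixl 6 _+ₚ_ _-ₚ_
  infixl 7 _*ₚ_ _•_

  _+ₚ_ : Poly → Poly → Poly
  _+ₚ_ = _++_

  _•_ : Carrier → Poly → Poly
  x • f = map (λ (y , m) → x *ᴷ y , m) f

  _-ₚ_ : Poly → Poly → Poly
  f -ₚ g = f +ₚ (-ᴷ 1#) • g

  _*ₚ_ : Poly → Poly → Poly
  _*ₚ_ = cartesianProductWith (λ (x , m) (y , n) → x *ᴷ y , m ++ n)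

  sumₚ : List Poly → Poly
  sumₚ = foldr _+ₚ_ []

  productₚ : List Poly → Poly
  productₚ = foldr _*ₚ_ (monomial [])

  evaluate : (ℕ → Carrier) → Poly → Carrier
  evaluate ρ f = sumᴷ (map (λ (x , m) → x *ᴷ foldr (λ i y → ρ i *ᴷ y) 1# m) f)

  -- ∂/∂xᵢ of a monomial, by the Leibniz rule.

  ∂ᵐ : ℕ → Monomial → List Monomial
  ∂ᵐ i []      = []
  ∂ᵐ i (j ∷ m) with i ≟ j
  ... | yes _ = m ∷ map (j ∷_) (∂ᵐ i m)
  ... | no  _ = map (j ∷_) (∂ᵐ i m)

  ∂ : ℕ → Poly → Poly
  ∂ i = concatMap (λ (x , m) → map (x ,_) (∂ᵐ i m))

  -- f (∂/∂x₀, ∂/∂x₁, …) g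

  infixr 8 _⟨∂⟩_

  _⟨∂⟩_ : Poly → Poly → Poly
  f ⟨∂⟩ g = concatMap (λ (x , m) → x • foldr ∂ g m) f

  ⟨_,_⟩ : Poly → Poly → Carrier
  ⟨ f , g ⟩ = evaluate (λ _ → 0#) (f ⟨∂⟩ g)

  𝔖 : S∞ → Poly
  𝔖 w = sumₚ (map (λ (a , i) → monomial i) (elements (compatiblePairs w)))

  μ : ℕ × ℕ → Poly
  μ (a , b) = var a -ₚ var b

  𝔇 : S∞ → S∞ → Poly
  𝔇 u w = (1/ (p !)) {{p !≢0}} • sumₚ (map (λ τ → productₚ (map μ τ)) (elements (chains u w)))
    where p = ℓ w ∸ ℓ u

  δ : S∞ → S∞ → Carrier
  δ u w = if does (u ≟ₛ w) then 1# else 0#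

  DualToSchubert : (S∞ → Poly) → Set r
  DualToSchubert D = ∀ u w → ⟨ 𝔖 u , D w ⟩ ≈ δ u w

{-# OPTIONS --safe #-}

-- Signed chain counts are iterated divided differences. Let E_w(x_{k₁}⋯x_{kₚ}) be the sum over
-- the saturated chains from 1 to w of ∏ⱼ (coefficient of x_{kⱼ} in μ of the j-th cover).
-- Comparing the covers below w and below w sᵢ gives E_w ∘ ∂ᵢ = E_{w sᵢ} if w has an ascent at i
-- and 0 otherwise; hence E_w is "apply ∂_w and set all variables to 0". In particular it is
-- symmetric in the variables, so pairing with 𝔇_{1,w} is E_w: the p! orderings cancel 1/p!.
--
-- On the other side ∂ᵢ 𝔖ᵤ = 𝔖_{u sᵢ} or 0. As for Fomin and Stanley, Σ 𝔖ᵤ u is a product of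
-- factors Aⱼ(x) = (1 + x u_{N−1})⋯(1 + x uⱼ) over the nilCoxeter algebra, and the identity
--   Aⱼ(x) Aⱼ(y) = Aⱼ₊₁(x) Aⱼ₊₁(y) (1 + (x + y) uⱼ + x y (uⱼ uⱼ₊₁ − uⱼ₊₁ uⱼ))
-- shows that Aⱼ(x) Aⱼ(y) is symmetric in x and y. So E_w(𝔖ᵤ) = δ by induction on the length.
--
-- Uniqueness: f − sⱼ f = (xⱼ − xⱼ₊₁) ∂ⱼ f lets each variable be moved to infinity, which yields
-- the Newton interpolation f = Σ_w E_w(f) 𝔖_w, so the Schubert polynomials span.

module Submission where

open import Defs
open import Algebra.Bundles using (CommutativeRing)
import Algebra.Properties.CommutativeSemigroup as CommutativeSemigroupProperties
import Algebra.Properties.Ring as RingProperties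
import Algebra.Properties.Semiring.Mult as Mult
import Algebra.Solver.Ring.NaturalCoefficients.Default as SemiringSolver
open import Data.Bool.Base using (if_then_else_)
open import Data.List.Base hiding (head; tail; product)
open import Data.List.Membership.DecPropositional using (_∈?_)
open import Data.List.Membership.Propositional using (_∈_)
open import Data.List.Membership.Propositional.Properties
open import Data.List.Membership.Propositional.Properties.WithK using (unique∧set⇒bag)
open import Data.List.Properties
  using (map-++; ++-assoc; ++-identityʳ; foldl-++; length-++; length-map; reverse-++;
         filter-accept; filter-reject; filter-none; ∷-injectiveʳ)
open import Data.List.Relation.Binary.BagAndSetEquality using (∼bag⇒↭)
open import Data.List.Relation.Binary.Permutation.Propositional
  using (_↭_; ↭-sym)
  renaming (refl to ↭refl; prep to ↭prep; swap to ↭swap; trans to ↭trans)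
open import Data.List.Relation.Binary.Permutation.Propositional.Properties
  using (shift; ↭-length; ↭-reverse; filter-↭; ∷↭∷ʳ)
open import Data.List.Relation.Binary.Pointwise using (Pointwise; []; _∷_; Pointwise-length)
open import Data.List.Relation.Unary.All as All using (All; []; _∷_)
import Data.List.Relation.Unary.All.Properties as All
open import Data.List.Relation.Unary.AllPairs as AllPairs using (AllPairs; []; _∷_)
import Data.List.Relation.Unary.AllPairs.Properties as AllPairs
open import Data.List.Relation.Unary.Any as Any using (Any; here; there)
import Data.List.Relation.Unary.Any.Properties as Any
open import Data.List.Relation.Unary.Linked using (Linked)
open import Data.List.Relation.Unary.Linked.Properties using (Linked⇒AllPairs; AllPairs⇒Linked)
open import Data.List.Relation.Unary.Unique.Propositional using (Unique)
import Data.List.Relation.Unary.Unique.Propositional.Properties as Unique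
open import Data.List.Reverse using (Reverse; reverseView; _∶_∶ʳ_; [])
open import Data.Nat.Base as ℕ using (ℕ; zero; suc; _<_; _≤_)
import Data.Nat.Properties as ℕ
open import Data.Nat.Properties using (_≟_; _<?_)
open import Data.Product.Base using (∃; _×_; _,_; proj₁; proj₂)
open import Data.Product.Properties using (≡-dec)
open import Data.Sum.Base using (_⊎_; inj₁; inj₂)
open import Function.Base using (_∘_; id)
open import Function.Bundles using (mk⇔)
open import Level using (Level; _⊔_)
open import Relation.Binary.Bundles using (Setoid)
open import Relation.Binary.Definitions using (tri<; tri≈; tri>)
open import Relation.Binary.PropositionalEquality as ≡
  using (_≡_; _≢_; cong; cong₂; subst; subst₂)
import Relation.Binary.Reasoning.Setoid as SetoidReasoning
open import Relation.Nullary.Decidable using (Dec; yes; no; does; map′; _×-dec_)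
open import Relation.Nullary.Negation using (¬_; contradiction)
open Inversions
open Finiteness using (init≈; ℓ≡#inv; chain?)

-- Divided differences, multiplication by a variable and partial derivatives are all transposed to
-- linear functionals on monomials, where they are recursions on a word of variables: no division by
-- `xᵢ - xᵢ₊₁` and no quotient of polynomials occurs. The price is that a functional makes sense on
-- commuting variables only if it is `Symmetric`, so symmetry is carried as a hypothesis, and for
-- chain counts it is a theorem.
--
-- Multiplication by a product P of Fomin-Stanley factors commutes with the transpose of ∂ᵢ when
-- ∂ᵢ(P f) = P ∂ᵢ f for all f, that is, when P is symmetric in xᵢ and xᵢ₊₁. Only two rows of the
-- triangular product involve these variables, and the second is one factor short of making the pair
-- symmetric; that missing factor is the source of the generator uᵢ in ∂ᵢ 𝔖ᵤ.
--
-- All sums are truncated at a bound on the support. The interpolation formula runs over sublists of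
-- the same triangle of factors as 𝔖, so grouping its terms by permutation produces Schubert
-- polynomials. Positive integers are inverted twice: for 1/p!, and to recover a coefficient from a
-- pairing with a monomial.

-- Finite sums and Iverson brackets.

module Sums {c r} (R : CommutativeRing c r) where

  open CommutativeRing R public
  open RingProperties ring public
    using (-‿distribˡ-*; -‿distribʳ-*; -‿+-comm; -0#≈0#; -1*x≈-x; x∙y⁻¹≈ε⇒x≈y; -‿involutive)
  open CommutativeSemigroupProperties +-commutativeSemigroup public using (interchange)
  module *-Semigroup = CommutativeSemigroupProperties *-commutativeSemigroup
  open *-Semigroup public using (x∙yz≈y∙xz)
  module ≈-Reasoning = SetoidReasoning setoid
  module Solver = SemiringSolver commutativeSemiring

  0+0≈0 : 0# + 0# ≈ 0#
  0+0≈0 = +-identityˡ 0#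

  ∑ : ∀ {a} {A : Set a} → List A → (A → Carrier) → Carrier
  ∑ xs f = foldr _+_ 0# (map f xs)

  module _ {a} {A : Set a} where

    ∑-cong∈ : ∀ (xs : List A) {f g} → (∀ x → x ∈ xs → f x ≈ g x) → ∑ xs f ≈ ∑ xs g
    ∑-cong∈ []       f≈g = refl
    ∑-cong∈ (x ∷ xs) f≈g = +-cong (f≈g x (here ≡.refl)) (∑-cong∈ xs λ y → f≈g y ∘ there)

    ∑-cong : ∀ (xs : List A) {f g} → (∀ x → f x ≈ g x) → ∑ xs f ≈ ∑ xs g
    ∑-cong xs f≈g = ∑-cong∈ xs λ x _ → f≈g x

    ∑-0 : ∀ (xs : List A) {f} → (∀ x → f x ≈ 0#) → ∑ xs f ≈ 0#
    ∑-0 []       f≈0 = refl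
    ∑-0 (x ∷ xs) f≈0 = trans (+-cong (f≈0 x) (∑-0 xs f≈0)) 0+0≈0

    ∑-+ : ∀ (xs : List A) f g → ∑ xs (λ x → f x + g x) ≈ ∑ xs f + ∑ xs g
    ∑-+ []       f g = sym 0+0≈0
    ∑-+ (x ∷ xs) f g = trans (+-congˡ (∑-+ xs f g)) (interchange _ _ _ _)

    ∑-*ˡ : ∀ c (xs : List A) f → ∑ xs (λ x → c * f x) ≈ c * ∑ xs f
    ∑-*ˡ c []       f = sym (zeroʳ c)
    ∑-*ˡ c (x ∷ xs) f = trans (+-congˡ (∑-*ˡ c xs f)) (sym (distribˡ c _ _))

    ∑-*ʳ : ∀ c (xs : List A) f → ∑ xs (λ x → f x * c) ≈ ∑ xs f * c
    ∑-*ʳ c xs f = trans (∑-cong xs λ x → *-comm _ c) (trans (∑-*ˡ c xs f) (*-comm c _))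

    ∑-++ : ∀ (xs ys : List A) f → ∑ (xs ++ ys) f ≈ ∑ xs f + ∑ ys f
    ∑-++ []       ys f = sym (+-identityˡ _)
    ∑-++ (x ∷ xs) ys f = trans (+-congˡ (∑-++ xs ys f)) (sym (+-assoc _ _ _))

    ∑-↭ : ∀ {xs ys : List A} f → xs ↭ ys → ∑ xs f ≈ ∑ ys f
    ∑-↭ f ↭refl          = refl
    ∑-↭ f (↭prep x p)    = +-congˡ (∑-↭ f p)
    ∑-↭ f (↭swap x y p)  = trans (+-congˡ (+-congˡ (∑-↭ f p)))
      (trans (sym (+-assoc _ _ _)) (trans (+-congʳ (+-comm _ _)) (+-assoc _ _ _)))
    ∑-↭ f (↭trans p q)   = trans (∑-↭ f p) (∑-↭ f q)

    ∑-map : ∀ {b} {B : Set b} (h : B → A) xs f → ∑ (map h xs) f ≈ ∑ xs (f ∘ h)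
    ∑-map h []       f = refl
    ∑-map h (x ∷ xs) f = +-congˡ (∑-map h xs f)

    ∑-concatMap : ∀ {b} {B : Set b} (h : B → List A) xs f →
                  ∑ (concatMap h xs) f ≈ ∑ xs (λ x → ∑ (h x) f)
    ∑-concatMap h []       f = refl
    ∑-concatMap h (x ∷ xs) f = trans (∑-++ (h x) _ f) (+-congˡ (∑-concatMap h xs f))

  ∑-swap : ∀ {a b} {A : Set a} {B : Set b} (xs : List A) (ys : List B) (f : A → B → Carrier) →
           ∑ xs (λ x → ∑ ys (f x)) ≈ ∑ ys (λ y → ∑ xs (λ x → f x y))
  ∑-swap []       ys f = sym (∑-0 ys λ _ → refl)
  ∑-swap (x ∷ xs) ys f = trans (+-congˡ (∑-swap xs ys f))
    (sym (∑-+ ys (f x) λ y → ∑ xs λ x → f x y))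

  ∑-product : ∀ {a b d} {A : Set a} {B : Set b} {D : Set d} (h : A → B → D) xs ys f →
              ∑ (cartesianProductWith h xs ys) f ≈ ∑ xs (λ x → ∑ ys (λ y → f (h x y)))
  ∑-product h []       ys f = refl
  ∑-product h (x ∷ xs) ys f = trans (∑-++ (map (h x) ys) _ f)
    (+-cong (∑-map (h x) ys f) (∑-product h xs ys f))

  ⟦_⟧ : ∀ {p} {P : Set p} → Dec P → Carrier
  ⟦ P? ⟧ = if does P? then 1# else 0#

  private variable
    p q : Level
    P : Set p
    Q : Set q

  ⟦⟧-yes : (P? : Dec P) → P → ⟦ P? ⟧ ≈ 1#
  ⟦⟧-yes (yes _) _  = refl
  ⟦⟧-yes (no ¬p) p = contradiction p ¬p

  ⟦⟧-no : (P? : Dec P) → ¬ P → ⟦ P? ⟧ ≈ 0#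
  ⟦⟧-no (yes p) ¬p = contradiction p ¬p
  ⟦⟧-no (no _)  _  = refl

  ⟦⟧-⇔ : (P? : Dec P) (Q? : Dec Q) → (P → Q) → (Q → P) → ⟦ P? ⟧ ≈ ⟦ Q? ⟧
  ⟦⟧-⇔ (yes p) Q? f g = sym (⟦⟧-yes Q? (f p))
  ⟦⟧-⇔ (no ¬p) Q? f g = sym (⟦⟧-no Q? (¬p ∘ g))

  ⟦⟧-× : (P? : Dec P) (Q? : Dec Q) → ⟦ P? ×-dec Q? ⟧ ≈ ⟦ P? ⟧ * ⟦ Q? ⟧
  ⟦⟧-× (yes _) Q? = sym (*-identityˡ _)
  ⟦⟧-× (no _)  Q? = sym (zeroˡ _)

  ⟦⟧-cong : (P? : Dec P) {x y : Carrier} → (P → x ≈ y) → ⟦ P? ⟧ * x ≈ ⟦ P? ⟧ * y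
  ⟦⟧-cong (yes p) f = *-congˡ (f p)
  ⟦⟧-cong (no ¬p) f = trans (zeroˡ _) (sym (zeroˡ _))

  ⟦⟧-0 : (P? : Dec P) {x : Carrier} → (P → x ≈ 0#) → ⟦ P? ⟧ * x ≈ 0#
  ⟦⟧-0 P? f = trans (⟦⟧-cong P? f) (zeroʳ _)

  ∑-filter : ∀ {a p} {A : Set a} {P : A → Set p} (P? : ∀ x → Dec (P x)) xs f →
             ∑ (filter P? xs) f ≈ ∑ xs (λ x → ⟦ P? x ⟧ * f x)
  ∑-filter P? []       f = refl
  ∑-filter P? (x ∷ xs) f with P? x
  ... | yes _ = +-cong (sym (*-identityˡ _)) (∑-filter P? xs f)
  ... | no  _ = trans (∑-filter P? xs f)
                      (trans (sym (+-identityˡ _)) (+-congʳ (sym (zeroˡ _))))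

-- Adjacent transpositions acting on indices.

swap-injective : ∀ a b {m n} → swap a b m ≡ swap a b n → m ≡ n
swap-injective a b {m} {n} eq = ≡.trans (≡.sym (swap-involutive a b m))
  (≡.trans (cong (swap a b) eq) (swap-involutive a b n))

σ : ℕ → ℕ → ℕ
σ i = swap i (suc i)

σ-l : ∀ i → σ i i ≡ suc i
σ-l i = swap-l i (suc i)

σ-r : ∀ i → σ i (suc i) ≡ i
σ-r i = swap-r i (suc i)

data Adjacent (i : ℕ) : ℕ → Set where
  first  : Adjacent i i
  second : Adjacent i (suc i)
  other  : ∀ {j} → j ≢ i → j ≢ suc i → Adjacent i j

adjacent : ∀ i j → Adjacent i j
adjacent i j with j ≟ i | j ≟ suc i
... | yes ≡.refl | _          = first
... | no _       | yes ≡.refl = second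
... | no j≢i     | no j≢1+i   = other j≢i j≢1+i

-- Functionals on monomials and transposed divided differences.

module Functionals {c r} (R : CommutativeRing c r) where

  open Sums R public
  open ≈-Reasoning

  -- A linear functional on polynomials is given by its values on monomials, which are lists
  -- of variables in arbitrary order.

  Functional : Set c
  Functional = List ℕ → Carrier

  infix 4 _≐_
  _≐_ : Functional → Functional → Set r
  φ ≐ ψ = ∀ m → φ m ≈ ψ m

  Symmetric : Functional → Set r
  Symmetric φ = ∀ {m n} → m ↭ n → φ m ≈ φ n

  κ : ℕ → ℕ → Carrier
  κ k a = ⟦ k ≟ a ⟧

  sgn : ℕ → ℕ × ℕ → Carrier
  sgn k (a , b) = κ k a - κ k b

  κ-≡ : ∀ k → κ k k ≈ 1#
  κ-≡ k = ⟦⟧-yes (k ≟ k) ≡.refl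

  κ-≢ : ∀ k a → k ≢ a → κ k a ≈ 0#
  κ-≢ k a = ⟦⟧-no (k ≟ a)

  0-0≈0 : 0# - 0# ≈ 0#
  0-0≈0 = -‿inverseʳ 0#

  sgn-first : ∀ i → sgn i (i , suc i) ≈ 1#
  sgn-first i = trans (+-cong (κ-≡ i) (trans (-‿cong (κ-≢ i (suc i) (ℕ.1+n≢n ∘ ≡.sym))) -0#≈0#))
                      (+-identityʳ 1#)

  sgn-second : ∀ i → sgn (suc i) (i , suc i) ≈ - 1#
  sgn-second i = trans (+-cong (κ-≢ (suc i) i ℕ.1+n≢n) (-‿cong (κ-≡ (suc i)))) (+-identityˡ _)

  sgn-other : ∀ k a b → k ≢ a → k ≢ b → sgn k (a , b) ≈ 0#
  sgn-other k a b k≢a k≢b = trans (+-cong (κ-≢ k a k≢a) (-‿cong (κ-≢ k b k≢b))) 0-0≈0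

  sgn-σ : ∀ i k a b → sgn (σ i k) (σ i a , σ i b) ≈ sgn k (a , b)
  sgn-σ i k a b = +-cong (κ-σ a) (-‿cong (κ-σ b))
    where
    κ-σ : ∀ a → κ (σ i k) (σ i a) ≈ κ k a
    κ-σ a = ⟦⟧-⇔ (σ i k ≟ σ i a) (k ≟ a) (swap-injective i (suc i)) (cong (σ i))

  sgn-flip : ∀ k a b → sgn k (b , a) ≈ - sgn k (a , b)
  sgn-flip k a b = trans (+-comm _ _)
    (trans (+-congˡ (sym (-‿involutive _))) (-‿+-comm (κ k a) (- κ k b)))

  sgn-σ-simple : ∀ i k → sgn (σ i k) (i , suc i) ≈ - sgn k (i , suc i)
  sgn-σ-simple i k = trans (sym (reflexive (cong₂ (λ a b → sgn (σ i k) (a , b)) (σ-r i) (σ-l i))))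
    (trans (sgn-σ i k (suc i) i) (sgn-flip k i (suc i)))

  -- The coefficient of the ordered word in the noncommutative expansion of the product of the
  -- `μ t`: the j-th letter is taken from the j-th factor.
  signs : List ℕ → List (ℕ × ℕ) → Carrier
  signs []      []      = 1#
  signs (k ∷ m) (t ∷ τ) = sgn k t * signs m τ
  signs _       _       = 0#

  -- The constant term, written as the fold that `evaluate` performs at the zero point, so that
  -- `lin ct` below agrees with it by definition.
  ct : Functional
  ct = foldr (λ _ y → 0# * y) 1#

  ct-∷ : ∀ k m → ct (k ∷ m) ≈ 0#
  ct-∷ k m = zeroˡ _

  ct-symmetric : Symmetric ct
  ct-symmetric ↭refl        = refl
  ct-symmetric (↭prep x p)  = *-congˡ (ct-symmetric p)
  ct-symmetric (↭swap x y p) = trans (zeroˡ _) (sym (zeroˡ _))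
  ct-symmetric (↭trans p q) = trans (ct-symmetric p) (ct-symmetric q)

  Symmetric-cong : ∀ {φ ψ} → φ ≐ ψ → Symmetric φ → Symmetric ψ
  Symmetric-cong φ≐ψ sφ {m} {n} p = trans (sym (φ≐ψ m)) (trans (sφ p) (φ≐ψ n))

  -- The transpose φ ↦ φ ∘ ∂ᵢ of the divided difference ∂ᵢ, through the twisted Leibniz rule
  -- ∂ᵢ (xⱼ f) = (∂ᵢ xⱼ) f + x_{sᵢ j} ∂ᵢ f.

  dd : ℕ → Functional → Functional
  dd i φ []      = 0#
  dd i φ (j ∷ m) = sgn j (i , suc i) * φ m + dd i (φ ∘ (σ i j ∷_)) m

  dd-cong : ∀ i {φ ψ} → φ ≐ ψ → dd i φ ≐ dd i ψ
  dd-cong i φ≐ψ []      = refl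
  dd-cong i φ≐ψ (j ∷ m) = +-cong (*-congˡ (φ≐ψ m)) (dd-cong i (λ n → φ≐ψ (σ i j ∷ n)) m)

  dd-+ : ∀ i φ ψ m → dd i (λ n → φ n + ψ n) m ≈ dd i φ m + dd i ψ m
  dd-+ i φ ψ []      = sym 0+0≈0
  dd-+ i φ ψ (j ∷ m) = trans (+-cong (distribˡ _ _ _) (dd-+ i _ _ m)) (interchange _ _ _ _)

  dd-*ˡ : ∀ i x φ m → dd i (λ n → x * φ n) m ≈ x * dd i φ m
  dd-*ˡ i x φ []      = sym (zeroʳ x)
  dd-*ˡ i x φ (j ∷ m) = trans (+-cong (x∙yz≈y∙xz _ _ _) (dd-*ˡ i x _ m)) (sym (distribˡ x _ _))

  dd-0 : ∀ i {φ} → (∀ m → φ m ≈ 0#) → ∀ m → dd i φ m ≈ 0#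
  dd-0 i φ≈0 []      = refl
  dd-0 i φ≈0 (j ∷ m) = trans
    (+-cong (trans (*-congˡ (φ≈0 m)) (zeroʳ _)) (dd-0 i (λ n → φ≈0 (σ i j ∷ n)) m)) 0+0≈0

  dd-∑ : ∀ i {a} {A : Set a} (xs : List A) (φ : A → Functional) m →
         dd i (λ n → ∑ xs λ x → φ x n) m ≈ ∑ xs (λ x → dd i (φ x) m)
  dd-∑ i []       φ m = dd-0 i (λ _ → refl) m
  dd-∑ i (x ∷ xs) φ m = trans (dd-+ i _ _ m) (+-congˡ (dd-∑ i xs φ m))

  dd-first : ∀ i φ m → dd i φ (i ∷ m) ≈ φ m + dd i (φ ∘ (suc i ∷_)) m
  dd-first i φ m = +-cong (trans (*-congʳ (sgn-first i)) (*-identityˡ _))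
    (reflexive (cong (λ j → dd i (φ ∘ (j ∷_)) m) (σ-l i)))

  dd-second : ∀ i φ m → dd i φ (suc i ∷ m) ≈ - φ m + dd i (φ ∘ (i ∷_)) m
  dd-second i φ m = +-cong (trans (*-congʳ (sgn-second i)) (-1*x≈-x _))
    (reflexive (cong (λ j → dd i (φ ∘ (j ∷_)) m) (σ-r i)))

  dd-other : ∀ i φ {j} m → j ≢ i → j ≢ suc i → dd i φ (j ∷ m) ≈ dd i (φ ∘ (j ∷_)) m
  dd-other i φ {j} m p q = trans (+-cong (trans (*-congʳ (sgn-other j i (suc i) p q)) (zeroˡ _))
    (reflexive (cong (λ j → dd i (φ ∘ (j ∷_)) m) (swap-≢ i (suc i) p q)))) (+-identityˡ _)

  Symmetric-∷ : ∀ {φ} k → Symmetric φ → Symmetric (φ ∘ (k ∷_))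
  Symmetric-∷ k sφ p = sφ (↭prep k p)

  private
    cancel : ∀ i x → sgn i (i , suc i) * x + sgn (suc i) (i , suc i) * x ≈ 0#
    cancel i x = trans (sym (distribʳ x (sgn i (i , suc i)) (sgn (suc i) (i , suc i)))) (trans (*-congʳ
      (trans (+-cong (sgn-first i) (sgn-second i)) (-‿inverseʳ 1#))) (zeroˡ x))

    vanish : ∀ i j → j ≢ i → j ≢ suc i → ∀ x → sgn j (i , suc i) * x ≈ 0#
    vanish i j p q x = trans (*-congʳ (sgn-other j i (suc i) p q)) (zeroˡ x)

    -- Both sides equal ∂ᵢ(xⱼ xₖ), expanded in either order.
    exchange : ∀ i (φ : Functional) j k m →
      sgn j (i , suc i) * φ (k ∷ m) + sgn k (i , suc i) * φ (σ i j ∷ m) ≈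
      sgn k (i , suc i) * φ (j ∷ m) + sgn j (i , suc i) * φ (σ i k ∷ m)
    exchange i φ j k m with adjacent i j | adjacent i k
    ... | first  | first  = refl
    ... | second | second = refl
    ... | first  | second = trans
      (trans (+-congˡ (*-congˡ (reflexive (cong (φ ∘ (_∷ m)) (σ-l i))))) (cancel i (φ (suc i ∷ m))))
      (sym (trans (+-comm _ _) (trans (+-congʳ (*-congˡ (reflexive (cong (φ ∘ (_∷ m)) (σ-r i)))))
                                      (cancel i (φ (i ∷ m))))))
    ... | second | first  = trans
      (trans (+-comm _ _) (trans (+-congʳ (*-congˡ (reflexive (cong (φ ∘ (_∷ m)) (σ-r i)))))
                                 (cancel i (φ (i ∷ m)))))
      (sym (trans (+-congˡ (*-congˡ (reflexive (cong (φ ∘ (_∷ m)) (σ-l i))))) (cancel i (φ (suc i ∷ m)))))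
    ... | other p q | _ = trans (+-comm _ _) (+-cong
      (*-congˡ (reflexive (cong (φ ∘ (_∷ m)) (swap-≢ i (suc i) p q))))
      (trans (vanish i j p q (φ (k ∷ m))) (sym (vanish i j p q (φ (σ i k ∷ m))))))
    ... | _ | other p q = trans (+-comm _ _) (+-cong
      (trans (vanish i k p q (φ (σ i j ∷ m))) (sym (vanish i k p q (φ (j ∷ m)))))
      (*-congˡ (reflexive (cong (φ ∘ (_∷ m)) (≡.sym (swap-≢ i (suc i) p q))))))

  -- Only exchanging the two leading letters needs an argument: the two Leibniz terms are matched by
  -- `exchange`, and in the remaining term the two twisted letters are exchanged by the symmetry of
  -- `φ`.
  dd-symmetric : ∀ i {φ} → Symmetric φ → Symmetric (dd i φ)
  dd-symmetric i sφ ↭refl = refl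
  dd-symmetric i sφ (↭prep j p) =
    +-cong (*-congˡ (sφ p)) (dd-symmetric i (Symmetric-∷ (σ i j) sφ) p)
  dd-symmetric i sφ (↭trans p q) = trans (dd-symmetric i sφ p) (dd-symmetric i sφ q)
  dd-symmetric i {φ} sφ (↭swap {m} {n} j k p) = begin
    dd i φ (j ∷ k ∷ m)
      ≈⟨ +-assoc (sgn j t * φ (k ∷ m)) (sgn k t * φ (σ i j ∷ m)) _ ⟨
    (sgn j t * φ (k ∷ m) + sgn k t * φ (σ i j ∷ m)) + dd i (φ ∘ (σ i j ∷_) ∘ (σ i k ∷_)) m
      ≈⟨ +-cong (exchange i φ j k m) (dd-cong i (λ _ → sφ (↭swap _ _ ↭refl)) m) ⟩
    (sgn k t * φ (j ∷ m) + sgn j t * φ (σ i k ∷ m)) + dd i (φ ∘ (σ i k ∷_) ∘ (σ i j ∷_)) m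
      ≈⟨ +-cong (+-cong (*-congˡ (sφ (↭prep j p))) (*-congˡ (sφ (↭prep (σ i k) p))))
                (dd-symmetric i (Symmetric-∷ (σ i j) (Symmetric-∷ (σ i k) sφ)) p) ⟩
    (sgn k t * φ (j ∷ n) + sgn j t * φ (σ i k ∷ n)) + dd i (φ ∘ (σ i k ∷_) ∘ (σ i j ∷_)) n
      ≈⟨ +-assoc (sgn k t * φ (j ∷ n)) (sgn j t * φ (σ i k ∷ n)) _ ⟩
    dd i φ (k ∷ j ∷ n) ∎
    where t = i , suc i

-- Ascents, descents and Bruhat covers.

≈ₛ-sym : ∀ u v → u ≈ₛ v → v ≈ₛ u
≈ₛ-sym u v u≈v n = ≡.sym (u≈v n)

≈ₛ-trans : ∀ u v w → u ≈ₛ v → v ≈ₛ w → u ≈ₛ w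
≈ₛ-trans u v w u≈v v≈w n = ≡.trans (u≈v n) (v≈w n)

·-congʳ : ∀ u v w → u ≈ₛ v → u · w ≈ₛ v · w
·-congʳ u v w u≈v n = u≈v (to w n)

·⦅⦆-involutive : ∀ u a b → u · ⦅ a , b ⦆ · ⦅ a , b ⦆ ≈ₛ u
·⦅⦆-involutive u a b n = cong (to u) (swap-involutive a b n)

tr : ℕ × ℕ → S∞
tr (a , b) = ⦅ a , b ⦆

Asc Desc : ℕ → S∞ → Set
Asc  i u = to u i < to u (suc i)
Desc i u = to u (suc i) < to u i

asc? : ∀ i u → Dec (Asc i u)
asc? i u = to u i <? to u (suc i)

Asc-cong : ∀ i u v → u ≈ₛ v → Asc i u → Asc i v
Asc-cong i u v u≈v = subst₂ _<_ (u≈v i) (u≈v (suc i))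

Desc-cong : ∀ i u v → u ≈ₛ v → Desc i u → Desc i v
Desc-cong i u v u≈v = subst₂ _<_ (u≈v (suc i)) (u≈v i)

Asc⇒¬Desc : ∀ i u → Asc i u → ¬ Desc i u
Asc⇒¬Desc i u = ℕ.<-asym

¬Asc⇒Desc : ∀ i u → ¬ Asc i u → Desc i u
¬Asc⇒Desc i u ¬asc with ascent⊎descent u i
... | inj₁ asc  = contradiction asc ¬asc
... | inj₂ desc = desc

¬Desc⇒Asc : ∀ i u → ¬ Desc i u → Asc i u
¬Desc⇒Asc i u ¬desc with ascent⊎descent u i
... | inj₁ asc  = asc
... | inj₂ desc = contradiction desc ¬desc

·s-Asc : ∀ i u → Desc i u → Asc i (u · s i)
·s-Asc i u = subst₂ _<_ (cong (to u) (≡.sym (σ-l i))) (cong (to u) (≡.sym (σ-r i)))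

·s-Desc : ∀ i u → Asc i u → Desc i (u · s i)
·s-Desc i u = subst₂ _<_ (cong (to u) (≡.sym (σ-r i))) (cong (to u) (≡.sym (σ-l i)))

#inv-ascending : ∀ w {a b} → a < b → to w a < to w b → #inv w < #inv (w · ⦅ a , b ⦆)
#inv-ascending w {a} {b} a<b p = subst (_< #inv v) (#inv-cong (v · ⦅ a , b ⦆) w (·⦅⦆-involutive w a b))
  (#inv-descending v a<b (subst₂ _<_ (cong (to w) (≡.sym (swap-r a b))) (cong (to w) (≡.sym (swap-l a b))) p))
  where v = w · ⦅ a , b ⦆

swap-natural : (π : ℕ → ℕ) → (∀ {m n} → π m ≡ π n → m ≡ n) →
               ∀ a b n → swap (π a) (π b) (π n) ≡ π (swap a b n)
swap-natural π inj a b n with n ≟ a | n ≟ b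
... | yes ≡.refl | _          = swap-l (π n) (π b)
... | no _       | yes ≡.refl = swap-r (π a) (π n)
... | no n≢a     | no n≢b     = swap-≢ (π a) (π b) (n≢a ∘ inj) (n≢b ∘ inj)

-- Records, because the length ℓ, and hence Cover, unfolds badly during conversion checking.

record Up (u : S∞) (t : ℕ × ℕ) : Set where
  constructor up
  field
    ordered   : proj₁ t < proj₂ t
    increment : #inv (u · tr t) ≡ suc (#inv u)

record Down (w : S∞) (t : ℕ × ℕ) : Set where
  constructor down
  field
    ordered   : proj₁ t < proj₂ t
    decrement : #inv w ≡ suc (#inv (w · tr t))

Cover⇒Up : ∀ u t → Cover u t → Up u t
Cover⇒Up u t cov = up (proj₁ cov)
  (≡.trans (≡.sym (ℓ≡#inv (u · tr t))) (≡.trans (proj₂ cov) (cong suc (ℓ≡#inv u))))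

Up⇒Cover : ∀ u t → Up u t → Cover u t
Up⇒Cover u t (up a<b eq) =
  a<b , ≡.trans (ℓ≡#inv (u · tr t)) (≡.trans eq (cong suc (≡.sym (ℓ≡#inv u))))

·tr-involutive : ∀ u t → u · tr t · tr t ≈ₛ u
·tr-involutive u (a , b) = ·⦅⦆-involutive u a b

Down⇒Up : ∀ w t → Down w t → Up (w · tr t) t
Down⇒Up w t (down a<b eq) =
  up a<b (≡.trans (#inv-cong (w · tr t · tr t) w (·tr-involutive w t)) eq)

Up-cong : ∀ u v t → u ≈ₛ v → Up u t → Up v t
Up-cong u v t u≈v (up a<b eq) = up a<b
  (≡.trans (≡.sym (#inv-cong (u · tr t) (v · tr t) (·-congʳ u v (tr t) u≈v)))
           (≡.trans eq (cong suc (#inv-cong u v u≈v))))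

Down-cong : ∀ v w t → v ≈ₛ w → Down v t → Down w t
Down-cong v w t v≈w (down a<b eq) = down a<b
  (≡.trans (≡.sym (#inv-cong v w v≈w))
           (≡.trans eq (cong suc (#inv-cong (v · tr t) (w · tr t) (·-congʳ v w (tr t) v≈w)))))

Up⇒Down : ∀ u w t → u · tr t ≈ₛ w → Up u t → Down w t
Up⇒Down u w t ut≈w (up a<b eq) = down a<b
  (≡.trans (≡.sym (#inv-cong (u · tr t) w ut≈w)) (≡.trans eq (cong suc (#inv-cong u (w · tr t)
    λ n → ≡.trans (≡.sym (·tr-involutive u t n)) (ut≈w (to (tr t) n))))))

cover-increasing : ∀ u {a b} → Up u (a , b) → to u a < to u b
cover-increasing u {a} {b} (up a<b eq) with ℕ.<-cmp (to u a) (to u b)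
... | tri< p _ _ = p

... | tri≈ _ p _ = contradiction (to-injective u p) (ℕ.<⇒≢ a<b)
... | tri> _ _ p = contradiction (#inv-descending u a<b p)
                     (ℕ.<-asym (subst (#inv u <_) (≡.sym eq) (ℕ.n<1+n _)))

-- (a b) = (a c)(c b)(a c), and each of the three factors increases the length.
no-value-between : ∀ u {a b} c → Up u (a , b) → a < c → c < b →
                   to u a < to u c → ¬ to u c < to u b
no-value-between u {a} {b} c (up a<b eq) a<c c<b ua<uc uc<ub = ℕ.<-irrefl ≡.refl (begin-strict
  suc (#inv u)                 ≤⟨ #inv-ascending u a<c ua<uc ⟩
  #inv u₁                      <⟨ #inv-ascending u₁ c<b u₁c<u₁b ⟩
  #inv u₂                      <⟨ #inv-ascending u₂ a<c u₂a<u₂c ⟩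
  #inv (u₂ · ⦅ a , c ⦆)        ≡⟨ #inv-cong (u₂ · ⦅ a , c ⦆) (u · ⦅ a , b ⦆) conj ⟩
  #inv (u · ⦅ a , b ⦆)         ≡⟨ eq ⟩
  suc (#inv u)                 ∎)
  where
  open ℕ.≤-Reasoning
  u₁ = u · ⦅ a , c ⦆
  u₂ = u₁ · ⦅ c , b ⦆
  b-fixed : swap a c b ≡ b
  b-fixed = swap-≢ a c (ℕ.>⇒≢ a<b) (ℕ.>⇒≢ c<b)
  a-fixed : swap c b a ≡ a
  a-fixed = swap-≢ c b (ℕ.<⇒≢ a<c) (ℕ.<⇒≢ a<b)
  u₁c<u₁b : to u₁ c < to u₁ b
  u₁c<u₁b = subst₂ _<_ (cong (to u) (≡.sym (swap-r a c))) (cong (to u) (≡.sym b-fixed))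
                   (ℕ.<-trans ua<uc uc<ub)
  u₂a<u₂c : to u₂ a < to u₂ c
  u₂a<u₂c = subst₂ _<_
    (cong (to u) (≡.sym (≡.trans (cong (swap a c) a-fixed) (swap-l a c))))
    (cong (to u) (≡.sym (≡.trans (cong (swap a c) (swap-l c b)) b-fixed))) uc<ub
  conj : u₂ · ⦅ a , c ⦆ ≈ₛ u · ⦅ a , b ⦆
  conj n = cong (to u) (≡.trans
    (≡.sym (swap-natural (swap a c) (swap-injective a c) c b (swap a c n)))
    (≡.trans (cong₂ (λ x y → swap x y (swap a c (swap a c n))) (swap-r a c) b-fixed)
             (cong (swap a b) (swap-involutive a c n))))

-- If just one of `a`, `b` lies in `{i, suc i}`, the changed value either moves away from the other
-- one, or could overtake it only if position and value of the other lay strictly between those of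
-- the cover, which `no-value-between` excludes.
cover-preserves-ascent : ∀ u i {a b} → Up u (a , b) → (a , b) ≢ (i , suc i) →
                         Asc i u → Asc i (u · ⦅ a , b ⦆)
cover-preserves-ascent u i {a} {b} cov ≢s ui<u1+i = go (adjacent i a) (adjacent i b)
  where
  a<b = Up.ordered cov
  ua<ub = cover-increasing u cov
  v = u · ⦅ a , b ⦆
  values : ∀ {x y} → swap a b i ≡ x → swap a b (suc i) ≡ y → to u x < to u y → Asc i v
  values p q = subst₂ _<_ (cong (to u) (≡.sym p)) (cong (to u) (≡.sym q))
  compare : ∀ {m n} → to u m ≢ to u n → ¬ to u n < to u m → to u m < to u n
  compare ≢ ≮ = ℕ.≤∧≢⇒< (ℕ.≮⇒≥ ≮) ≢
  go : Adjacent i a → Adjacent i b → Asc i v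
  go first first   = contradiction a<b (ℕ.<-irrefl ≡.refl)
  go first second  = contradiction ≡.refl ≢s
  go second first  = contradiction a<b (ℕ.<-asym (ℕ.n<1+n i))
  go second second = contradiction a<b (ℕ.<-irrefl ≡.refl)
  go first (other b≢i b≢1+i) = values (swap-l a b) (swap-≢ a b ℕ.1+n≢n (b≢1+i ∘ ≡.sym))
    (compare (b≢1+i ∘ to-injective u) (no-value-between u (suc i) cov (ℕ.n<1+n i)
      (ℕ.≤∧≢⇒< a<b (b≢1+i ∘ ≡.sym)) ui<u1+i))
  go second (other b≢i b≢1+i) = values (swap-≢ a b (ℕ.1+n≢n ∘ ≡.sym) (b≢i ∘ ≡.sym)) (swap-l a b)
    (ℕ.<-trans ui<u1+i ua<ub)
  go (other a≢i a≢1+i) first = values (swap-r a b) (swap-≢ a b (a≢1+i ∘ ≡.sym) ℕ.1+n≢n)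
    (ℕ.<-trans ua<ub ui<u1+i)
  go (other a≢i a≢1+i) second = values (swap-≢ a b (a≢i ∘ ≡.sym) (ℕ.1+n≢n ∘ ≡.sym)) (swap-r a b)
    (compare (a≢i ∘ ≡.sym ∘ to-injective u)
      λ ua<ui → no-value-between u i cov (ℕ.≤∧≢⇒< (ℕ.≤-pred a<b) a≢i) (ℕ.n<1+n i) ua<ui ui<u1+i)
  go (other a≢i a≢1+i) (other b≢i b≢1+i) = values
    (swap-≢ a b (a≢i ∘ ≡.sym) (b≢i ∘ ≡.sym)) (swap-≢ a b (a≢1+i ∘ ≡.sym) (b≢1+i ∘ ≡.sym)) ui<u1+i

σ-mono : ∀ i {a b} → a < b → (a , b) ≢ (i , suc i) → σ i a < σ i b
σ-mono i {a} {b} a<b ≢s with adjacent i a | adjacent i b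
... | first  | first  = contradiction a<b (ℕ.<-irrefl ≡.refl)
... | first  | second = contradiction ≡.refl ≢s
... | second | first  = contradiction a<b (ℕ.<-asym (ℕ.n<1+n i))
... | second | second = contradiction a<b (ℕ.<-irrefl ≡.refl)
... | first  | other p q = subst₂ _<_ (≡.sym (σ-l i)) (≡.sym (swap-≢ i (suc i) p q))
                             (ℕ.≤∧≢⇒< a<b (q ∘ ≡.sym))
... | second | other p q = subst₂ _<_ (≡.sym (σ-r i)) (≡.sym (swap-≢ i (suc i) p q))
                             (ℕ.<-trans (ℕ.n<1+n i) a<b)
... | other p q | first  = subst₂ _<_ (≡.sym (swap-≢ i (suc i) p q)) (≡.sym (σ-l i))
                             (ℕ.<-trans a<b (ℕ.n<1+n i))
... | other p q | second = subst₂ _<_ (≡.sym (swap-≢ i (suc i) p q)) (≡.sym (σ-r i))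
                             (ℕ.≤∧≢⇒< (ℕ.≤-pred a<b) p)
... | other p q | other p′ q′ = subst₂ _<_ (≡.sym (swap-≢ i (suc i) p q))
                                  (≡.sym (swap-≢ i (suc i) p′ q′)) a<b

σ² : ℕ → ℕ × ℕ → ℕ × ℕ
σ² i (a , b) = σ i a , σ i b

·s·tr : ∀ w i a b → w · s i · ⦅ a , b ⦆ ≈ₛ w · ⦅ σ i a , σ i b ⦆ · s i
·s·tr w i a b n = cong (to w) (≡.sym (swap-natural (σ i) (swap-injective i (suc i)) a b n))

simple-cover : ∀ w i → Desc i w → Down w (i , suc i)
simple-cover w i desc = down (ℕ.n<1+n i) (≡.sym (#inv-descent w {i} desc))

simple-cover⇒Desc : ∀ w i → Down w (i , suc i) → Desc i w
simple-cover⇒Desc w i (down _ eq) = ¬Asc⇒Desc i w λ asc → ℕ.<-asym (ℕ.n<1+n (#inv w))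
  (subst (_< #inv w) (#inv-ascent w {i} asc) (subst (#inv (w · s i) <_) (≡.sym eq) (ℕ.n<1+n _)))

-- Conjugation by sᵢ matches the elements covered by w sᵢ, other than w, with the elements
-- covered by w that have an ascent at i.
cover-conj⇒ : ∀ w i t → Asc i w → t ≢ (i , suc i) → let v = w · tr (σ² i t) in
  Down (w · s i) t → Down w (σ² i t) × Asc i v
cover-conj⇒ w i t@(a , b) asc ≢s cov@(down a<b dec) = down (σ-mono i a<b ≢s) eq , Asc-v
  where
  v = w · tr (σ² i t)
  x = w · s i · tr t
  Desc-x : Desc i x
  Desc-x = ¬Asc⇒Desc i x λ asc-x → Asc⇒¬Desc i (x · tr t)
    (cover-preserves-ascent x i {a} {b} (Down⇒Up (w · s i) t cov) ≢s asc-x)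
    (Desc-cong i (w · s i) (x · tr t) (≈ₛ-sym (x · tr t) (w · s i) (·tr-involutive (w · s i) t))
               (·s-Desc i w asc))
  Asc-v : Asc i v
  Asc-v = ¬Desc⇒Asc i v λ desc → Asc⇒¬Desc i x
      (Asc-cong i (v · s i) x (≈ₛ-sym x (v · s i) (·s·tr w i a b)) (·s-Asc i v desc)) Desc-x
  eq : #inv w ≡ suc (#inv v)
  eq = ℕ.suc-injective (begin
    suc (#inv w)          ≡⟨ #inv-ascent w {i} asc ⟨
    #inv (w · s i)        ≡⟨ dec ⟩
    suc (#inv x)          ≡⟨ cong suc (#inv-cong x (v · s i) (·s·tr w i a b)) ⟩
    suc (#inv (v · s i))  ≡⟨ cong suc (#inv-ascent v {i} Asc-v) ⟩
    suc (suc (#inv v))    ∎)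
    where open ≡.≡-Reasoning

cover-conj⇐ : ∀ w i t → Asc i w → let v = w · tr (σ² i t) in
  Down w (σ² i t) → Asc i v → Down (w · s i) t
cover-conj⇐ w i t@(a , b) asc cov@(down σa<σb dec) Asc-v = down a<b eq
  where
  v = w · tr (σ² i t)
  x = w · s i · tr t
  ≢s : σ² i t ≢ (i , suc i)
  ≢s e = Asc⇒¬Desc i w asc (simple-cover⇒Desc w i (subst (Down w) e cov))
  a<b : a < b
  a<b = subst₂ _<_ (swap-involutive i (suc i) a) (swap-involutive i (suc i) b)
                   (σ-mono i σa<σb ≢s)
  eq : #inv (w · s i) ≡ suc (#inv x)
  eq = begin
    #inv (w · s i)        ≡⟨ #inv-ascent w {i} asc ⟩
    suc (#inv w)          ≡⟨ cong suc dec ⟩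
    suc (suc (#inv v))    ≡⟨ cong suc (#inv-ascent v {i} Asc-v) ⟨
    suc (#inv (v · s i))  ≡⟨ cong suc (#inv-cong x (v · s i) (·s·tr w i a b)) ⟨
    suc (#inv x)          ∎
    where open ≡.≡-Reasoning

descent⊎ε : ∀ w → (∃ λ i → Desc i w) ⊎ w ≈ₛ ε
descent⊎ε w with ℕ.anyUpTo? (λ i → to w (suc i) <? to w i) (bound w)
... | yes (i , _ , desc) = inj₁ (i , desc)
... | no none = inj₂ (no-descent w λ i → asc i (ascent⊎descent w i))
  where
  asc : ∀ i → Asc i w ⊎ Desc i w → Asc i w
  asc i (inj₁ p) = p
  asc i (inj₂ p) =
    contradiction (i , ℕ.<-trans (ℕ.n<1+n i) (descent-bound w (fixes w) p) , p) none

fixes-·s : ∀ {N} w i → Fixes≥ N w → suc i < N → Fixes≥ N (w · s i)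
fixes-·s w i fix 1+i<N n N≤n = ≡.trans
  (cong (to w) (swap-≢ i (suc i) (ℕ.>⇒≢ (ℕ.<-≤-trans (ℕ.<-trans (ℕ.n<1+n i) 1+i<N) N≤n))
                                 (ℕ.>⇒≢ (ℕ.<-≤-trans 1+i<N N≤n))))
  (fix n N≤n)

-- Decidability of covers and the range of transpositions.

opaque

  up? : ∀ u t → Dec (Up u t)
  up? u t = map′ (λ (a<b , eq) → up a<b eq) (λ (up a<b eq) → a<b , eq)
    ((proj₁ t <? proj₂ t) ×-dec (#inv (u · tr t) ≟ suc (#inv u)))

  down? : ∀ w t → Dec (Down w t)
  down? w t = map′ (λ (a<b , eq) → down a<b eq) (λ (down a<b eq) → a<b , eq)
    ((proj₁ t <? proj₂ t) ×-dec (#inv w ≟ suc (#inv (w · tr t))))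

  infix 4 _≈?_
  _≈?_ : ∀ u v → Dec (u ≈ₛ v)
  _≈?_ = _≟ₛ_

unique∧set⇒↭ : ∀ {a} {A : Set a} {xs ys : List A} → Unique xs → Unique ys →
               (∀ {x} → x ∈ xs → x ∈ ys) → (∀ {x} → x ∈ ys → x ∈ xs) → xs ↭ ys
unique∧set⇒↭ xs! ys! xs⊆ys ys⊆xs = ∼bag⇒↭ (unique∧set⇒bag xs! ys! (mk⇔ xs⊆ys ys⊆xs))

_≟²_ : (t t′ : ℕ × ℕ) → Dec (t ≡ t′)
_≟²_ = ≡-dec _≟_ _≟_

pairs : ℕ → List (ℕ × ℕ)
pairs N = cartesianProduct (upTo N) (upTo N)

pairs! : ∀ N → Unique (pairs N)
pairs! N = Unique.cartesianProduct⁺ (Unique.upTo⁺ N) (Unique.upTo⁺ N)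

∈-pairs : ∀ {N a b} → a < N → b < N → (a , b) ∈ pairs N
∈-pairs a<N b<N = ∈-cartesianProduct⁺ (∈-upTo⁺ a<N) (∈-upTo⁺ b<N)

σ-< : ∀ {i N a} → suc i < N → a < N → σ i a < N
σ-< {i} {N} {a} 1+i<N a<N with adjacent i a
... | first     = subst (_< N) (≡.sym (σ-l i)) 1+i<N
... | second    = subst (_< N) (≡.sym (σ-r i)) (ℕ.<-trans (ℕ.n<1+n i) 1+i<N)
... | other p q = subst (_< N) (≡.sym (swap-≢ i (suc i) p q)) a<N

σ²-involutive : ∀ i t → σ² i (σ² i t) ≡ t
σ²-involutive i (a , b) = cong₂ _,_ (swap-involutive i (suc i) a) (swap-involutive i (suc i) b)

σ²-injective : ∀ i {t t′} → σ² i t ≡ σ² i t′ → t ≡ t′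
σ²-injective i {t} {t′} eq = ≡.trans (≡.sym (σ²-involutive i t))
  (≡.trans (cong (σ² i) eq) (σ²-involutive i t′))

σ²-pairs : ∀ {i N} → suc i < N → map (σ² i) (pairs N) ↭ pairs N
σ²-pairs {i} {N} 1+i<N = unique∧set⇒↭ (Unique.map⁺ (σ²-injective i) (pairs! N)) (pairs! N) to∈ from∈
  where
  closed : ∀ {t} → t ∈ pairs N → σ² i t ∈ pairs N
  closed t∈ with ∈-cartesianProduct⁻ (upTo N) (upTo N) t∈
  ... | a∈ , b∈ = ∈-pairs (σ-< 1+i<N (∈-upTo⁻ a∈)) (σ-< 1+i<N (∈-upTo⁻ b∈))
  to∈ : ∀ {t} → t ∈ map (σ² i) (pairs N) → t ∈ pairs N
  to∈ t∈ with ∈-map⁻ (σ² i) t∈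
  ... | _ , t′∈ , ≡.refl = closed t′∈
  from∈ : ∀ {t} → t ∈ pairs N → t ∈ map (σ² i) (pairs N)
  from∈ {t} t∈ = subst (_∈ map (σ² i) (pairs N)) (σ²-involutive i t) (∈-map⁺ (σ² i) (closed t∈))

-- Signed chain counts as iterated divided differences.

module CoverSums {c r} (R : CommutativeRing c r) (N : ℕ) where

  open Functionals R
  open ≈-Reasoning

  ∑-≟² : ∀ {xs t} x → Unique xs → t ∈ xs → ∑ xs (λ t′ → ⟦ t′ ≟² t ⟧ * x) ≈ x
  ∑-≟² {_ ∷ xs} {t} x (t∉ ∷ xs!) (here ≡.refl) = trans (+-cong
    (trans (*-congʳ (⟦⟧-yes (t ≟² t) ≡.refl)) (*-identityˡ x))
    (trans (∑-cong∈ xs λ t′ t′∈ → trans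
              (*-congʳ (⟦⟧-no (t′ ≟² t) λ t′≡t → All.lookup t∉ t′∈ (≡.sym t′≡t))) (zeroˡ x))
           (∑-0 xs λ _ → refl)))
    (+-identityʳ x)
  ∑-≟² {t′ ∷ _} {t} x (t′∉ ∷ xs!) (there t∈) = trans (+-cong
    (trans (*-congʳ (⟦⟧-no (t′ ≟² t) (All.lookup t′∉ t∈))) (zeroˡ x)) (∑-≟² x xs! t∈))
    (+-identityˡ x)

  -- E w m is the signed count of the saturated chains from 1 to w, read downwards from w,
  -- that use the variables of m in order; it is the coefficient of w in the iterated
  -- Chevalley–Monk product of m.

  covers : S∞ → ℕ × ℕ → Carrier
  covers w t = ⟦ down? w t ⟧

  E : S∞ → Functional
  E w []      = ⟦ ε ≈? w ⟧
  E w (k ∷ m) = ∑ (pairs N) λ t → covers w t * (sgn k t * E (w · tr t) m)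

  covers-cong : ∀ v w t → v ≈ₛ w → covers v t ≈ covers w t
  covers-cong v w t v≈w = ⟦⟧-⇔ (down? v t) (down? w t)
    (Down-cong v w t v≈w) (Down-cong w v t (≈ₛ-sym v w v≈w))

  E-cong : ∀ v w → v ≈ₛ w → E v ≐ E w
  E-cong v w v≈w [] = ⟦⟧-⇔ (ε ≈? v) (ε ≈? w)
    (λ ε≈v → ≈ₛ-trans ε v w ε≈v v≈w) (λ ε≈w → ≈ₛ-trans ε w v ε≈w (≈ₛ-sym v w v≈w))
  E-cong v w v≈w (k ∷ m) = ∑-cong (pairs N) λ t → *-cong (covers-cong v w t v≈w)
    (*-congˡ (E-cong (v · tr t) (w · tr t) (·-congʳ v w (tr t) v≈w) m))

  E-ε : ∀ w → w ≈ₛ ε → E w ≐ ct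
  E-ε w w≈ε []      = ⟦⟧-yes (ε ≈? w) (≈ₛ-sym w ε w≈ε)
  E-ε w w≈ε (k ∷ m) = trans (∑-0 (pairs N) λ t → ⟦⟧-0 (down? w t) λ (down _ eq) →
      contradiction (≡.trans (≡.sym (#inv-cong w ε w≈ε)) eq) λ ())
    (sym (ct-∷ k m))

  module _ {i} (1+i<N : suc i < N) where

    private
      sᵢ = i , suc i

      sᵢ∈ : sᵢ ∈ pairs N
      sᵢ∈ = ∈-pairs (ℕ.<-trans (ℕ.n<1+n i) 1+i<N) 1+i<N

    dd-step : ∀ w k m → (∀ v → dd i (E v) m ≈ ⟦ asc? i v ⟧ * E (v · s i) m) →
      dd i (E w) (k ∷ m) ≈ sgn k sᵢ * E w m +
        (∑ (pairs N) λ t → covers w t *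
          (sgn (σ i k) t * (⟦ asc? i (w · tr t) ⟧ * E (w · tr t · s i) m)))
    dd-step w k m IH = +-congˡ (trans (dd-∑ i (pairs N) _ m) (∑-cong (pairs N) λ t →
      trans (dd-*ˡ i (covers w t) _ m)
        (*-congˡ (trans (dd-*ˡ i (sgn (σ i k) t) _ m) (*-congˡ (IH (w · tr t)))))))

    -- The summands of the two sides to be compared: of the twisted part of `dd i (E w)` at `k ∷ m`,
    -- after the inductive hypothesis, and of `E (w · s i)` at `k ∷ m`.
    ascentTerm descentTerm : S∞ → ℕ → List ℕ → ℕ × ℕ → Carrier
    ascentTerm w k m t = covers w t *
      (sgn (σ i k) t * (⟦ asc? i (w · tr t) ⟧ * E (w · tr t · s i) m))
    descentTerm w k m t = covers (w · s i) t * (sgn k t * E (w · s i · tr t) m)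

    -- The cover `sᵢ` leads from `w · s i` down to `w` and accounts for the Leibniz term; every
    -- other cover is conjugated by `cover-conj⇒` and `cover-conj⇐`.
    descentTerm≈ : ∀ w k m → Asc i w → ∀ t →
      descentTerm w k m t ≈ ⟦ t ≟² sᵢ ⟧ * (sgn k sᵢ * E w m) + ascentTerm w k m (σ² i t)
    descentTerm≈ w k m asc t = go t (t ≟² sᵢ)
      where
      go : ∀ t (t≟sᵢ : Dec (t ≡ sᵢ)) →
           descentTerm w k m t ≈ ⟦ t≟sᵢ ⟧ * (sgn k sᵢ * E w m) + ascentTerm w k m (σ² i t)
      go _ (yes ≡.refl) = trans
        (trans (*-cong (⟦⟧-yes (down? (w · s i) sᵢ) (simple-cover (w · s i) i (·s-Desc i w asc)))
                       (*-congˡ (E-cong (w · s i · tr sᵢ) w (·⦅⦆-involutive w i (suc i)) m)))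
               (sym (+-identityʳ _)))
        -- `σ² i` reverses `sᵢ` to a decreasing pair, which is no cover, so the second summand
        -- vanishes here.
        (+-congˡ (sym (⟦⟧-0 (down? w (σ² i sᵢ)) λ (down lt _) → contradiction
          (≡.subst₂ _<_ (σ-l i) (σ-r i) lt) (ℕ.<-asym (ℕ.n<1+n i)))))
      go t@(a , b) (no t≢sᵢ) = trans (trans
        (*-cong (⟦⟧-⇔ (down? (w · s i) t) (down? w (σ² i t) ×-dec asc? i (w · tr (σ² i t)))
                      (cover-conj⇒ w i t asc t≢sᵢ)
                      (λ (cov , asc-v) → cover-conj⇐ w i t asc cov asc-v))
                (*-cong (sym (sgn-σ i k a b))
                        (E-cong (w · s i · tr t) (w · tr (σ² i t) · s i) (·s·tr w i a b) m)))
        (trans (*-congʳ (⟦⟧-× (down? w (σ² i t)) (asc? i (w · tr (σ² i t)))))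
               (trans (*-assoc _ _ _) (*-congˡ (x∙yz≈y∙xz _ _ _)))))
        (sym (trans (+-congʳ (zeroˡ _)) (+-identityˡ _)))

    -- Among the elements covered by `w` only `w · s i` can have an ascent at `i`: along any other
    -- cover the ascent would persist up to `w`, which has a descent there.
    ascentTerm≈ : ∀ w k m → Desc i w → ∀ t →
      ascentTerm w k m t ≈ ⟦ t ≟² sᵢ ⟧ * (sgn (σ i k) sᵢ * E w m)
    ascentTerm≈ w k m desc t = go t (t ≟² sᵢ)
      where
      go : ∀ t (t≟sᵢ : Dec (t ≡ sᵢ)) →
           ascentTerm w k m t ≈ ⟦ t≟sᵢ ⟧ * (sgn (σ i k) sᵢ * E w m)
      go _ (yes ≡.refl) = *-cong (⟦⟧-yes (down? w sᵢ) (simple-cover w i desc))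
        (*-congˡ (trans (*-cong (⟦⟧-yes (asc? i (w · tr sᵢ)) (·s-Asc i w desc))
                                (E-cong (w · tr sᵢ · s i) w (·⦅⦆-involutive w i (suc i)) m))
                        (*-identityˡ _)))
      go t@(a , b) (no t≢sᵢ) = trans
        (⟦⟧-0 (down? w t) λ cov → trans (*-congˡ (⟦⟧-0 (asc? i (w · tr t)) λ asc →
          contradiction (Desc-cong i w (w · tr t · tr t)
                          (≈ₛ-sym (w · tr t · tr t) w (·tr-involutive w t)) desc)
            (Asc⇒¬Desc i (w · tr t · tr t)
              (cover-preserves-ascent (w · tr t) i {a} {b} (Down⇒Up w t cov) t≢sᵢ asc))))
          (zeroʳ _))
        (sym (zeroˡ _))

    dd-E : ∀ m w → dd i (E w) m ≈ ⟦ asc? i w ⟧ * E (w · s i) m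
    dd-E [] w = sym (⟦⟧-0 (asc? i w) λ asc → ⟦⟧-no (ε ≈? (w · s i)) λ ε≈ → contradiction
      (Desc-cong i (w · s i) ε (≈ₛ-sym ε (w · s i) ε≈) (·s-Desc i w asc)) (ℕ.<-asym (ℕ.n<1+n i)))
    dd-E (k ∷ m) w = go (asc? i w)
      where
      x = sgn k sᵢ * E w m
      go : (asc?w : Dec (Asc i w)) → dd i (E w) (k ∷ m) ≈ ⟦ asc?w ⟧ * E (w · s i) (k ∷ m)
      go (yes asc) = begin
        dd i (E w) (k ∷ m)
          ≈⟨ dd-step w k m (dd-E m) ⟩
        x + ∑ (pairs N) (ascentTerm w k m)
          -- The Leibniz term becomes the summand at `t = sᵢ`, and the cover sum is reindexed along
          -- `σ² i`, which permutes `pairs N` because `suc i < N`.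
          ≈⟨ +-cong (∑-≟² x (pairs! N) sᵢ∈) (∑-↭ (ascentTerm w k m) (σ²-pairs 1+i<N)) ⟨
        ∑ (pairs N) (λ t → ⟦ t ≟² sᵢ ⟧ * x) + ∑ (map (σ² i) (pairs N)) (ascentTerm w k m)
          ≈⟨ +-congˡ (∑-map (σ² i) (pairs N) (ascentTerm w k m)) ⟩
        ∑ (pairs N) (λ t → ⟦ t ≟² sᵢ ⟧ * x) + ∑ (pairs N) (ascentTerm w k m ∘ σ² i)
          ≈⟨ ∑-+ (pairs N) (λ t → ⟦ t ≟² sᵢ ⟧ * x) (ascentTerm w k m ∘ σ² i) ⟨
        ∑ (pairs N) (λ t → ⟦ t ≟² sᵢ ⟧ * x + ascentTerm w k m (σ² i t))
          ≈⟨ ∑-cong (pairs N) (descentTerm≈ w k m asc) ⟨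
        E (w · s i) (k ∷ m)
          ≈⟨ *-identityˡ _ ⟨
        1# * E (w · s i) (k ∷ m) ∎
      go (no ¬asc) = begin
        dd i (E w) (k ∷ m)
          ≈⟨ dd-step w k m (dd-E m) ⟩
        x + ∑ (pairs N) (ascentTerm w k m)
          ≈⟨ +-congˡ (∑-cong (pairs N) (ascentTerm≈ w k m (¬Asc⇒Desc i w ¬asc))) ⟩
        x + ∑ (pairs N) (λ t → ⟦ t ≟² sᵢ ⟧ * (sgn (σ i k) sᵢ * E w m))
          ≈⟨ +-congˡ (∑-≟² _ (pairs! N) sᵢ∈) ⟩
        x + sgn (σ i k) sᵢ * E w m
          ≈⟨ distribʳ _ (sgn k sᵢ) (sgn (σ i k) sᵢ) ⟨
        (sgn k sᵢ + sgn (σ i k) sᵢ) * E w m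
          -- `sᵢ` reverses its own pair, so the single surviving cover carries the sign opposite to
          -- the Leibniz term.
          ≈⟨ *-congʳ (trans (+-congˡ (sgn-σ-simple i k)) (-‿inverseʳ (sgn k sᵢ))) ⟩
        0# * E w m
          ≈⟨ trans (zeroˡ _) (sym (zeroˡ _)) ⟩
        0# * E (w · s i) (k ∷ m) ∎

    E-descent : ∀ w → Desc i w → E w ≐ dd i (E (w · s i))
    E-descent w desc m = sym (trans (dd-E m (w · s i)) (trans
      (*-cong (⟦⟧-yes (asc? i (w · s i)) (·s-Asc i w desc))
              (E-cong (w · s i · s i) w (·s·s w i) m))
      (*-identityˡ _)))

  -- On chains this says that multiplications by different variables commute. It is inherited from
  -- `ct` through `dd-symmetric`, one descent at a time; `Fixes≥ N w` keeps each descent within the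
  -- range of `pairs N`.
  E-symmetric : ∀ w → Fixes≥ N w → Symmetric (E w)
  E-symmetric w = go (#inv w) w ≡.refl
    where
    go : ∀ n w → #inv w ≡ n → Fixes≥ N w → Symmetric (E w)
    go n w eq fix with descent⊎ε w
    ... | inj₂ w≈ε = Symmetric-cong (λ m → sym (E-ε w w≈ε m)) ct-symmetric
    go zero w eq fix | inj₁ (i , desc) =
      contradiction (≡.trans (#inv-descent w {i} desc) eq) λ ()
    go (suc n) w eq fix | inj₁ (i , desc) = Symmetric-cong
      (λ m → sym (E-descent 1+i<N w desc m))
      (dd-symmetric i (go n (w · s i) (ℕ.suc-injective (≡.trans (#inv-descent w {i} desc) eq))
                          (fixes-·s w i fix 1+i<N)))
      where 1+i<N = descent-bound w fix desc

-- Sublists of strictly sorted lists.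

subs : ∀ {a} {A : Set a} → List A → List (List A)
subs []       = [ [] ]
subs (x ∷ xs) = map (x ∷_) (subs xs) ++ subs xs

module _ {A : Set} where

  subs⇒∈ : ∀ (xs : List A) {zs} → zs ∈ subs xs → All (_∈ xs) zs
  subs⇒∈ []       (here ≡.refl) = []
  subs⇒∈ (x ∷ xs) zs∈ with ∈-++⁻ (map (x ∷_) (subs xs)) zs∈
  ... | inj₂ zs∈′ = All.map there (subs⇒∈ xs zs∈′)
  ... | inj₁ zs∈′ with ∈-map⁻ (x ∷_) zs∈′
  ...   | ys , ys∈ , ≡.refl = here ≡.refl ∷ All.map there (subs⇒∈ xs ys∈)

  subs! : ∀ {xs : List A} → Unique xs → Unique (subs xs)
  subs! [] = [] ∷ []
  subs! {x ∷ xs} (x∉ ∷ xs!) = Unique.++⁺ (Unique.map⁺ ∷-injectiveʳ (subs! xs!)) (subs! xs!) disjoint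
    where
    disjoint : ∀ {zs} → ¬ (zs ∈ map (x ∷_) (subs xs) × zs ∈ subs xs)
    disjoint (zs∈ , zs∈′) with ∈-map⁻ (x ∷_) zs∈
    ... | _ , _ , ≡.refl = All.lookup x∉ (All.head (subs⇒∈ xs zs∈′)) ≡.refl

  module _ {R : A → A → Set} where

    subs-AllPairs : ∀ {xs} → AllPairs R xs → ∀ {zs} → zs ∈ subs xs → AllPairs R zs
    subs-AllPairs {[]} [] (here ≡.refl) = []
    subs-AllPairs {x ∷ xs} (x< ∷ xs↑) zs∈ with ∈-++⁻ (map (x ∷_) (subs xs)) zs∈
    ... | inj₂ zs∈′ = subs-AllPairs xs↑ zs∈′
    ... | inj₁ zs∈′ with ∈-map⁻ (x ∷_) zs∈′
    ...   | ys , ys∈ , ≡.refl = All.map (All.lookup x<) (subs⇒∈ xs ys∈) ∷ subs-AllPairs xs↑ ys∈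

    -- If the first entry of `zs` is the head `x`, irreflexivity keeps `x` out of the rest; if it
    -- comes later in `xs`, transitivity puts `x` strictly before all of `zs`. Either way the
    -- remaining entries lie in the tail.
    subs-complete : (∀ {x y z} → R x y → R y z → R x z) → (∀ {x} → ¬ R x x) →
      ∀ {xs} → AllPairs R xs → ∀ {zs} → AllPairs R zs → All (_∈ xs) zs → zs ∈ subs xs
    subs-complete R-trans R-irrefl = go
      where
      drop-∈ : ∀ {x xs zs} → All (R x) zs → All (_∈ x ∷ xs) zs → All (_∈ xs) zs
      drop-∈ []           []                   = []
      drop-∈ (xRx ∷ xR)   (here ≡.refl ∷ zs∈) = contradiction xRx R-irrefl
      drop-∈ (_ ∷ xR)     (there z∈ ∷ zs∈)    = z∈ ∷ drop-∈ xR zs∈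
      go : ∀ {xs} → AllPairs R xs → ∀ {zs} → AllPairs R zs → All (_∈ xs) zs → zs ∈ subs xs
      go {[]}     _          {[]}     _          _ = here ≡.refl
      go {[]}     _          {_ ∷ _}  _          (() ∷ _)
      go {x ∷ xs} _          {[]}     _          _ = ∈-++⁺ʳ (map (x ∷_) (subs xs)) (empty xs)
        where
        empty : ∀ xs → [] ∈ subs xs
        empty []       = here ≡.refl
        empty (x ∷ xs) = ∈-++⁺ʳ (map (x ∷_) (subs xs)) (empty xs)
      go {x ∷ xs} (x< ∷ xs↑) {_ ∷ zs} (z< ∷ zs↑) (here ≡.refl ∷ zs∈) =
        ∈-++⁺ˡ (∈-map⁺ (x ∷_) (go xs↑ zs↑ (drop-∈ z< zs∈)))
      go {x ∷ xs} (x< ∷ xs↑) {_ ∷ zs} (z< ∷ zs↑) (there z∈ ∷ zs∈) =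
        ∈-++⁺ʳ (map (x ∷_) (subs xs)) (go xs↑ (z< ∷ zs↑)
          (z∈ ∷ drop-∈ (All.map (R-trans (All.lookup x< z∈)) z<) zs∈))

-- The triangular list of Fomin-Stanley factors.

-- A factor 1 + xₖ uⱼ of the Fomin–Stanley product is recorded as (k , j). The factors
-- 1 + xₖ u_{j+n-1}, …, 1 + xₖ uⱼ form row k j n, and the product is rows 0 N.

row : ℕ → ℕ → ℕ → List (ℕ × ℕ)
row k j zero    = []
row k j (suc n) = row k (suc j) n ∷ʳ (k , j)

rows : ℕ → ℕ → List (ℕ × ℕ)
rows k zero    = []
rows k (suc n) = row k k (suc n) ++ rows (suc k) n

InRow : ℕ → ℕ → ℕ → ℕ × ℕ → Set
InRow k j n (k′ , j′) = k′ ≡ k × j ≤ j′ × j′ < n ℕ.+ j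

InRows : ℕ → ℕ → ℕ × ℕ → Set
InRows k n (k′ , j′) = k ≤ k′ × k′ ≤ j′ × j′ < n ℕ.+ k

row⇒ : ∀ k j n → All (InRow k j n) (row k j n)
row⇒ k j zero    = []
row⇒ k j (suc n) = All.∷ʳ⁺
  (All.map (λ {t} (k≡ , j≤ , <n) → k≡ , ℕ.≤-trans (ℕ.n≤1+n j) j≤ , subst (proj₂ t <_) (ℕ.+-suc n j) <n)
           (row⇒ k (suc j) n))
  (≡.refl , ℕ.≤-refl , subst (suc j ≤_) (ℕ.+-suc n j) (ℕ.m≤n+m (suc j) n))

row⇐ : ∀ k j n {j′} → j ≤ j′ → j′ < n ℕ.+ j → (k , j′) ∈ row k j n
row⇐ k j zero    j≤ <n = contradiction j≤ (ℕ.<⇒≱ <n)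
row⇐ k j (suc n) {j′} j≤ <n with j ≟ j′
... | yes ≡.refl = ∈-++⁺ʳ (row k (suc j) n) (here ≡.refl)
... | no  j≢j′   = ∈-++⁺ˡ (row⇐ k (suc j) n (ℕ.≤∧≢⇒< j≤ j≢j′) (subst (j′ <_) (≡.sym (ℕ.+-suc n j)) <n))

rows⇒ : ∀ k n → All (InRows k n) (rows k n)
rows⇒ k zero    = []
rows⇒ k (suc n) = All.++⁺
  (All.map (λ { (≡.refl , j≤ , <n) → ℕ.≤-refl , j≤ , <n }) (row⇒ k k (suc n)))
  (All.map (λ {t} (k≤ , j≤ , <n) → ℕ.≤-trans (ℕ.n≤1+n k) k≤ , j≤ , subst (proj₂ t <_) (ℕ.+-suc n k) <n)
           (rows⇒ (suc k) n))

rows⇐ : ∀ k n {t} → InRows k n t → t ∈ rows k n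
rows⇐ k zero    (k≤ , j≤ , <n) = contradiction (ℕ.≤-trans k≤ j≤) (ℕ.<⇒≱ <n)
rows⇐ k (suc n) {k′ , j′} (k≤ , j≤ , <n) with k ≟ k′
... | yes ≡.refl = ∈-++⁺ˡ (row⇐ k k (suc n) j≤ <n)
... | no  k≢k′   = ∈-++⁺ʳ (row k k (suc n))
  (rows⇐ (suc k) n (ℕ.≤∧≢⇒< k≤ k≢k′ , j≤ , subst (j′ <_) (≡.sym (ℕ.+-suc n k)) <n))

-- `rows` lists its factors in the order `Step`. Since `Step` is a strict order, the chains for it
-- inside `rows` are exactly the sublists, which turns compatible sequences into terms of the
-- expanded product.
Step-trans : ∀ {x y z} → Step x y → Step y z → Step x z
Step-trans {i , a} {i′ , a′} {i″ , a″} (i≤i′ , f) (i′≤i″ , g) =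
  ℕ.≤-trans i≤i′ i′≤i″ , λ { ≡.refl →
    let i≡i′ = ℕ.≤-antisym i≤i′ i′≤i″ in
    ℕ.<-trans (g (≡.sym i≡i′)) (f i≡i′) }

Step-irrefl : ∀ {x} → ¬ Step x x
Step-irrefl (_ , f) = ℕ.<-irrefl ≡.refl (f ≡.refl)

row-sorted : ∀ k j n → AllPairs Step (row k j n)
row-sorted k j zero    = []
row-sorted k j (suc n) = AllPairs.++⁺ (row-sorted k (suc j) n) ([] ∷ [])
  (All.map (λ { (≡.refl , j< , _) → (ℕ.≤-refl , λ _ → j<) ∷ [] }) (row⇒ k (suc j) n))

rows-sorted : ∀ k n → AllPairs Step (rows k n)
rows-sorted k zero    = []
rows-sorted k (suc n) = AllPairs.++⁺ (row-sorted k k (suc n)) (rows-sorted (suc k) n)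
  (All.map (λ { (≡.refl , _) → All.map
      (λ (k< , _) → ℕ.<⇒≤ k< , λ { ≡.refl → contradiction k< (ℕ.<-irrefl ≡.refl) })
      (rows⇒ (suc k) n) })
    (row⇒ k k (suc n)))

rows! : ∀ k n → Unique (rows k n)
rows! k n = AllPairs.map (λ { st ≡.refl → Step-irrefl st }) (rows-sorted k n)

-- Reduced words and their last letters.

-- `Reduced` with the length measured by inversions, the form in which multiplication by a simple
-- transposition is computed.
record Red (u : S∞) (a : Word) : Set where
  constructor red
  field
    expresses : wordProduct a ≈ₛ u
    minimal : length a ≡ #inv u

Red-cong : ∀ u v a → u ≈ₛ v → Red u a → Red v a
Red-cong u v a u≈v (red prod len) =
  red (≈ₛ-trans (wordProduct a) u v prod u≈v) (≡.trans len (#inv-cong u v u≈v))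

-- Were `j` an ascent of `u`, then `u · s j` would have more inversions than the word `a` expressing
-- it has letters.
Red-∷ʳ⁻ : ∀ u a j → Red u (a ∷ʳ j) → Desc j u × Red (u · s j) a
Red-∷ʳ⁻ u a j (red prod len) = desc ,
  red (init≈ a u j prod) (ℕ.suc-injective (≡.trans len′ (≡.sym (#inv-descent u {j} desc))))
  where
  len′ : suc (length a) ≡ #inv u
  len′ = ≡.trans (≡.sym (length-∷ʳ a j)) len
  desc : Desc j u
  desc = ¬Asc⇒Desc j u λ asc → ℕ.<-irrefl ≡.refl (begin-strict
    length a         <⟨ ℕ.n<1+n _ ⟩
    suc (length a)   ≡⟨ len′ ⟩
    #inv u           <⟨ ℕ.n<1+n _ ⟩
    suc (#inv u)     ≡⟨ #inv-ascent u {j} asc ⟨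
    #inv (u · s j)   ≤⟨ #inv≤length (u · s j) a (init≈ a u j prod) ⟩
    length a         ∎)
    where open ℕ.≤-Reasoning

Red-∷ʳ⁺ : ∀ u a j → Desc j u → Red (u · s j) a → Red u (a ∷ʳ j)
Red-∷ʳ⁺ u a j desc (red prod len) = red
  (λ n → ≡.trans (wordProduct-∷ʳ a j n) (≡.trans (prod (to (s j) n)) (·s·s u j n)))
  (≡.trans (length-∷ʳ a j) (≡.trans (cong suc len) (#inv-descent u {j} desc)))

desc? : ∀ i u → Dec (Desc i u)
desc? i u = to u (suc i) <? to u i

opaque
  red? : ∀ u a → Dec (Red u a)
  red? u a = map′ (λ (p , l) → red p l) (λ (red p l) → p , l)
    ((wordProduct a ≟ₛ u) ×-dec (length a ≟ #inv u))

module SubSums {c r} (R : CommutativeRing c r) where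

  open Functionals R
  open ≈-Reasoning

  module _ {a} {A : Set a} where

    -- `subs` branches on the head, whereas the product of factors grows at the end; this is the
    -- expansion along the last factor.
    ∑-subs-∷ʳ : ∀ (xs : List A) x g →
      ∑ (subs (xs ∷ʳ x)) g ≈ ∑ (subs xs) g + ∑ (subs xs) (λ z → g (z ∷ʳ x))
    ∑-subs-∷ʳ []       x g = trans (+-comm (g [ x ]) _) (+-congˡ (sym (+-identityʳ _)))
    ∑-subs-∷ʳ (y ∷ xs) x g = begin
      ∑ (map (y ∷_) (subs (xs ∷ʳ x)) ++ subs (xs ∷ʳ x)) g
        ≈⟨ split (xs ∷ʳ x) g ⟩
      ∑ (subs (xs ∷ʳ x)) (g ∘ (y ∷_)) + ∑ (subs (xs ∷ʳ x)) g
        ≈⟨ +-cong (∑-subs-∷ʳ xs x (g ∘ (y ∷_))) (∑-subs-∷ʳ xs x g) ⟩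
      (∑ (subs xs) (g ∘ (y ∷_)) + ∑ (subs xs) (g ∘ (y ∷_) ∘ (_∷ʳ x))) +
      (∑ (subs xs) g + ∑ (subs xs) (g ∘ (_∷ʳ x)))
        ≈⟨ interchange _ _ _ _ ⟩
      (∑ (subs xs) (g ∘ (y ∷_)) + ∑ (subs xs) g) +
      (∑ (subs xs) (g ∘ (y ∷_) ∘ (_∷ʳ x)) + ∑ (subs xs) (g ∘ (_∷ʳ x)))
        ≈⟨ +-cong (split xs g) (split xs (g ∘ (_∷ʳ x))) ⟨
      ∑ (subs (y ∷ xs)) g + ∑ (subs (y ∷ xs)) (g ∘ (_∷ʳ x)) ∎
      where
      split : ∀ xs g → ∑ (map (y ∷_) (subs xs) ++ subs xs) g ≈
                       ∑ (subs xs) (g ∘ (y ∷_)) + ∑ (subs xs) g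
      split xs g = trans (∑-++ (map (y ∷_) (subs xs)) (subs xs) g)
                         (+-congʳ (∑-map (y ∷_) (subs xs) g))

    ∑-subs-[] : ∀ (xs : List A) g → (∀ x z → g (x ∷ z) ≈ 0#) → ∑ (subs xs) g ≈ g []
    ∑-subs-[] []       g g≈0 = +-identityʳ _
    ∑-subs-[] (x ∷ xs) g g≈0 = trans (∑-++ (map (x ∷_) (subs xs)) (subs xs) g)
      (trans (+-cong (trans (∑-map (x ∷_) (subs xs) g) (∑-0 (subs xs) (g≈0 x)))
                     (∑-subs-[] xs g g≈0))
             (+-identityˡ _))

-- NilCoxeter generators, variables and divided differences as operators.

module Operators {c r} (R : CommutativeRing c r) where

  open Functionals R public

  -- The module S∞ → Functional, on which the nilCoxeter generator uⱼ acts on the right by U j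
  -- (in the basis S∞), the variable xₖ by X k and the divided difference ∂ᵢ by Δ i.

  record Fun : Set (c ⊔ r) where
    constructor fun
    field
      app      : S∞ → Functional
      app-cong : ∀ u v {m n} → u ≈ₛ v → m ↭ n → app u m ≈ app v n

  open Fun public

  infix 4 _≋_
  record _≋_ (ζ ξ : Fun) : Set (c ⊔ r) where
    constructor pointwise
    field at : ∀ u m → app ζ u m ≈ app ξ u m

  open _≋_ public

  Fun-setoid : Setoid (c ⊔ r) (c ⊔ r)
  Fun-setoid = record
    { Carrier = Fun
    ; _≈_ = _≋_
    ; isEquivalence = record
      { refl  = pointwise λ _ _ → refl
      ; sym   = λ p → pointwise λ u m → sym (at p u m)
      ; trans = λ p q → pointwise λ u m → trans (at p u m) (at q u m)
      }
    }

  module ≋ = Setoid Fun-setoid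
  module ≋-Reasoning = SetoidReasoning Fun-setoid

  d : ℕ → S∞ → Carrier
  d j u = ⟦ desc? j u ⟧

  d-cong : ∀ j u v → u ≈ₛ v → d j u ≈ d j v
  d-cong j u v u≈v = ⟦⟧-⇔ (desc? j u) (desc? j v) (Desc-cong j u v u≈v)
                          (Desc-cong j v u (≈ₛ-sym u v u≈v))

  infixl 6 _⊕_
  _⊕_ : Fun → Fun → Fun
  ζ ⊕ ξ = fun (λ u m → app ζ u m + app ξ u m)
              (λ u v u≈v p → +-cong (app-cong ζ u v u≈v p) (app-cong ξ u v u≈v p))

  ⊖_ : Fun → Fun
  ⊖ ζ = fun (λ u m → - app ζ u m) (λ u v u≈v p → -‿cong (app-cong ζ u v u≈v p))

  U : ℕ → Fun → Fun
  U j ζ = fun (λ u m → d j u * app ζ (u · s j) m)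
    (λ u v u≈v p → *-cong (d-cong j u v u≈v) (app-cong ζ (u · s j) (v · s j) (·-congʳ u v (s j) u≈v) p))

  X : ℕ → Fun → Fun
  X k ζ = fun (λ u m → app ζ u (k ∷ m)) (λ u v u≈v p → app-cong ζ u v u≈v (↭prep k p))

  Δ : ℕ → Fun → Fun
  Δ i ζ = fun (λ u → dd i (app ζ u))
    (λ u v {m} u≈v p → trans (dd-cong i (λ n → app-cong ζ u v u≈v ↭refl) m)
      (dd-symmetric i (λ q → app-cong ζ v v (λ _ → ≡.refl) q) p))

  -- Right multiplication by the factor `1 + xₖ uⱼ`.
  H : ℕ → ℕ → Fun → Fun
  H k j ζ = ζ ⊕ X k (U j ζ)

  ⊕-cong : ∀ {ζ ζ′ ξ ξ′} → ζ ≋ ζ′ → ξ ≋ ξ′ → ζ ⊕ ξ ≋ ζ′ ⊕ ξ′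
  ⊕-cong p q = pointwise λ u m → +-cong (at p u m) (at q u m)

  ⊖-cong : ∀ {ζ ξ} → ζ ≋ ξ → ⊖ ζ ≋ ⊖ ξ
  ⊖-cong p = pointwise λ u m → -‿cong (at p u m)

  U-cong : ∀ j {ζ ξ} → ζ ≋ ξ → U j ζ ≋ U j ξ
  U-cong j p = pointwise λ u m → *-congˡ (at p (u · s j) m)

  X-cong : ∀ k {ζ ξ} → ζ ≋ ξ → X k ζ ≋ X k ξ
  X-cong k p = pointwise λ u m → at p u (k ∷ m)

  Δ-cong : ∀ i {ζ ξ} → ζ ≋ ξ → Δ i ζ ≋ Δ i ξ
  Δ-cong i p = pointwise λ u m → dd-cong i (at p u) m

  H-cong : ∀ k j {ζ ξ} → ζ ≋ ξ → H k j ζ ≋ H k j ξ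
  H-cong k j p = ⊕-cong p (X-cong k (U-cong j p))

  U-⊕ : ∀ j ζ ξ → U j (ζ ⊕ ξ) ≋ U j ζ ⊕ U j ξ
  U-⊕ j ζ ξ = pointwise λ u m → distribˡ _ _ _

  Δ-⊕ : ∀ i ζ ξ → Δ i (ζ ⊕ ξ) ≋ Δ i ζ ⊕ Δ i ξ
  Δ-⊕ i ζ ξ = pointwise λ u m → dd-+ i (app ζ u) (app ξ u) m

  Δ-⊖ : ∀ i ζ → Δ i (⊖ ζ) ≋ ⊖ Δ i ζ
  Δ-⊖ i ζ = pointwise λ u m → trans (dd-cong i (λ n → sym (-1*x≈-x (app ζ u n))) m)
    (trans (dd-*ˡ i (- 1#) (app ζ u) m) (-1*x≈-x _))

  UΔ : ∀ j i ζ → U j (Δ i ζ) ≋ Δ i (U j ζ)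
  UΔ j i ζ = pointwise λ u m → sym (dd-*ˡ i (d j u) (app ζ (u · s j)) m)

  XΔ-first : ∀ i ζ → X i (Δ i ζ) ≋ ζ ⊕ Δ i (X (suc i) ζ)
  XΔ-first i ζ = pointwise λ u m → dd-first i (app ζ u) m

  XΔ-second : ∀ i ζ → X (suc i) (Δ i ζ) ≋ ⊖ ζ ⊕ Δ i (X i ζ)
  XΔ-second i ζ = pointwise λ u m → dd-second i (app ζ u) m

  XΔ-other : ∀ {k} i ζ → k ≢ i → k ≢ suc i → X k (Δ i ζ) ≋ Δ i (X k ζ)
  XΔ-other i ζ p q = pointwise λ u m → dd-other i (app ζ u) m p q

  -- On functionals `Δ i` acts first on the full product with the test monomial or on the monomial
  -- alone, according to the order of the operators. Both agree because `xₖ` is fixed by `sᵢ`.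
  HΔ-other : ∀ {k} i j ζ → k ≢ i → k ≢ suc i → H k j (Δ i ζ) ≋ Δ i (H k j ζ)
  HΔ-other {k} i j ζ p q = begin
    Δ i ζ ⊕ X k (U j (Δ i ζ))   ≈⟨ ⊕-cong ≋.refl (X-cong k (UΔ j i ζ)) ⟩
    Δ i ζ ⊕ X k (Δ i (U j ζ))   ≈⟨ ⊕-cong ≋.refl (XΔ-other i (U j ζ) p q) ⟩
    Δ i ζ ⊕ Δ i (X k (U j ζ))   ≈⟨ Δ-⊕ i ζ (X k (U j ζ)) ⟨
    Δ i (H k j ζ)               ∎
    where open ≋-Reasoning

  private
    lt-cong : ∀ {x x′ y y′} → x ≡ x′ → y ≡ y′ → ⟦ x <? y ⟧ ≈ ⟦ x′ <? y′ ⟧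
    lt-cong p q = reflexive (cong₂ (λ x y → ⟦ x <? y ⟧) p q)

  d-nil : ∀ j u → d j u * d j (u · s j) ≈ 0#
  d-nil j u = ⟦⟧-0 (desc? j u) λ desc → ⟦⟧-no (desc? j (u · s j)) λ desc′ →
    Asc⇒¬Desc j (u · s j) (·s-Asc j u desc) desc′

  UU≋0 : ∀ j ζ u m → app (U j (U j ζ)) u m ≈ 0#
  UU≋0 j ζ u m = trans (sym (*-assoc _ _ _)) (trans (*-congʳ (d-nil j u)) (zeroˡ _))

  Far : ℕ → ℕ → Set
  Far i j = suc i < j ⊎ suc j < i

  module _ {i j : ℕ} where

    far-≢ : Far i j → (i ≢ j × i ≢ suc j) × (suc i ≢ j × suc i ≢ suc j)
    far-≢ (inj₁ p) = (ℕ.<⇒≢ (ℕ.<-trans (ℕ.n<1+n i) p) , ℕ.<⇒≢ (ℕ.<-trans (ℕ.n<1+n i) (ℕ.m<n⇒m<1+n p))) ,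
                     (ℕ.<⇒≢ p , ℕ.<⇒≢ (ℕ.m<n⇒m<1+n p))
    far-≢ (inj₂ p) = (ℕ.>⇒≢ (ℕ.<-trans (ℕ.n<1+n j) p) , ℕ.>⇒≢ p) ,
                     (ℕ.>⇒≢ (ℕ.m<n⇒m<1+n (ℕ.<-trans (ℕ.n<1+n j) p)) , ℕ.>⇒≢ (ℕ.m<n⇒m<1+n p))

    d-far : Far i j → ∀ u → d i (u · s j) ≈ d i u
    d-far far u = lt-cong (cong (to u) (swap-≢ j (suc j) (proj₁ q) (proj₂ q)))
                          (cong (to u) (swap-≢ j (suc j) (proj₁ p) (proj₂ p)))
      where
      p = proj₁ (far-≢ far)
      q = proj₂ (far-≢ far)

    ·s·s-far : Far i j → ∀ u → u · s i · s j ≈ₛ u · s j · s i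
    ·s·s-far far u n = ≡.trans (·s·tr u i j (suc j) n) (cong₂ (λ x y → to (u · ⦅ x , y ⦆ · s i) n)
      (swap-≢ i (suc i) (proj₁ (proj₁ p) ∘ ≡.sym) (proj₁ (proj₂ p) ∘ ≡.sym))
      (swap-≢ i (suc i) (proj₂ (proj₁ p) ∘ ≡.sym) (proj₂ (proj₂ p) ∘ ≡.sym)))
      where p = far-≢ far

  Far-sym : ∀ {i j} → Far i j → Far j i
  Far-sym (inj₁ p) = inj₂ p
  Far-sym (inj₂ p) = inj₁ p

  UU-far : ∀ {i j} → Far i j → ∀ ζ → U i (U j ζ) ≋ U j (U i ζ)
  UU-far {i} {j} far ζ = pointwise λ u m → begin
    d i u * (d j (u · s i) * app ζ (u · s i · s j) m)
      ≈⟨ x∙yz≈y∙xz _ _ _ ⟩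
    d j (u · s i) * (d i u * app ζ (u · s i · s j) m)
      ≈⟨ *-cong (d-far (Far-sym far) u)
           (*-cong (sym (d-far far u)) (app-cong ζ (u · s i · s j) (u · s j · s i) (·s·s-far far u) ↭refl)) ⟩
    d j u * (d i (u · s j) * app ζ (u · s j · s i) m) ∎
    where open ≈-Reasoning

  XX : ∀ k l ζ → X k (X l ζ) ≋ X l (X k ζ)
  XX k l ζ = pointwise λ u m → app-cong ζ u u (λ _ → ≡.refl) (↭swap l k ↭refl)

  UH-far : ∀ {i j} k → Far i j → ∀ ζ → U i (H k j ζ) ≋ H k j (U i ζ)
  UH-far {i} {j} k far ζ = ≋.trans (U-⊕ i ζ (X k (U j ζ)))
    (⊕-cong ≋.refl (X-cong k (UU-far far ζ)))

  HH-far : ∀ {i j} k l → Far i j → ∀ ζ → H k i (H l j ζ) ≋ H l j (H k i ζ)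
  HH-far {i} {j} k l far ζ = begin
    H l j ζ ⊕ X k (U i (H l j ζ))
      ≈⟨ ⊕-cong ≋.refl (X-cong k (UH-far l far ζ)) ⟩
    (ζ ⊕ X l (U j ζ)) ⊕ (X k (U i ζ) ⊕ X k (X l (U j (U i ζ))))
      ≈⟨ ⊕-cong ≋.refl (⊕-cong ≋.refl (XX k l (U j (U i ζ)))) ⟩
    (ζ ⊕ X l (U j ζ)) ⊕ (X k (U i ζ) ⊕ X l (X k (U j (U i ζ))))
      ≈⟨ (pointwise λ u m → interchange _ _ _ _) ⟩
    (ζ ⊕ X k (U i ζ)) ⊕ (X l (U j ζ) ⊕ X l (X k (U j (U i ζ))))
      ≈⟨ ⊕-cong ≋.refl (X-cong l (U-⊕ j ζ (X k (U i ζ)))) ⟨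
    H l j (H k i ζ) ∎
    where open ≋-Reasoning

  -- Both products are the same three comparisons in opposite order: they test whether `u` reverses
  -- all of the positions `i`, `i + 1`, `i + 2`.
  d-braid : ∀ i u → let j = suc i in
    d i u * (d j (u · s i) * d i (u · s i · s j)) ≈ d j u * (d i (u · s j) * d j (u · s j · s i))
  d-braid i u = begin
    d i u * (d j (u · s i) * d i (u · s i · s j))
      ≈⟨ *-congˡ (*-cong
           (lt-cong (cong (to u) fix₂) (cong (to u) (σ-r i)))
           (lt-cong (cong (to u) (≡.trans (cong (σ i) (σ-l j)) fix₂))
                    (cong (to u) (≡.trans (cong (σ i) fix₀) (σ-l i))))) ⟩
    x * (y * z)
      ≈⟨ *-Semigroup.x∙yz≈z∙yx x y z ⟩
    z * (y * x)
      ≈⟨ *-congˡ (*-cong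
           (lt-cong (cong (to u) (σ-l j)) (cong (to u) fix₀))
           (lt-cong (cong (to u) (≡.trans (cong (σ j) fix₂) (σ-r j)))
                    (cong (to u) (≡.trans (cong (σ j) (σ-r i)) fix₀)))) ⟨
    d j u * (d i (u · s j) * d j (u · s j · s i)) ∎
    where
    open ≈-Reasoning
    j = suc i
    fix₂ : σ i (suc j) ≡ suc j
    fix₂ = swap-≢ i j (ℕ.>⇒≢ (ℕ.<-trans (ℕ.n<1+n i) (ℕ.n<1+n j))) ℕ.1+n≢n
    fix₀ : σ j i ≡ i
    fix₀ = swap-≢ j (suc j) (ℕ.<⇒≢ (ℕ.n<1+n i)) (ℕ.<⇒≢ (ℕ.<-trans (ℕ.n<1+n i) (ℕ.n<1+n j)))
    x = d i u
    y = ⟦ to u (suc j) <? to u i ⟧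
    z = d j u

  -- Conjugating either generator by the other gives the transposition of `i` and `i + 2`.
  ·s-braid : ∀ i u → let j = suc i in u · s i · s j · s i ≈ₛ u · s j · s i · s j
  ·s-braid i u n = cong (to u) (≡.sym (conj n))
    where
    j = suc i
    fix₂ : σ i (suc j) ≡ suc j
    fix₂ = swap-≢ i j (ℕ.>⇒≢ (ℕ.<-trans (ℕ.n<1+n i) (ℕ.n<1+n j))) ℕ.1+n≢n
    fix₀ : σ j i ≡ i
    fix₀ = swap-≢ j (suc j) (ℕ.<⇒≢ (ℕ.n<1+n i)) (ℕ.<⇒≢ (ℕ.<-trans (ℕ.n<1+n i) (ℕ.n<1+n j)))
    conjₗ : ∀ n → σ j (σ i n) ≡ swap i (suc j) (σ j n)
    conjₗ n = ≡.trans (≡.sym (swap-natural (σ j) (swap-injective j (suc j)) i j n))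
                      (cong₂ (λ x y → swap x y (σ j n)) fix₀ (σ-l j))
    conjᵣ : ∀ n → σ i (σ j n) ≡ swap i (suc j) (σ i n)
    conjᵣ n = ≡.trans (≡.sym (swap-natural (σ i) (swap-injective i j) j (suc j) n))
                      (cong₂ (λ x y → swap x y (σ i n)) (σ-r i) fix₂)
    conj : ∀ n → σ j (σ i (σ j n)) ≡ σ i (σ j (σ i n))
    conj n = ≡.trans (conjₗ (σ j n)) (≡.trans (cong (swap i (suc j)) (swap-involutive j (suc j) n))
      (≡.sym (≡.trans (conjᵣ (σ i n)) (cong (swap i (suc j)) (swap-involutive i j n)))))

-- Divided differences of the Fomin-Stanley product.

-- The rows before row `i` contain neither `xᵢ` nor `xᵢ₊₁`, so ∂ᵢ passes through them.
rows-split : ∀ d {k i} n → d ℕ.+ k ≡ i →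
  ∃ λ L → All (λ t → proj₁ t < i) L × rows k (d ℕ.+ n) ≡ L ++ rows i n
rows-split zero    n ≡.refl = [] , [] , ≡.refl
rows-split (suc d) {k} n ≡.refl with rows-split d {suc k} n (ℕ.+-suc d k)
... | L , L< , eq = row k k (suc (d ℕ.+ n)) ++ L
  , All.++⁺ (All.map (λ { (≡.refl , _) → subst (suc k ≤_) (ℕ.+-suc d k) (ℕ.m≤n+m (suc k) d) })
                     (row⇒ k k (suc (d ℕ.+ n))))
            L<
  , ≡.trans (cong (row k k (suc (d ℕ.+ n)) ++_) eq) (≡.sym (++-assoc (row k k (suc (d ℕ.+ n))) L _))

module Products {c r} (R : CommutativeRing c r) where

  open Operators R public

  A : ℕ → ℕ → ℕ → Fun → Fun
  A k j zero    ζ = ζ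
  A k j (suc n) ζ = H k j (A k (suc j) n ζ)

  A-H-far : ∀ k l j i n → suc i < j → ∀ ζ → A k j n (H l i ζ) ≋ H l i (A k j n ζ)
  A-H-far k l j i zero    i<j ζ = ≋.refl
  A-H-far k l j i (suc n) i<j ζ = ≋.trans
    (H-cong k j (A-H-far k l (suc j) i n (ℕ.m<n⇒m<1+n i<j) ζ))
    (HH-far k l (inj₂ i<j) (A k (suc j) n ζ))

  -- The symmetric factor 1 + (x + y) uⱼ + x y (uⱼ uⱼ₊₁ − uⱼ₊₁ uⱼ).

  Q : ℕ → ℕ → ℕ → Fun → Fun
  Q x y j ζ = (ζ ⊕ (X x (U j ζ) ⊕ X y (U j ζ))) ⊕
    (X x (X y (U (suc j) (U j ζ))) ⊕ ⊖ X x (X y (U j (U (suc j) ζ))))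

  Q-cong : ∀ x y j {ζ ξ} → ζ ≋ ξ → Q x y j ζ ≋ Q x y j ξ
  Q-cong x y j p = ⊕-cong
    (⊕-cong p (⊕-cong (X-cong x (U-cong j p)) (X-cong y (U-cong j p))))
    (⊕-cong (X-cong x (X-cong y (U-cong (suc j) (U-cong j p))))
            (⊖-cong (X-cong x (X-cong y (U-cong j (U-cong (suc j) p))))))

  private
    open Solver using (solve; _:=_; _:+_; _:*_)

    -- `HHH` read off at one basis element: `a` to `g′` are descent indicators, the other letters
    -- values of the functional. The first three hypotheses are the two nil relations and the braid
    -- relation.
    expansion : ∀ {a b c d e f g g′ v v′ r r′} p₀ p₁ p₁′ p₂ t w n₁ n₂ →
      a * e ≈ 0# → c * f ≈ 0# → a * (c * g) ≈ b * (d * g′) → v ≈ v′ → r ≈ r′ →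
      ((p₀ + a * p₁) + b * (p₂ + d * v)) + a * ((p₁′ + e * n₁) + c * (t + g * r)) ≈
      ((p₀ + b * p₂) + (a * (p₁ + c * w) + a * (p₁′ + c * t))) +
        (b * (d * (v′ + g′ * r′)) + - (a * (c * (w + f * n₂))))
    expansion {a} {b} {c} {d} {e} {f} {g} {g′} {v} {v′} {r} {r′} p₀ p₁ p₁′ p₂ t w n₁ n₂
              ae≈0 cf≈0 braid v≈v′ r≈r′ = begin
      ((p₀ + a * p₁) + b * (p₂ + d * v)) + a * ((p₁′ + e * n₁) + c * (t + g * r))
        ≈⟨ solve 14 (λ a b c d e g v r p₀ p₁ p₁′ p₂ t n₁ →
             ((p₀ :+ a :* p₁) :+ b :* (p₂ :+ d :* v)) :+ a :* ((p₁′ :+ e :* n₁) :+ c :* (t :+ g :* r)) :=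
             ((p₀ :+ a :* p₁ :+ b :* p₂ :+ a :* p₁′ :+ a :* (c :* t) :+ b :* (d :* v)) :+ (a :* (c :* g)) :* r)
               :+ (a :* e) :* n₁) refl a b c d e g v r p₀ p₁ p₁′ p₂ t n₁ ⟩
      ((p₀ + a * p₁ + b * p₂ + a * p₁′ + a * (c * t) + b * (d * v)) + (a * (c * g)) * r) + (a * e) * n₁
        ≈⟨ +-cong (+-cong (+-congˡ (*-congˡ (*-congˡ v≈v′))) (*-cong braid r≈r′))
                  (trans (*-congʳ ae≈0) (zeroˡ n₁)) ⟩
      ((p₀ + a * p₁ + b * p₂ + a * p₁′ + a * (c * t) + b * (d * v′)) + (b * (d * g′)) * r′) + 0#
        -- The term subtracted in `Q` cancels against one that `1 + y uⱼ` contributes. Both are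
        -- introduced here, the negative one as an atom `z` for the semiring normalisation.
        ≈⟨ +-congˡ (-‿inverseʳ (a * (c * w))) ⟨
      ((p₀ + a * p₁ + b * p₂ + a * p₁′ + a * (c * t) + b * (d * v′)) + (b * (d * g′)) * r′)
        + (a * (c * w) + z)
        ≈⟨ solve 14 (λ a b c d g′ v′ r′ p₀ p₁ p₁′ p₂ t w z →
             ((p₀ :+ a :* p₁ :+ b :* p₂ :+ a :* p₁′ :+ a :* (c :* t) :+ b :* (d :* v′))
               :+ (b :* (d :* g′)) :* r′) :+ (a :* (c :* w) :+ z) :=
             ((p₀ :+ b :* p₂) :+ (a :* (p₁ :+ c :* w) :+ a :* (p₁′ :+ c :* t))) :+
             (b :* (d :* (v′ :+ g′ :* r′)) :+ z)) refl a b c d g′ v′ r′ p₀ p₁ p₁′ p₂ t w z ⟩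
      ((p₀ + b * p₂) + (a * (p₁ + c * w) + a * (p₁′ + c * t))) + (b * (d * (v′ + g′ * r′)) + z)
        ≈⟨ +-congˡ (+-congˡ (-‿cong (*-congˡ kill))) ⟨
      ((p₀ + b * p₂) + (a * (p₁ + c * w) + a * (p₁′ + c * t))) +
        (b * (d * (v′ + g′ * r′)) + - (a * (c * (w + f * n₂)))) ∎
      where
      open ≈-Reasoning
      z = - (a * (c * w))
      kill : c * (w + f * n₂) ≈ c * w
      kill = trans (distribˡ c w _) (trans (+-congˡ (trans (sym (*-assoc c f n₂))
        (trans (*-congʳ cf≈0) (zeroˡ n₂)))) (+-identityʳ _))

  -- With `j = i + 1` this is `(1 + x uᵢ)(1 + y uⱼ)(1 + y uᵢ)` with `1 + y uⱼ` brought to the front: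
  -- squares of generators vanish, and the cubic terms agree by the braid relation.
  HHH : ∀ x y i ξ → H y i (H y (suc i) (H x i ξ)) ≋ Q x y i (H y (suc i) ξ)
  HHH x y i ξ = pointwise λ u m → let j = suc i in expansion
    (app ξ u m) (app ξ (u · s i) (x ∷ m)) (app ξ (u · s i) (y ∷ m)) (app ξ (u · s j) (y ∷ m))
    (app ξ (u · s i · s j) (y ∷ y ∷ m)) (app ξ (u · s i · s j) (y ∷ x ∷ m))
    (app ξ (u · s i · s i) (x ∷ y ∷ m)) (app ξ (u · s i · s j · s j) (y ∷ y ∷ x ∷ m))
    (d-nil i u) (d-nil j (u · s i)) (d-braid i u)
    (app-cong ξ (u · s j · s i) (u · s j · s i) (λ _ → ≡.refl) (↭swap x y ↭refl))
    (app-cong ξ (u · s i · s j · s i) (u · s j · s i · s j) (·s-braid i u)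
      (↭trans (↭swap x y ↭refl) (↭prep y (↭swap x y ↭refl))))

  -- The factor `1 + x uⱼ` commutes with the factors of `y` whose letters are at least `j + 2`; what
  -- then remains is `HHH`.
  A-A : ∀ x y j n ζ →
    A y j (suc (suc n)) (A x j (suc (suc n)) ζ) ≋ Q x y j (A y (suc j) (suc n) (A x (suc j) (suc n) ζ))
  A-A x y j n ζ = begin
    H y j (H y (suc j) (A y (suc (suc j)) n (H x j ξ)))
      ≈⟨ H-cong y j (H-cong y (suc j) (A-H-far y x (suc (suc j)) j n ℕ.≤-refl ξ)) ⟩
    H y j (H y (suc j) (H x j (A y (suc (suc j)) n ξ)))
      ≈⟨ HHH x y j (A y (suc (suc j)) n ξ) ⟩
    Q x y j (A y (suc j) (suc n) ξ) ∎
    where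
    open ≋-Reasoning
    ξ = A x (suc j) (suc n) ζ

  module _ (i : ℕ) where

    -- ∂ᵢ is linear over polynomials invariant under `sᵢ`. Here two twisted Leibniz steps leave
    -- constant terms of opposite sign.
    XX-Δ : ∀ ζ → X i (X (suc i) (Δ i ζ)) ≋ Δ i (X i (X (suc i) ζ))
    XX-Δ ζ = begin
      X i (X (suc i) (Δ i ζ))
        ≈⟨ X-cong i (XΔ-second i ζ) ⟩
      ⊖ X i ζ ⊕ X i (Δ i (X i ζ))
        ≈⟨ ⊕-cong ≋.refl (XΔ-first i (X i ζ)) ⟩
      ⊖ X i ζ ⊕ (X i ζ ⊕ Δ i (X (suc i) (X i ζ)))
        ≈⟨ (pointwise λ u m → trans (sym (+-assoc _ _ _))
              (trans (+-congʳ (-‿inverseˡ _)) (+-identityˡ _))) ⟩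
      Δ i (X (suc i) (X i ζ))
        ≈⟨ Δ-cong i (XX (suc i) i ζ) ⟩
      Δ i (X i (X (suc i) ζ)) ∎
      where open ≋-Reasoning

    X+X-Δ : ∀ ζ → X i (Δ i ζ) ⊕ X (suc i) (Δ i ζ) ≋ Δ i (X i ζ ⊕ X (suc i) ζ)
    X+X-Δ ζ = begin
      X i (Δ i ζ) ⊕ X (suc i) (Δ i ζ)
        ≈⟨ ⊕-cong (XΔ-first i ζ) (XΔ-second i ζ) ⟩
      (ζ ⊕ Δ i (X (suc i) ζ)) ⊕ (⊖ ζ ⊕ Δ i (X i ζ))
        ≈⟨ (pointwise λ u m → trans (interchange _ _ _ _)
              (trans (+-congʳ (-‿inverseʳ _)) (trans (+-identityˡ _) (+-comm _ _)))) ⟩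
      Δ i (X i ζ) ⊕ Δ i (X (suc i) ζ)
        ≈⟨ Δ-⊕ i (X i ζ) (X (suc i) ζ) ⟨
      Δ i (X i ζ ⊕ X (suc i) ζ) ∎
      where open ≋-Reasoning

    linear-Δ : ∀ j ζ → let S = λ ζ → ζ ⊕ (X i (U j ζ) ⊕ X (suc i) (U j ζ)) in
               S (Δ i ζ) ≋ Δ i (S ζ)
    linear-Δ j ζ = begin
      Δ i ζ ⊕ (X i (U j (Δ i ζ)) ⊕ X (suc i) (U j (Δ i ζ)))
        ≈⟨ ⊕-cong ≋.refl (⊕-cong (X-cong i (UΔ j i ζ)) (X-cong (suc i) (UΔ j i ζ))) ⟩
      Δ i ζ ⊕ (X i (Δ i (U j ζ)) ⊕ X (suc i) (Δ i (U j ζ)))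
        ≈⟨ ⊕-cong ≋.refl (X+X-Δ (U j ζ)) ⟩
      Δ i ζ ⊕ Δ i (X i (U j ζ) ⊕ X (suc i) (U j ζ))
        ≈⟨ Δ-⊕ i ζ (X i (U j ζ) ⊕ X (suc i) (U j ζ)) ⟨
      Δ i (ζ ⊕ (X i (U j ζ) ⊕ X (suc i) (U j ζ))) ∎
      where open ≋-Reasoning

    quadratic-Δ : ∀ j k ζ → X i (X (suc i) (U j (U k (Δ i ζ)))) ≋ Δ i (X i (X (suc i) (U j (U k ζ))))
    quadratic-Δ j k ζ = ≋.trans
      (X-cong i (X-cong (suc i) (≋.trans (U-cong j (UΔ k i ζ)) (UΔ j i (U k ζ)))))
      (XX-Δ (U j (U k ζ)))

    Q-Δ : ∀ j ζ → Q i (suc i) j (Δ i ζ) ≋ Δ i (Q i (suc i) j ζ)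
    Q-Δ j ζ = begin
      Q i (suc i) j (Δ i ζ)
        ≈⟨ ⊕-cong (linear-Δ j ζ) (⊕-cong (quadratic-Δ (suc j) j ζ) (⊖-cong (quadratic-Δ j (suc j) ζ))) ⟩
      Δ i S ⊕ (Δ i T ⊕ ⊖ Δ i T′)
        ≈⟨ ⊕-cong ≋.refl (⊕-cong ≋.refl (Δ-⊖ i T′)) ⟨
      Δ i S ⊕ (Δ i T ⊕ Δ i (⊖ T′))
        ≈⟨ ⊕-cong ≋.refl (Δ-⊕ i T (⊖ T′)) ⟨
      Δ i S ⊕ Δ i (T ⊕ ⊖ T′)
        ≈⟨ Δ-⊕ i S (T ⊕ ⊖ T′) ⟨
      Δ i (Q i (suc i) j ζ) ∎
      where
      open ≋-Reasoning
      S  = ζ ⊕ (X i (U j ζ) ⊕ X (suc i) (U j ζ))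
      T  = X i (X (suc i) (U (suc j) (U j ζ)))
      T′ = X i (X (suc i) (U j (U (suc j) ζ)))

    HH-linear : ∀ x y j ζ → H y j (H x j ζ) ≋ ζ ⊕ (X x (U j ζ) ⊕ X y (U j ζ))
    HH-linear x y j ζ = pointwise λ u m → trans (+-congˡ (trans (distribˡ _ _ _)
      (trans (+-congˡ (UU≋0 j ζ u (x ∷ y ∷ m))) (+-identityʳ _)))) (+-assoc _ _ _)

    A-A-Δ : ∀ j n ζ → A (suc i) j n (A i j n (Δ i ζ)) ≋ Δ i (A (suc i) j n (A i j n ζ))
    A-A-Δ j zero          ζ = ≋.refl
    A-A-Δ j (suc zero)    ζ = ≋.trans (HH-linear i (suc i) j (Δ i ζ))
      (≋.trans (linear-Δ j ζ) (Δ-cong i (≋.sym (HH-linear i (suc i) j ζ))))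
    A-A-Δ j (suc (suc n)) ζ = begin
      A (suc i) j (suc (suc n)) (A i j (suc (suc n)) (Δ i ζ))
        ≈⟨ A-A i (suc i) j n (Δ i ζ) ⟩
      Q i (suc i) j (A (suc i) (suc j) (suc n) (A i (suc j) (suc n) (Δ i ζ)))
        ≈⟨ Q-cong i (suc i) j (A-A-Δ (suc j) (suc n) ζ) ⟩
      Q i (suc i) j (Δ i (A (suc i) (suc j) (suc n) (A i (suc j) (suc n) ζ)))
        ≈⟨ Q-Δ j (A (suc i) (suc j) (suc n) (A i (suc j) (suc n) ζ)) ⟩
      Δ i (Q i (suc i) j (A (suc i) (suc j) (suc n) (A i (suc j) (suc n) ζ)))
        ≈⟨ Δ-cong i (A-A i (suc i) j n ζ) ⟨
      Δ i (A (suc i) j (suc (suc n)) (A i j (suc (suc n)) ζ)) ∎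
      where open ≋-Reasoning

    -- With y = xᵢ₊₁ and C = B (1 + y uᵢ) the symmetric product above, ∂ᵢ C = 0 gives
    -- ∂ᵢ B = B uᵢ.
    A-B-Δ : ∀ n ζ → let B = λ ζ → A (suc i) (suc i) n (A i i (suc n) ζ) in
            ∃ λ ω → B (Δ i ζ) ≋ Δ i ω ⊕ U i (B ζ)
    -- Since uᵢ squares to zero, `C = B (1 + y uᵢ)` inverts to `B = C (1 - y uᵢ)`. Pulling `Δ i` out
    -- past `y = xᵢ₊₁` leaves `xᵢ` in its place, hence this witness, and the Leibniz term is
    -- `U i C`, equal to `U i B`.
    A-B-Δ n ζ = C ⊕ ⊖ X i (U i C) , pointwise λ u m → begin
      app BΔ u m
        ≈⟨ cancelʳ (app BΔ u m) (app (U i BΔ) u (suc i ∷ m)) ⟨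
      (app BΔ u m + app (U i BΔ) u (suc i ∷ m)) - app (U i BΔ) u (suc i ∷ m)
        ≈⟨ +-cong (at CΔ≋ΔC u m) (-‿cong (at UBΔ u (suc i ∷ m))) ⟩
      app (Δ i C) u m - app (X (suc i) (Δ i (U i C))) u m
        ≈⟨ +-congˡ (-‿cong (at (XΔ-second i (U i C)) u m)) ⟩
      app (Δ i C) u m - (- app (U i C) u m + app (Δ i (X i (U i C))) u m)
        ≈⟨ +-congˡ (sym (-‿+-comm _ _)) ⟩
      app (Δ i C) u m + (- - app (U i C) u m + - app (Δ i (X i (U i C))) u m)
        ≈⟨ +-congˡ (trans (+-comm _ _) (+-cong (sym (at (Δ-⊖ i (X i (U i C))) u m))
             (trans (-‿involutive _) (at UC u m)))) ⟩
      app (Δ i C) u m + (app (Δ i (⊖ X i (U i C))) u m + app (U i B) u m)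
        ≈⟨ +-assoc _ _ _ ⟨
      (app (Δ i C) u m + app (Δ i (⊖ X i (U i C))) u m) + app (U i B) u m
        ≈⟨ +-congʳ (at (Δ-⊕ i C (⊖ X i (U i C))) u m) ⟨
      app (Δ i (C ⊕ ⊖ X i (U i C))) u m + app (U i B) u m ∎
      where
      open ≈-Reasoning
      B  = A (suc i) (suc i) n (A i i (suc n) ζ)
      BΔ = A (suc i) (suc i) n (A i i (suc n) (Δ i ζ))
      C  = H (suc i) i B
      CΔ≋ΔC : H (suc i) i BΔ ≋ Δ i C
      CΔ≋ΔC = A-A-Δ i (suc n) ζ
      U-absorb : ∀ ξ → U i (H (suc i) i ξ) ≋ U i ξ
      U-absorb ξ = pointwise λ u m → trans (distribˡ _ _ _)
        (trans (+-congˡ (UU≋0 i ξ u (suc i ∷ m))) (+-identityʳ _))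
      UC : U i C ≋ U i B
      UC = U-absorb B
      UBΔ : U i BΔ ≋ Δ i (U i C)
      UBΔ = ≋.trans (≋.sym (U-absorb BΔ)) (≋.trans (U-cong i CΔ≋ΔC) (UΔ i i C))
      cancelʳ : ∀ x y → (x + y) - y ≈ x
      cancelʳ x y = trans (+-assoc x y _) (trans (+-congˡ (-‿inverseʳ y)) (+-identityʳ x))

  run : List (ℕ × ℕ) → Fun → Fun
  run L ζ = foldl (λ ζ (k , j) → H k j ζ) ζ L

  run-cong : ∀ L {ζ ξ} → ζ ≋ ξ → run L ζ ≋ run L ξ
  run-cong []            p = p
  run-cong ((k , j) ∷ L) p = run-cong L (H-cong k j p)

  run-++ : ∀ L L′ ζ → run (L ++ L′) ζ ≡ run L′ (run L ζ)
  run-++ L L′ ζ = foldl-++ _ ζ L L′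

  run-row : ∀ k j n ζ → run (row k j n) ζ ≡ A k j n ζ
  run-row k j zero    ζ = ≡.refl
  run-row k j (suc n) ζ = ≡.trans (run-++ (row k (suc j) n) [ k , j ] ζ) (cong (H k j) (run-row k (suc j) n ζ))

  run-left : ∀ i L → All (λ t → proj₁ t < i) L → ∀ ζ → run L (Δ i ζ) ≋ Δ i (run L ζ)
  run-left i []            []         ζ = ≋.refl
  run-left i ((k , j) ∷ L) (k<i ∷ L<) ζ = ≋.trans
    (run-cong L (HΔ-other i j ζ (ℕ.<⇒≢ k<i) (ℕ.<⇒≢ (ℕ.m<n⇒m<1+n k<i))))
    (run-left i L L< (H k j ζ))

  H-⊕ : ∀ k j ζ ξ → H k j (ζ ⊕ ξ) ≋ H k j ζ ⊕ H k j ξ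
  H-⊕ k j ζ ξ = ≋.trans (⊕-cong ≋.refl (X-cong k (U-⊕ j ζ ξ)))
    (pointwise λ u m → interchange _ _ _ _)

  -- The rows after row `i + 1` use only variables and letters beyond `i + 1`, so both summands pass
  -- through.
  run-right : ∀ i L → All (λ (k , j) → suc i < k × suc i < j) L → ∀ ω η →
    run L (Δ i ω ⊕ U i η) ≋ Δ i (run L ω) ⊕ U i (run L η)
  run-right i []            []                   ω η = ≋.refl
  run-right i ((k , j) ∷ L) ((i<k , i<j) ∷ L>) ω η = ≋.trans
    (run-cong L (≋.trans (H-⊕ k j (Δ i ω) (U i η)) (⊕-cong
      (HΔ-other i j ω (ℕ.>⇒≢ (ℕ.<-trans (ℕ.n<1+n i) i<k)) (ℕ.>⇒≢ i<k))
      (≋.sym (UH-far k (inj₁ i<j) η)))))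
    (run-right i L L> (H k j ω) (H k j η))

  run-rows-Δ : ∀ i n ζ u →
    app (run (rows i (suc n)) (Δ i ζ)) u [] ≈ app (U i (run (rows i (suc n)) ζ)) u []
  run-rows-Δ i n ζ u = begin
    app (run (rows i (suc n)) (Δ i ζ)) u []
      ≡⟨ cong (λ ζ → app ζ u []) (split n (Δ i ζ)) ⟩
    app (run (tail n) (B (Δ i ζ))) u []
      ≈⟨ at (run-cong (tail n) (proj₂ (A-B-Δ i n ζ))) u [] ⟩
    app (run (tail n) (Δ i ω ⊕ U i (B ζ))) u []
      ≈⟨ at (run-right i (tail n) (tail> n) ω (B ζ)) u [] ⟩
    -- At the empty monomial the `Δ i` summand is the derivative of a constant.
    0# + app (U i (run (tail n) (B ζ))) u []
      ≈⟨ +-identityˡ _ ⟩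
    app (U i (run (tail n) (B ζ))) u []
      ≡⟨ cong (λ ζ → app (U i ζ) u []) (split n ζ) ⟨
    app (U i (run (rows i (suc n)) ζ)) u [] ∎
    where
    open ≈-Reasoning
    B = λ ζ → A (suc i) (suc i) n (A i i (suc n) ζ)
    ω = proj₁ (A-B-Δ i n ζ)
    tail : ℕ → List (ℕ × ℕ)
    tail zero    = []
    tail (suc n) = rows (suc (suc i)) n
    tail> : ∀ n → All (λ (k , j) → suc i < k × suc i < j) (tail n)
    tail> zero    = []
    tail> (suc n) = All.map (λ (k≥ , j≥ , _) → k≥ , ℕ.≤-trans k≥ j≥) (rows⇒ (suc (suc i)) n)
    rows≡ : ∀ n → rows (suc i) n ≡ row (suc i) (suc i) n ++ tail n
    rows≡ zero    = ≡.refl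
    rows≡ (suc n) = ≡.refl
    split : ∀ n ζ → run (rows i (suc n)) ζ ≡ run (tail n) (A (suc i) (suc i) n (A i i (suc n) ζ))
    split n ζ = ≡.trans (run-++ (row i i (suc n)) (rows (suc i) n) ζ)
      (≡.trans (cong₂ run (rows≡ n) (run-row i i (suc n) ζ))
      (≡.trans (run-++ (row (suc i) (suc i) n) (tail n) (A i i (suc n) ζ))
               (cong (run (tail n)) (run-row (suc i) (suc i) n (A i i (suc n) ζ)))))

  run-Δ : ∀ {i N} → i < N → ∀ ζ u →
    app (run (rows 0 N) (Δ i ζ)) u [] ≈ app (U i (run (rows 0 N) ζ)) u []
  run-Δ {i} {N} i<N ζ u with rows-split i {0} (suc (N ℕ.∸ suc i)) (ℕ.+-identityʳ i)
  ... | L , L< , eq = begin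
    app (run (rows 0 N) (Δ i ζ)) u []
      ≡⟨ cong (λ ζ → app ζ u []) (split (Δ i ζ)) ⟩
    app (run rest (run L (Δ i ζ))) u []
      ≈⟨ at (run-cong rest (run-left i L L< ζ)) u [] ⟩
    app (run rest (Δ i (run L ζ))) u []
      ≈⟨ run-rows-Δ i (N ℕ.∸ suc i) (run L ζ) u ⟩
    app (U i (run rest (run L ζ))) u []
      ≡⟨ cong (λ ζ → app (U i ζ) u []) (split ζ) ⟨
    app (U i (run (rows 0 N) ζ)) u [] ∎
    where
    open ≈-Reasoning
    rest = rows i (suc (N ℕ.∸ suc i))
    N≡ : i ℕ.+ suc (N ℕ.∸ suc i) ≡ N
    N≡ = ≡.trans (ℕ.+-suc i _) (ℕ.m+[n∸m]≡n i<N)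
    split : ∀ ζ → run (rows 0 N) ζ ≡ run rest (run L ζ)
    split ζ = ≡.trans (cong (λ L → run L ζ) (≡.trans (cong (rows 0) (≡.sym N≡)) eq)) (run-++ L rest ζ)

-- Schubert polynomials as expanded products.

module Schubert {c r} (R : CommutativeRing c r) where

  open SubSums R public using (∑-subs-∷ʳ; ∑-subs-[])
  open Products R public

  -- φ(𝔖ᵤ), provided that u fixes every n > N.

  onSchubert : ℕ → Functional → S∞ → Carrier
  onSchubert N φ u = ∑ (subs (rows 0 N)) λ z → ⟦ red? u (map proj₂ z) ⟧ * φ (map proj₁ z)

  -- `φ` placed at the identity, the only element with the empty reduced word. The indicator is
  -- `red?` so that it is already the term of the empty sublist.
  initial : ∀ φ → Symmetric φ → Fun
  initial φ sφ = fun (λ u m → ⟦ red? u [] ⟧ * φ m) λ u v u≈v p → *-cong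
    (⟦⟧-⇔ (red? u []) (red? v []) (Red-cong u v [] u≈v) (Red-cong v u [] (≈ₛ-sym u v u≈v))) (sφ p)

  -- A sublist records the factors that contribute `xₖ uⱼ` instead of 1. The last factor acts last,
  -- so the induction is from the end, where a chosen `j` has to be a descent of `u`, just as for
  -- the last letter of a reduced word.
  run≈∑ : ∀ {L} → Reverse L → ∀ φ (sφ : Symmetric φ) u m → app (run L (initial φ sφ)) u m ≈
    (∑ (subs L) λ z → ⟦ red? u (map proj₂ z) ⟧ * φ (map proj₁ z ++ m))
  run≈∑ [] φ sφ u m = sym (+-identityʳ _)
  run≈∑ (L ∶ rL ∶ʳ (k , j)) φ sφ u m = begin
    app (run (L ∷ʳ (k , j)) (initial φ sφ)) u m
      ≡⟨ cong (λ ζ → app ζ u m) (run-++ L [ k , j ] (initial φ sφ)) ⟩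
    app (run L (initial φ sφ)) u m + d j u * app (run L (initial φ sφ)) (u · s j) (k ∷ m)
      ≈⟨ +-cong (run≈∑ rL φ sφ u m) (*-congˡ (run≈∑ rL φ sφ (u · s j) (k ∷ m))) ⟩
    ∑ (subs L) g + d j u * (∑ (subs L) λ z → ⟦ red? (u · s j) (map proj₂ z) ⟧ * φ (map proj₁ z ++ k ∷ m))
      ≈⟨ +-congˡ (∑-*ˡ (d j u) (subs L) _) ⟨
    ∑ (subs L) g + (∑ (subs L) λ z → d j u * (⟦ red? (u · s j) (map proj₂ z) ⟧ * φ (map proj₁ z ++ k ∷ m)))
      ≈⟨ +-congˡ (∑-cong (subs L) λ z → trans (sym (*-assoc _ _ _)) (*-cong (reduced z) (reflexive (index z)))) ⟩
    ∑ (subs L) g + ∑ (subs L) (λ z → g (z ∷ʳ (k , j)))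
      ≈⟨ ∑-subs-∷ʳ L (k , j) g ⟨
    ∑ (subs (L ∷ʳ (k , j))) g ∎
    where
    open ≈-Reasoning
    g = λ z → ⟦ red? u (map proj₂ z) ⟧ * φ (map proj₁ z ++ m)
    index : ∀ z → φ (map proj₁ z ++ k ∷ m) ≡ φ (map proj₁ (z ∷ʳ (k , j)) ++ m)
    index z = cong φ (≡.trans (≡.sym (++-assoc (map proj₁ z) [ k ] m))
                              (cong (_++ m) (≡.sym (map-++ proj₁ z [ k , j ]))))
    reduced : ∀ z → d j u * ⟦ red? (u · s j) (map proj₂ z) ⟧ ≈ ⟦ red? u (map proj₂ (z ∷ʳ (k , j))) ⟧
    reduced z = trans (sym (⟦⟧-× (desc? j u) (red? (u · s j) (map proj₂ z))))
      (trans (⟦⟧-⇔ (desc? j u ×-dec red? (u · s j) (map proj₂ z)) (red? u (map proj₂ z ∷ʳ j))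
                (λ (p , q) → Red-∷ʳ⁺ u (map proj₂ z) j p q) (Red-∷ʳ⁻ u (map proj₂ z) j))
             (reflexive (cong (λ a → ⟦ red? u a ⟧) (≡.sym (map-++ proj₂ z [ k , j ])))))

  onSchubert≈run : ∀ N φ (sφ : Symmetric φ) u →
    onSchubert N φ u ≈ app (run (rows 0 N) (initial φ sφ)) u []
  onSchubert≈run N φ sφ u = sym (trans (run≈∑ (reverseView (rows 0 N)) φ sφ u [])
    (∑-cong (subs (rows 0 N)) λ z → *-congˡ (reflexive (cong φ (++-identityʳ (map proj₁ z))))))

  onSchubert-dd : ∀ {i N} → i < N → ∀ φ → Symmetric φ → ∀ u →
    onSchubert N (dd i φ) u ≈ d i u * onSchubert N φ (u · s i)
  onSchubert-dd {i} {N} i<N φ sφ u = begin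
    onSchubert N (dd i φ) u
      ≈⟨ onSchubert≈run N (dd i φ) (dd-symmetric i sφ) u ⟩
    app (run (rows 0 N) (initial (dd i φ) (dd-symmetric i sφ))) u []
      ≈⟨ at (run-cong (rows 0 N) (pointwise λ u m → sym (dd-*ˡ i ⟦ red? u [] ⟧ φ m))) u [] ⟩
    app (run (rows 0 N) (Δ i (initial φ sφ))) u []
      ≈⟨ run-Δ i<N (initial φ sφ) u ⟩
    d i u * app (run (rows 0 N) (initial φ sφ)) (u · s i) []
      ≈⟨ *-congˡ (onSchubert≈run N φ sφ (u · s i)) ⟨
    d i u * onSchubert N φ (u · s i) ∎
    where open ≈-Reasoning

σ-≤ : ∀ i j → σ i j ≤ suc j
σ-≤ i j with adjacent i j
... | first     = ℕ.≤-reflexive (σ-l i)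
... | second    = ℕ.≤-trans (ℕ.≤-reflexive (σ-r i)) (ℕ.m≤n+m i 2)
... | other p q = ℕ.≤-trans (ℕ.≤-reflexive (swap-≢ i (suc i) p q)) (ℕ.n≤1+n j)

-- Chain counts evaluated on Schubert polynomials.

module Duality {c r} (R : CommutativeRing c r) where

  open Schubert R public
  open ≈-Reasoning

  module _ (N : ℕ) where
    open CoverSums R N using (E; E-ε; E-cong; E-symmetric; E-descent; dd-E)

    onSchubert-cong : ∀ M {φ ψ} → φ ≐ ψ → ∀ u → onSchubert M φ u ≈ onSchubert M ψ u
    onSchubert-cong M φ≐ψ u = ∑-cong (subs (rows 0 M)) λ z → *-congˡ (φ≐ψ (map proj₁ z))

    onSchubert-ct : ∀ M u w → w ≈ₛ ε → onSchubert M ct u ≈ ⟦ u ≈? w ⟧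
    onSchubert-ct M u w w≈ε = begin
      onSchubert M ct u
        ≈⟨ ∑-subs-[] (rows 0 M) _ (λ t z → trans (*-congˡ (ct-∷ (proj₁ t) (map proj₁ z))) (zeroʳ _)) ⟩
      ⟦ red? u [] ⟧ * 1#
        ≈⟨ *-identityʳ _ ⟩
      ⟦ red? u [] ⟧
        ≈⟨ ⟦⟧-⇔ (red? u []) (u ≈? w)
             (λ (red ε≈u _) → ≈ₛ-trans u ε w (≈ₛ-sym ε u ε≈u) (≈ₛ-sym w ε w≈ε))
             (λ u≈w → let u≈ε = ≈ₛ-trans u w ε u≈w w≈ε in
                      red (≈ₛ-sym u ε u≈ε) (≡.sym (#inv-cong u ε u≈ε))) ⟩
      ⟦ u ≈? w ⟧ ∎

    onSchubert-E : ∀ M → N ≤ M → ∀ w → Fixes≥ N w → ∀ u → onSchubert M (E w) u ≈ ⟦ u ≈? w ⟧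
    onSchubert-E M N≤M w = go (#inv w) w ≡.refl
      where
      go : ∀ n w → #inv w ≡ n → Fixes≥ N w → ∀ u → onSchubert M (E w) u ≈ ⟦ u ≈? w ⟧
      descend : ∀ n w → #inv w ≡ n → Fixes≥ N w → (∃ λ i → Desc i w) ⊎ w ≈ₛ ε →
                ∀ u → onSchubert M (E w) u ≈ ⟦ u ≈? w ⟧
      go n w eq fix = descend n w eq fix (descent⊎ε w)
      descend n w eq fix (inj₂ w≈ε) u =
        trans (onSchubert-cong M (E-ε w w≈ε) u) (onSchubert-ct M u w w≈ε)
      descend zero w eq fix (inj₁ (i , desc)) u =
        contradiction (≡.trans (#inv-descent w {i} desc) eq) λ ()
      descend (suc n) w eq fix (inj₁ (i , desc)) u = begin
        onSchubert M (E w) u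
          ≈⟨ onSchubert-cong M (E-descent 1+i<N w desc) u ⟩
        onSchubert M (dd i (E (w · s i))) u
          ≈⟨ onSchubert-dd (ℕ.<-≤-trans (ℕ.<-trans (ℕ.n<1+n i) 1+i<N) N≤M)
               (E (w · s i)) (E-symmetric (w · s i) fix′) u ⟩
        d i u * onSchubert M (E (w · s i)) (u · s i)
          ≈⟨ *-congˡ (go n (w · s i) (ℕ.suc-injective (≡.trans (#inv-descent w {i} desc) eq)) fix′ (u · s i)) ⟩
        d i u * ⟦ (u · s i) ≈? (w · s i) ⟧
          ≈⟨ ⟦⟧-× (desc? i u) ((u · s i) ≈? (w · s i)) ⟨
        ⟦ desc? i u ×-dec (u · s i) ≈? (w · s i) ⟧
          -- If `u` equals `w` it inherits the descent of `w`, so the descent condition is absorbed.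
          ≈⟨ ⟦⟧-⇔ (desc? i u ×-dec (u · s i) ≈? (w · s i)) (u ≈? w)
               (λ (_ , us≈ws) n → ≡.trans (≡.sym (·s·s u i n)) (≡.trans (us≈ws (σ i n)) (·s·s w i n)))
               (λ u≈w → Desc-cong i w u (≈ₛ-sym u w u≈w) desc , ·-congʳ u w (s i) u≈w) ⟩
        ⟦ u ≈? w ⟧ ∎
        where
        1+i<N = descent-bound w fix desc
        fix′  = fixes-·s w i fix 1+i<N

  -- Moving a variable past its neighbours.

  private
    choose : ∀ {p} {P : Set p} → Dec P → Carrier → Carrier → Carrier
    choose (yes _) x y = x
    choose (no _)  x y = y

    choose-yes : ∀ {p} {P : Set p} (P? : Dec P) {x y} → P → choose P? x y ≈ x
    choose-yes (yes _) _ = refl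
    choose-yes (no ¬p) p = contradiction p ¬p

    choose-no : ∀ {p} {P : Set p} (P? : Dec P) {x y} → ¬ P → choose P? x y ≈ y
    choose-no (yes p) ¬p = contradiction p ¬p
    choose-no (no _)  _  = refl

    choose-cong : ∀ {p} {P : Set p} (P? : Dec P) {x x′ y y′} → x ≈ x′ → y ≈ y′ →
                  choose P? x y ≈ choose P? x′ y′
    choose-cong (yes _) p q = p
    choose-cong (no _)  p q = q

  -- The transpose of the substitution x_l ↦ x_l (l < k), x_j ↦ x_k, x_l ↦ 0 (other l).

  keep : ℕ → ℕ → Functional → Functional
  keep k j φ []      = φ []
  keep k j φ (l ∷ m) = choose (l <? k) (keep k j (φ ∘ (l ∷_)) m)
                         (choose (l ≟ j) (keep k j (φ ∘ (k ∷_)) m) 0#)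

  module _ {k j l : ℕ} (φ : Functional) (m : List ℕ) where

    keep-< : l < k → keep k j φ (l ∷ m) ≈ keep k j (φ ∘ (l ∷_)) m
    keep-< l<k = choose-yes (l <? k) l<k

    keep-≡ : k ≤ l → l ≡ j → keep k j φ (l ∷ m) ≈ keep k j (φ ∘ (k ∷_)) m
    keep-≡ k≤l l≡j = trans (choose-no (l <? k) (ℕ.≤⇒≯ k≤l)) (choose-yes (l ≟ j) l≡j)

    keep-0 : k ≤ l → l ≢ j → keep k j φ (l ∷ m) ≈ 0#
    keep-0 k≤l l≢j = trans (choose-no (l <? k) (ℕ.≤⇒≯ k≤l)) (choose-no (l ≟ j) l≢j)

  keep-cong : ∀ k j {φ ψ} → φ ≐ ψ → keep k j φ ≐ keep k j ψ
  keep-cong k j φ≐ψ []      = φ≐ψ []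
  keep-cong k j φ≐ψ (l ∷ m) = choose-cong (l <? k) (keep-cong k j (λ n → φ≐ψ (l ∷ n)) m)
    (choose-cong (l ≟ j) (keep-cong k j (λ n → φ≐ψ (k ∷ n)) m) refl)

  -- f(…, x_k at position j, 0, …) = f(…, x_k at position j + 1, …) + x_k (∂ⱼ f)(…), because
  -- f − sⱼ f = (xⱼ − xⱼ₊₁) ∂ⱼ f and ∂ⱼ f is symmetric in xⱼ and xⱼ₊₁.
  newton-step : ∀ k j → k ≤ j → ∀ φ → Symmetric φ → ∀ m →
    keep k j φ m ≈ keep k (suc j) φ m + dd j (keep k (suc j) (φ ∘ (k ∷_))) m
  newton-step k j k≤j φ sφ [] = sym (+-identityʳ _)
  newton-step k j k≤j φ sφ (l ∷ m) = go (l <? k) (adjacent j l)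
    where
    k≤1+j = ℕ.m≤n⇒m≤1+n k≤j
    ψ = keep k (suc j) (φ ∘ (k ∷_))
    go : ∀ {l} → Dec (l < k) → Adjacent j l →
         keep k j φ (l ∷ m) ≈ keep k (suc j) φ (l ∷ m) + dd j ψ (l ∷ m)
    go {l} (yes l<k) _ = begin
      keep k j φ (l ∷ m)
        ≈⟨ keep-< φ m l<k ⟩
      keep k j (φ ∘ (l ∷_)) m
        ≈⟨ newton-step k j k≤j (φ ∘ (l ∷_)) (Symmetric-∷ l sφ) m ⟩
      keep k (suc j) (φ ∘ (l ∷_)) m + dd j (keep k (suc j) (φ ∘ (l ∷_) ∘ (k ∷_))) m
        ≈⟨ +-congˡ (dd-cong j (λ n → trans (keep-cong k (suc j) (λ _ → sφ (↭swap l k ↭refl)) n)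
             (sym (keep-< (φ ∘ (k ∷_)) n l<k))) m) ⟩
      keep k (suc j) (φ ∘ (l ∷_)) m + dd j (ψ ∘ (l ∷_)) m
        ≈⟨ +-cong (keep-< φ m l<k) (dd-other j ψ m
             (ℕ.<⇒≢ (ℕ.<-≤-trans l<k k≤j)) (ℕ.<⇒≢ (ℕ.<-≤-trans l<k k≤1+j))) ⟨
      keep k (suc j) φ (l ∷ m) + dd j ψ (l ∷ m) ∎
    -- With position `j + 1` active `xⱼ` is killed, so the whole value comes from the derivative,
    -- through ∂ⱼ xⱼ = 1.
    go (no _) first = begin
      keep k j φ (j ∷ m)
        ≈⟨ keep-≡ φ m k≤j ≡.refl ⟩
      keep k j (φ ∘ (k ∷_)) m
        ≈⟨ newton-step k j k≤j (φ ∘ (k ∷_)) (Symmetric-∷ k sφ) m ⟩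
      ψ m + dd j (keep k (suc j) (φ ∘ (k ∷_) ∘ (k ∷_))) m
        ≈⟨ +-congˡ (dd-cong j (λ n → sym (keep-≡ (φ ∘ (k ∷_)) n k≤1+j ≡.refl)) m) ⟩
      ψ m + dd j (ψ ∘ (suc j ∷_)) m
        ≈⟨ dd-first j ψ m ⟨
      dd j ψ (j ∷ m)
        ≈⟨ +-identityˡ _ ⟨
      0# + dd j ψ (j ∷ m)
        ≈⟨ +-congʳ (keep-0 φ m k≤j (ℕ.1+n≢n ∘ ≡.sym)) ⟨
      keep k (suc j) φ (j ∷ m) + dd j ψ (j ∷ m) ∎
    -- With position `j` active `xⱼ₊₁` is killed; on the right its value is cancelled by ∂ⱼ xⱼ₊₁ =
    -- -1.
    go (no _) second = begin
      keep k j φ (suc j ∷ m)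
        ≈⟨ keep-0 φ m k≤1+j ℕ.1+n≢n ⟩
      0#
        ≈⟨ -‿inverseʳ (ψ m) ⟨
      ψ m - ψ m
        ≈⟨ +-congˡ (+-identityʳ _) ⟨
      ψ m + (- ψ m + 0#)
        ≈⟨ +-congˡ (+-congˡ (dd-0 j (λ n → keep-0 (φ ∘ (k ∷_)) n k≤j (ℕ.1+n≢n ∘ ≡.sym)) m)) ⟨
      ψ m + (- ψ m + dd j (ψ ∘ (j ∷_)) m)
        ≈⟨ +-cong (keep-≡ φ m k≤1+j ≡.refl) (dd-second j ψ m) ⟨
      keep k (suc j) φ (suc j ∷ m) + dd j ψ (suc j ∷ m) ∎
    go {l} (no l≮k) (other p q) = begin
      keep k j φ (l ∷ m)
        ≈⟨ keep-0 φ m k≤l p ⟩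
      0#
        ≈⟨ 0+0≈0 ⟨
      0# + 0#
        ≈⟨ +-cong (keep-0 φ m k≤l q)
             (trans (dd-other j ψ m p q) (dd-0 j (λ n → keep-0 (φ ∘ (k ∷_)) n k≤l q) m)) ⟨
      keep k (suc j) φ (l ∷ m) + dd j ψ (l ∷ m) ∎
      where k≤l = ℕ.≮⇒≥ l≮k

-- Newton interpolation and separation by Schubert polynomials.

reduced? : ∀ a → Dec (#inv (wordProduct a) ≡ length a)
reduced? a = #inv (wordProduct a) ≟ length a

#inv-∷ʳ : ∀ a j → #inv (wordProduct (a ∷ʳ j)) ≡ #inv (wordProduct a · s j)
#inv-∷ʳ a j = #inv-cong (wordProduct (a ∷ʳ j)) (wordProduct a · s j) (wordProduct-∷ʳ a j)

reduced-∷ʳ⁺ : ∀ a j → #inv (wordProduct a) ≡ length a × Asc j (wordProduct a) →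
              #inv (wordProduct (a ∷ʳ j)) ≡ length (a ∷ʳ j)
reduced-∷ʳ⁺ a j (eq , asc) = ≡.trans (#inv-∷ʳ a j) (≡.trans (#inv-ascent (wordProduct a) {j} asc)
  (≡.trans (cong suc eq) (≡.sym (length-∷ʳ a j))))

reduced-∷ʳ⁻ : ∀ a j → #inv (wordProduct (a ∷ʳ j)) ≡ length (a ∷ʳ j) →
              #inv (wordProduct a) ≡ length a × Asc j (wordProduct a)
reduced-∷ʳ⁻ a j eq =
  ℕ.suc-injective (≡.trans (≡.sym (#inv-ascent v {j} asc)) eq′) , asc
  where
  v = wordProduct a
  eq′ : #inv (v · s j) ≡ suc (length a)
  eq′ = ≡.trans (≡.sym (#inv-∷ʳ a j)) (≡.trans eq (length-∷ʳ a j))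
  asc : Asc j v
  asc = ¬Desc⇒Asc j v λ desc → ℕ.<-irrefl ≡.refl (begin-strict
    length a                <⟨ ℕ.n<1+n _ ⟩
    suc (length a)          ≡⟨ eq′ ⟨
    #inv (v · s j)          <⟨ ℕ.n<1+n _ ⟩
    suc (#inv (v · s j))    ≡⟨ #inv-descent v {j} desc ⟩
    #inv v                  ≤⟨ #inv≤length v a (λ _ → ≡.refl) ⟩
    length a                ∎)
    where open ℕ.≤-Reasoning

-- A letter `j` below `M` moves `j + 1`, which may equal `M`; hence the bound `suc M`.
wordProduct-fixes : ∀ {M a} → All (_< M) a → Fixes≥ (suc M) (wordProduct a)
wordProduct-fixes []          n M<n = ≡.refl
wordProduct-fixes {a = j ∷ a} (j<M ∷ a<M) n M<n = ≡.trans
  (cong (σ j) (wordProduct-fixes a<M n M<n))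
  (swap-≢ j (suc j) (ℕ.>⇒≢ (ℕ.<-trans j<M M<n)) (ℕ.>⇒≢ (ℕ.≤-<-trans j<M M<n)))

module Newton {c r} (R : CommutativeRing c r) where

  open Duality R public
  open ≈-Reasoning

  -- `word ct a` sends f to the constant term of ∂ₐ₁ ⋯ ∂ₐₚ f: the last letter is outermost as a
  -- transpose and therefore acts first on f.
  word : Functional → Word → Functional
  word = foldl λ φ j → dd j φ

  word-∷ʳ : ∀ φ a j → word φ (a ∷ʳ j) ≡ dd j (word φ a)
  word-∷ʳ φ a j = foldl-++ _ φ a [ j ]

  -- Newton interpolation at 0: the sum of x_i (∂ₐ f)(0) over the products (i , a) of factors
  -- from L.

  newton : List (ℕ × ℕ) → Functional → Functional
  newton L φ m = ∑ (subs L) λ z → φ (map proj₁ z) * word ct (map proj₂ z) m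

  newton-∷ʳ : ∀ L k j φ → Symmetric φ → ∀ m →
    newton (L ∷ʳ (k , j)) φ m ≈ newton L φ m + dd j (newton L (φ ∘ (k ∷_))) m
  newton-∷ʳ L k j φ sφ m = trans (∑-subs-∷ʳ L (k , j) _) (+-congˡ (sym (trans
    (dd-∑ j (subs L) (λ z n → φ (k ∷ map proj₁ z) * word ct (map proj₂ z) n) m)
    (∑-cong (subs L) λ z → trans (dd-*ˡ j _ _ m) (*-cong
      (trans (sφ (∷↭∷ʳ k (map proj₁ z))) (reflexive (cong φ (≡.sym (map-++ proj₁ z [ k , j ])))))
      (reflexive (≡.trans (cong (λ ψ → ψ m) (≡.sym (word-∷ʳ ct (map proj₂ z) j)))
                          (cong (λ a → word ct a m) (≡.sym (map-++ proj₂ z [ k , j ])))))))))) 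

  module _ (M : ℕ) where

    -- Allowed monomials have all variables below M, and this survives any number of divided
    -- differences: each of them raises the variables by at most 1 but lowers the degree.

    Below : ℕ → List ℕ → Set
    Below b = All (λ l → l ℕ.+ b ≤ M)

    Allowed : List ℕ → Set
    Allowed m = Below (length m) m

    infix 4 _≐ᴬ_
    _≐ᴬ_ : Functional → Functional → Set r
    φ ≐ᴬ ψ = ∀ m → Allowed m → φ m ≈ ψ m

    private
      below-pred : ∀ {b m} → Below (suc b) m → Below b m
      below-pred = All.map λ {l} → ℕ.≤-trans (ℕ.+-monoʳ-≤ l (ℕ.n≤1+n _))

      dd-local : ∀ i n b φ ψ → (∀ m → length m ≡ n → Below b m → φ m ≈ ψ m) →
                 ∀ m → length m ≡ suc n → Below (suc b) m → dd i φ m ≈ dd i ψ m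
      dd-local i n b φ ψ φ≈ψ (j ∷ m) len (j≤ ∷ m≤) = +-cong
        (*-congˡ (φ≈ψ m (ℕ.suc-injective len) (below-pred m≤))) (inner n m (ℕ.suc-injective len) m≤ φ≈ψ)
        where
        σj≤ : σ i j ℕ.+ b ≤ M
        σj≤ = ℕ.≤-trans (ℕ.+-monoˡ-≤ b (σ-≤ i j)) (subst (_≤ M) (ℕ.+-suc j b) j≤)
        inner : ∀ n m → length m ≡ n → Below (suc b) m →
                (∀ m → length m ≡ n → Below b m → φ m ≈ ψ m) →
                dd i (φ ∘ (σ i j ∷_)) m ≈ dd i (ψ ∘ (σ i j ∷_)) m
        inner zero    []      _   _  _   = refl
        inner (suc n) (l ∷ m) len m≤ φ≈ψ = dd-local i n b _ _
          (λ m′ len′ m′≤ → φ≈ψ (σ i j ∷ m′) (cong suc len′) (σj≤ ∷ m′≤)) (l ∷ m) len m≤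

    dd-congᴬ : ∀ i {φ ψ} → φ ≐ᴬ ψ → dd i φ ≐ᴬ dd i ψ
    dd-congᴬ i φ≐ψ []      _  = refl
    dd-congᴬ i {φ} {ψ} φ≐ψ (j ∷ m) m≤ = dd-local i (length m) (length m) φ ψ
      (λ n len n≤ → φ≐ψ n (subst (λ b → Below b n) (≡.sym len) n≤)) (j ∷ m) ≡.refl m≤

    allowed⇒< : ∀ m → Allowed m → All (_< M) m
    allowed⇒< []      _  = []
    allowed⇒< (l ∷ m) m≤ = All.map (λ {x} → ℕ.<-≤-trans (ℕ.m<m+n x ℕ.z<s)) m≤

    keep-last : ∀ φ m → All (_< M) m → keep M M φ m ≈ φ m
    keep-last φ []      _           = refl
    keep-last φ (l ∷ m) (l<M ∷ m<M) = trans (keep-< φ m l<M) (keep-last (φ ∘ (l ∷_)) m m<M)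

    keep-suc : ∀ k φ m → All (_< M) m → keep k k φ m ≈ keep (suc k) M φ m
    keep-suc k φ []      _           = refl
    keep-suc k φ (l ∷ m) (l<M ∷ m<M) with ℕ.<-cmp l k
    ... | tri< l<k _ _ = trans (keep-< φ m l<k) (trans (keep-suc k (φ ∘ (l ∷_)) m m<M)
                               (sym (keep-< φ m (ℕ.m<n⇒m<1+n l<k))))
    ... | tri≈ _ ≡.refl _ = trans (keep-≡ φ m ℕ.≤-refl ≡.refl) (trans (keep-suc k (φ ∘ (l ∷_)) m m<M)
                               (sym (keep-< φ m ℕ.≤-refl)))
    ... | tri> _ _ k<l = trans (keep-0 φ m (ℕ.<⇒≤ k<l) (ℕ.>⇒≢ k<l))
                               (sym (keep-0 φ m k<l (ℕ.<⇒≢ l<M)))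

    keep-ct : ∀ φ m → All (_< M) m → φ [] * ct m ≈ keep 0 M φ m
    keep-ct φ []      _         = *-identityʳ _
    keep-ct φ (l ∷ m) (l<M ∷ _) = trans (trans (*-congˡ (ct-∷ l m)) (zeroʳ _))
                                        (sym (keep-0 φ m ℕ.z≤n (ℕ.<⇒≢ l<M)))

    -- The invariant of the construction: the factors in `L` reproduce f with the variables before
    -- `k` in place, `xₖ` substituted at position `j`, and all others set to 0.
    Interpolates : List (ℕ × ℕ) → ℕ → ℕ → Set _
    Interpolates L k j = ∀ φ → Symmetric φ → newton L φ ≐ᴬ keep k j φ

    -- A row lists its letters downwards from `M - 1` to `j`, and each appended factor is one
    -- `newton-step`. The derivative is compared by `dd-congᴬ`, as the inductive hypothesis speaks
    -- only of allowed monomials.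
    interpolates-row : ∀ L k j n → n ℕ.+ j ≡ M → k ≤ j → Interpolates L k M →
                       Interpolates (L ++ row k j n) k j
    interpolates-row L k j zero    ≡.refl k≤j int φ sφ m m≤ = trans
      (reflexive (cong (λ L → newton L φ m) (++-identityʳ L))) (int φ sφ m m≤)
    interpolates-row L k j (suc n) n+j≡M k≤j int φ sφ m m≤ = begin
      newton (L ++ row k (suc j) n ∷ʳ (k , j)) φ m
        ≡⟨ cong (λ L → newton L φ m) (++-assoc L (row k (suc j) n) [ k , j ]) ⟨
      newton (L′ ∷ʳ (k , j)) φ m
        ≈⟨ newton-∷ʳ L′ k j φ sφ m ⟩
      newton L′ φ m + dd j (newton L′ (φ ∘ (k ∷_))) m
        ≈⟨ +-cong (IH φ sφ m m≤) (dd-congᴬ j (IH (φ ∘ (k ∷_)) (Symmetric-∷ k sφ)) m m≤) ⟩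
      keep k (suc j) φ m + dd j (keep k (suc j) (φ ∘ (k ∷_))) m
        ≈⟨ newton-step k j k≤j φ sφ m ⟨
      keep k j φ m ∎
      where
      L′ = L ++ row k (suc j) n
      IH = interpolates-row L k (suc j) n (≡.trans (ℕ.+-suc n j) n+j≡M) (ℕ.m≤n⇒m≤1+n k≤j) int

    interpolates-rows : ∀ L k n → n ℕ.+ k ≡ M → Interpolates L k M →
                        Interpolates (L ++ rows k n) M M
    interpolates-rows L k zero    ≡.refl int φ sφ m m≤ = trans
      (reflexive (cong (λ L → newton L φ m) (++-identityʳ L))) (int φ sφ m m≤)
    interpolates-rows L k (suc n) n+k≡M int φ sφ m m≤ = trans
      (reflexive (cong (λ L → newton L φ m) (≡.sym (++-assoc L (row k k (suc n)) (rows (suc k) n)))))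
      (interpolates-rows (L ++ row k k (suc n)) (suc k) n (≡.trans (ℕ.+-suc n k) n+k≡M)
        (λ φ sφ m m≤ → trans (interpolates-row L k k (suc n) n+k≡M ℕ.≤-refl int φ sφ m m≤)
                             (keep-suc k φ m (allowed⇒< m m≤)))
        φ sφ m m≤)

    newton-formula : ∀ φ → Symmetric φ → ∀ m → Allowed m → φ m ≈ newton (rows 0 M) φ m
    newton-formula φ sφ m m≤ = sym (trans
      (interpolates-rows [] 0 M (ℕ.+-identityʳ M)
        (λ φ sφ m m≤ → trans (+-identityʳ _) (keep-ct φ m (allowed⇒< m m≤))) φ sφ m m≤)
      (keep-last φ m (allowed⇒< m m≤)))

    open CoverSums R (suc M) using (E; E-cong; E-ε; dd-E)

    -- As long as every letter is an ascent, `dd-E` climbs from `ε` to the product of the word; at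
    -- the first descent it gives 0, and the word is not reduced.
    word-E : ∀ {a} → Reverse a → All (_< M) a → ∀ m →
             word ct a m ≈ ⟦ reduced? a ⟧ * E (wordProduct a) m
    word-E [] _ m = sym (trans (*-cong (⟦⟧-yes (reduced? []) ≡.refl) (E-ε ε (λ _ → ≡.refl) m)) (*-identityˡ _))
    word-E (a ∶ ra ∶ʳ j) a∷ʳj< m = begin
      word ct (a ∷ʳ j) m
        ≡⟨ cong (λ ψ → ψ m) (word-∷ʳ ct a j) ⟩
      dd j (word ct a) m
        ≈⟨ dd-cong j (word-E ra (proj₁ (All.∷ʳ⁻ a∷ʳj<))) m ⟩
      dd j (λ n → ⟦ reduced? a ⟧ * E v n) m
        ≈⟨ dd-*ˡ j _ (E v) m ⟩
      ⟦ reduced? a ⟧ * dd j (E v) m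
        ≈⟨ *-congˡ (dd-E (ℕ.s≤s (proj₂ (All.∷ʳ⁻ a∷ʳj<))) m v) ⟩
      ⟦ reduced? a ⟧ * (⟦ asc? j v ⟧ * E (v · s j) m)
        ≈⟨ *-assoc _ _ _ ⟨
      ⟦ reduced? a ⟧ * ⟦ asc? j v ⟧ * E (v · s j) m
        ≈⟨ *-cong (⟦⟧-× (reduced? a) (asc? j v))
                  (E-cong (wordProduct (a ∷ʳ j)) (v · s j) (wordProduct-∷ʳ a j) m) ⟨
      ⟦ reduced? a ×-dec asc? j v ⟧ * E (wordProduct (a ∷ʳ j)) m
        ≈⟨ *-congʳ (⟦⟧-⇔ (reduced? a ×-dec asc? j v) (reduced? (a ∷ʳ j)) (reduced-∷ʳ⁺ a j) (reduced-∷ʳ⁻ a j)) ⟩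
      ⟦ reduced? (a ∷ʳ j) ⟧ * E (wordProduct (a ∷ʳ j)) m ∎
      where v = wordProduct a

  -- F is cleared one key at a time, so the classes modulo ≈ₛ need not be enumerated.
  module _ {A : Set} (zs : List A) (key : A → S∞) (G : A → Carrier)
           (fibres : ∀ y → y ∈ zs → (∑ zs λ z → ⟦ key z ≈? key y ⟧ * G z) ≈ 0#) where

    private
      clear : ∀ ks → All (λ k → (∑ zs λ z → ⟦ key z ≈? k ⟧ * G z) ≈ 0#) ks →
              (F : S∞ → Carrier) → (∀ u v → u ≈ₛ v → F u ≈ F v) →
              (∀ z → z ∈ zs → Any (λ k → key z ≈ₛ k) ks ⊎ F (key z) ≈ 0#) → (∑ zs λ z → G z * F (key z)) ≈ 0#
      clear [] [] F F-cong covered = trans (∑-cong∈ zs λ z z∈ → vanish (covered z z∈)) (∑-0 zs λ _ → refl)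
        where
        vanish : ∀ {z} → Any (λ k → key z ≈ₛ k) [] ⊎ F (key z) ≈ 0# → G z * F (key z) ≈ 0#
        vanish (inj₂ F≈0) = trans (*-congˡ F≈0) (zeroʳ _)
      clear (k ∷ ks) (fibre ∷ fibres) F F-cong covered = begin
        ∑ zs (λ z → G z * F (key z))
          ≈⟨ ∑-cong zs (λ z → split (G z) (F (key z)) ⟦ key z ≈? k ⟧ (F k)) ⟩
        ∑ zs (λ z → G z * F′ (key z) + F k * (⟦ key z ≈? k ⟧ * G z))
          ≈⟨ ∑-+ zs _ _ ⟩
        ∑ zs (λ z → G z * F′ (key z)) + ∑ zs (λ z → F k * (⟦ key z ≈? k ⟧ * G z))
          ≈⟨ +-cong (clear ks fibres F′ F′-cong covered′)
               (trans (∑-*ˡ (F k) zs _) (trans (*-congˡ fibre) (zeroʳ _))) ⟩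
        0# + 0#
          ≈⟨ 0+0≈0 ⟩
        0# ∎
        where
        F′ : S∞ → Carrier
        -- `F′` vanishes on the class of `k`, and the correction contributes `F k` times the fibre
        -- sum over that class, which is 0.
        F′ v = F v - ⟦ v ≈? k ⟧ * F k
        F′-cong : ∀ u v → u ≈ₛ v → F′ u ≈ F′ v
        F′-cong u v u≈v = +-cong (F-cong u v u≈v) (-‿cong (*-congʳ (⟦⟧-⇔ (u ≈? k) (v ≈? k)
          (≈ₛ-trans v u k (≈ₛ-sym u v u≈v)) (≈ₛ-trans u v k u≈v))))
        split : ∀ g f e h → g * f ≈ g * (f - e * h) + h * (e * g)
        split g f e h = sym (begin
          g * (f - e * h) + h * (e * g)
            ≈⟨ +-cong (distribˡ g f _) (solve 3 (λ g e h → h :* (e :* g) := g :* (e :* h)) refl g e h) ⟩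
          (g * f + g * - (e * h)) + g * (e * h)
            ≈⟨ +-assoc _ _ _ ⟩
          g * f + (g * - (e * h) + g * (e * h))
            ≈⟨ +-congˡ (trans (sym (distribˡ g _ _)) (trans (*-congˡ (-‿inverseˡ _)) (zeroʳ g))) ⟩
          g * f + 0#
            ≈⟨ +-identityʳ _ ⟩
          g * f ∎)
          where open Solver using (solve; _:=_; _:*_)
        covered′ : ∀ z → z ∈ zs → Any (λ k → key z ≈ₛ k) ks ⊎ F′ (key z) ≈ 0#
        covered′ z z∈ with key z ≈? k | covered z z∈
        ... | yes z≈k | _ = inj₂ (trans (+-cong (F-cong (key z) k z≈k) (-‿cong (*-identityˡ _))) (-‿inverseʳ _))
        ... | no z≉k  | inj₁ (here z≈k)  = contradiction z≈k z≉k
        ... | no z≉k  | inj₁ (there k∈) = inj₁ k∈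
        ... | no z≉k  | inj₂ F≈0 = inj₂ (trans (+-cong F≈0 (-‿cong (zeroˡ _))) 0-0≈0)

    ∑-class-function : (F : S∞ → Carrier) → (∀ u v → u ≈ₛ v → F u ≈ F v) →
                       (∑ zs λ z → G z * F (key z)) ≈ 0#
    ∑-class-function F F-cong = clear (map key zs) (All.map⁺ (All.tabulate (λ {y} → fibres y))) F F-cong λ z z∈ →
      inj₁ (Any.map⁺ (Any.map (λ { ≡.refl _ → ≡.refl }) z∈))

  allowed-bound : ∀ b m → ∃ λ M → All (λ l → l ℕ.+ b ≤ M) m
  allowed-bound b []      = 0 , []
  allowed-bound b (l ∷ m) with allowed-bound b m
  ... | M , m≤ = l ℕ.+ b ℕ.⊔ M , ℕ.m≤m⊔n _ M ∷ All.map (λ p → ℕ.≤-trans p (ℕ.m≤n⊔m (l ℕ.+ b) M)) m≤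

  -- The Schubert polynomials span.
  separation : ∀ φ → Symmetric φ → (∀ M u → Fixes≥ (suc M) u → onSchubert M φ u ≈ 0#) → ∀ m → φ m ≈ 0#
  separation φ sφ φ𝔖≈0 m with allowed-bound (length m) m
  ... | M , m≤ = begin
    φ m
      ≈⟨ newton-formula M φ sφ m m≤ ⟩
    newton (rows 0 M) φ m
      ≈⟨ ∑-cong∈ zs (λ z z∈ → trans
           (*-congˡ (word-E M (reverseView (map proj₂ z)) (letters z z∈) m)) (sym (*-assoc _ _ _))) ⟩
    ∑ zs (λ z → G z * E (wordProduct (map proj₂ z)) m)
      ≈⟨ ∑-class-function zs (wordProduct ∘ map proj₂) G fibres
           (λ u → E u m) (λ u v u≈v → E-cong u v u≈v m) ⟩
    0# ∎
    where
    open CoverSums R (suc M) using (E; E-cong)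
    zs = subs (rows 0 M)
    G : List (ℕ × ℕ) → Carrier
    G z = φ (map proj₁ z) * ⟦ reduced? (map proj₂ z) ⟧
    letters : ∀ z → z ∈ zs → All (_< M) (map proj₂ z)
    letters z z∈ = All.map⁺ (All.map
      (λ {t} t∈ → subst (proj₂ t <_) (ℕ.+-identityʳ M) (proj₂ (proj₂ (All.lookup (rows⇒ 0 M) t∈))))
      (subs⇒∈ (rows 0 M) z∈))
    -- The reduced sublists with product `u` are the terms of 𝔖ᵤ, so the fibre sum is φ(𝔖ᵤ).
    fibres : ∀ y → y ∈ zs → (∑ zs λ z → ⟦ wordProduct (map proj₂ z) ≈? wordProduct (map proj₂ y) ⟧ * G z) ≈ 0#
    fibres y y∈ = trans (∑-cong zs λ z → let a = map proj₂ z in trans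
      (trans (*-congˡ (*-comm _ _)) (trans (sym (*-assoc _ _ _))
        (*-congʳ (sym (⟦⟧-× (wordProduct a ≈? u) (reduced? a))))))
      (*-congʳ (⟦⟧-⇔ ((wordProduct a ≈? u) ×-dec reduced? a) (red? u a)
        (λ (p , l) → red p (≡.trans (≡.sym l) (#inv-cong (wordProduct a) u p)))
        (λ (red p l) → p , ≡.trans (#inv-cong (wordProduct a) u p) (≡.sym l)))))
      (φ𝔖≈0 M u (wordProduct-fixes (letters y y∈)))
      where u = wordProduct (map proj₂ y)

-- Compatible pairs as sublists of the factors.

Reduced⇒Red : ∀ u a → Reduced u a → Red u a
Reduced⇒Red u a (p , l) = red p (≡.trans l (ℓ≡#inv u))

Red⇒Reduced : ∀ u a → Red u a → Reduced u a
Red⇒Reduced u a (red p l) = p , ≡.trans l (≡.sym (ℓ≡#inv u))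

Red-letters : ∀ {a} → Reverse a → ∀ M u → Fixes≥ (suc M) u → Red u a → All (_< M) a
Red-letters []            M u fix _ = []
Red-letters (a ∶ ra ∶ʳ j) M u fix r =
  All.∷ʳ⁺ (Red-letters ra M (u · s j) (fixes-·s {suc M} u j fix j<M) (proj₂ shorter)) (ℕ.≤-pred j<M)
  where
  shorter = Red-∷ʳ⁻ u a j r
  j<M : suc j < suc M
  j<M = descent-bound {suc M} u fix {j} (proj₁ shorter)

unzip′ : List (ℕ × ℕ) → Word × List ℕ
unzip′ z = map proj₂ z , map proj₁ z

zip-unzip′ : ∀ (z : List (ℕ × ℕ)) → zip (map proj₁ z) (map proj₂ z) ≡ z
zip-unzip′ []      = ≡.refl
zip-unzip′ (t ∷ z) = cong (t ∷_) (zip-unzip′ z)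

unzip′-zip : ∀ {i a} → Pointwise _≤_ i a → unzip′ (zip i a) ≡ (a , i)
unzip′-zip []       = ≡.refl
unzip′-zip {i ∷ _} {a ∷ _} (p ∷ ps) = cong (λ (as , is) → a ∷ as , i ∷ is) (unzip′-zip ps)

unzip′-injective : ∀ {z z′} → unzip′ z ≡ unzip′ z′ → z ≡ z′
unzip′-injective {z} {z′} eq = ≡.trans (≡.sym (zip-unzip′ z))
  (≡.trans (cong₂ zip (cong proj₂ eq) (cong proj₁ eq)) (zip-unzip′ z′))

zip-rows : ∀ M {i a} → Pointwise _≤_ i a → All (_< M) a → All (_∈ rows 0 M) (zip i a)
zip-rows M []       []                   = []
zip-rows M (p ∷ ps) (_∷_ {x = j} j<M as) =
  rows⇐ 0 M (ℕ.z≤n , p , subst (j <_) (≡.sym (ℕ.+-identityʳ M)) j<M) ∷ zip-rows M ps as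

rows-pointwise : ∀ M z → All (_∈ rows 0 M) z → Pointwise _≤_ (map proj₁ z) (map proj₂ z)
rows-pointwise M []      []        = []
rows-pointwise M (t ∷ z) (t∈ ∷ z∈) =
  proj₁ (proj₂ (All.lookup (rows⇒ 0 M) t∈)) ∷ rows-pointwise M z z∈

module _ (M : ℕ) (u : S∞) (fix : Fixes≥ (suc M) u) where

  private
    compatible : List (List (ℕ × ℕ))
    compatible = filter (λ z → red? u (map proj₂ z)) (subs (rows 0 M))

  -- Membership in `rows 0 M` encodes i ≤ a < M entry by entry, and being a sublist encodes the
  -- `Step` condition; both lists are free of duplicates.
  compatible-↭ : map unzip′ compatible ↭ elements (compatiblePairs u)
  compatible-↭ = unique∧set⇒↭
    (Unique.map⁺ unzip′-injective (Unique.filter⁺ (λ z → red? u (map proj₂ z)) (subs! (rows! 0 M))))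
    (Enumeration.unique (compatiblePairs u)) sound complete
    where
    good⇒ : ∀ z → z ∈ subs (rows 0 M) × Red u (map proj₂ z) →
            Reduced u (map proj₂ z) × Compatible (map proj₂ z) (map proj₁ z)
    good⇒ z (z∈ , red-z) = Red⇒Reduced u (map proj₂ z) red-z
      , rows-pointwise M z (subs⇒∈ (rows 0 M) z∈)
      , subst (Linked Step) (≡.sym (zip-unzip′ z)) (AllPairs⇒Linked (subs-AllPairs (rows-sorted 0 M) z∈))
    sound : ∀ {x} → x ∈ map unzip′ compatible → x ∈ elements (compatiblePairs u)
    sound x∈ = go (∈-map⁻ unzip′ x∈)
      where
      go : ∀ {x} → ∃ (λ z → z ∈ compatible × x ≡ unzip′ z) → x ∈ elements (compatiblePairs u)
      go (z , z∈ , ≡.refl) = Enumeration.complete (compatiblePairs u)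
        (good⇒ z (∈-filter⁻ (λ z → red? u (map proj₂ z)) {xs = subs (rows 0 M)} z∈))
    ⇒compatible : ∀ a i → Reduced u a → Compatible a i → (a , i) ∈ map unzip′ compatible
    ⇒compatible a i red-a (pw , linked) = subst (_∈ map unzip′ compatible) (unzip′-zip pw)
      (∈-map⁺ unzip′ (∈-filter⁺ (λ z → red? u (map proj₂ z))
        (subs-complete Step-trans Step-irrefl (rows-sorted 0 M)
          (Linked⇒AllPairs Step-trans linked)
          (zip-rows M pw (Red-letters (reverseView a) M u fix (Reduced⇒Red u a red-a))))
        (subst (Red u) (≡.sym (cong proj₁ (unzip′-zip pw))) (Reduced⇒Red u a red-a))))
    complete : ∀ {x} → x ∈ elements (compatiblePairs u) → x ∈ map unzip′ compatible
    complete {a , i} x∈ = ⇒compatible a i (proj₁ p) (proj₂ p)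
      where p = Enumeration.sound (compatiblePairs u) x∈

module Enumerated {c r} (R : CommutativeRing c r) where

  open Newton R public

  ∑-compatiblePairs : ∀ M u → Fixes≥ (suc M) u → ∀ φ →
    ∑ (elements (compatiblePairs u)) (λ (a , i) → φ i) ≈ onSchubert M φ u
  ∑-compatiblePairs M u fix φ = trans
    (sym (∑-↭ (λ (a , i) → φ i) (compatible-↭ M u fix)))
    (trans (∑-map unzip′ (filter (λ z → red? u (map proj₂ z)) (subs (rows 0 M))) (λ (a , i) → φ i))
           (∑-filter (λ z → red? u (map proj₂ z)) (subs (rows 0 M)) (φ ∘ map proj₁)))

-- Arrangements of a monomial.

-- Positions are chosen, not values: repeated variables count with multiplicity, as they do in the
-- Leibniz rule, and a monomial of degree p has exactly p! arrangements.
choices : List ℕ → List (ℕ × List ℕ)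
choices []      = []
choices (k ∷ m) = (k , m) ∷ map (λ (l , m′) → l , k ∷ m′) (choices m)

choices-↭ : ∀ m → All (λ (k , m′) → k ∷ m′ ↭ m) (choices m)
choices-↭ []      = []
choices-↭ (k ∷ m) = ↭refl ∷ All.map⁺ (All.map (λ p → ↭trans (↭swap _ k ↭refl) (↭prep k p)) (choices-↭ m))

length-choices : ∀ m → length (choices m) ≡ length m
length-choices []      = ≡.refl
length-choices (k ∷ m) = cong suc (≡.trans (length-map _ (choices m)) (length-choices m))

-- There are none unless m has length p.

arrangements : ℕ → List ℕ → List (List ℕ)
arrangements zero    []      = [ [] ]
arrangements zero    (_ ∷ _) = []
arrangements (suc p) m       = concatMap (λ (k , m′) → map (k ∷_) (arrangements p m′)) (choices m)

arrangements-↭ : ∀ p m → All (_↭ m) (arrangements p m)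
arrangements-↭ zero    []      = ↭refl ∷ []
arrangements-↭ zero    (_ ∷ _) = []
arrangements-↭ (suc p) m       = All.concat⁺ (All.map⁺ (All.map
  (λ {(k , m′)} km′↭m → All.map⁺ (All.map (λ n↭m′ → ↭trans (↭prep k n↭m′) km′↭m) (arrangements-↭ p m′)))
  (choices-↭ m)))

arrangements-length : ∀ p m → All (λ n → length n ≡ p) (arrangements p m)
arrangements-length zero    []      = ≡.refl ∷ []
arrangements-length zero    (_ ∷ _) = []
arrangements-length (suc p) m       = All.concat⁺ (All.map⁺ (All.universal
  (λ (k , m′) → All.map⁺ (All.map (cong suc) (arrangements-length p m′))) (choices m)))

length-concatMap : ∀ {A B : Set} (f : A → List B) xs n → All (λ x → length (f x) ≡ n) xs →
                   length (concatMap f xs) ≡ length xs ℕ.* n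
length-concatMap f []       n []         = ≡.refl
length-concatMap f (x ∷ xs) n (eq ∷ eqs) =
  ≡.trans (length-++ (f x)) (cong₂ ℕ._+_ eq (length-concatMap f xs n eqs))

length-arrangements : ∀ p m → length m ≡ p → length (arrangements p m) ≡ p ℕ.!
length-arrangements zero    []      _  = ≡.refl
length-arrangements (suc p) m       eq = ≡.trans
  (length-concatMap _ (choices m) (p ℕ.!) (All.map
    (λ {(k , m′)} km′↭m → ≡.trans (length-map (k ∷_) (arrangements p m′))
      (length-arrangements p m′ (ℕ.suc-injective (≡.trans (↭-length km′↭m) eq))))
    (choices-↭ m)))
  (cong (ℕ._* p ℕ.!) (≡.trans (length-choices m) eq))

-- Chains read upwards and downwards.

opaque
  isChain? : ∀ w u τ → Dec (Chain w u τ)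
  isChain? = Finiteness.chain?

Chain-∷⁻ : ∀ w u t τ → Chain w u (t ∷ τ) → Up u t × Chain w (u · tr t) τ
Chain-∷⁻ w u t τ (step cov c) = Cover⇒Up u t cov , c

Chain-∷⁺ : ∀ w u t τ → Up u t × Chain w (u · tr t) τ → Chain w u (t ∷ τ)
Chain-∷⁺ w u t τ (up-t , c) = step (Up⇒Cover u t up-t) c

Chain-[]⁻ : ∀ w u → Chain w u [] → u ≈ₛ w
Chain-[]⁻ w u (stop u≈w) = u≈w

Chain-[]⁺ : ∀ w u → u ≈ₛ w → Chain w u []
Chain-[]⁺ w u = stop

module Chains {c r} (R : CommutativeRing c r) (N : ℕ) where

  open Functionals R
  open ≈-Reasoning
  open CoverSums R N using (E; covers; E-symmetric)

  -- The counterpart of E w, for chains from u to w read upwards from u.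

  E↑ : S∞ → S∞ → Functional
  E↑ w u []      = ⟦ u ≈? w ⟧
  E↑ w u (k ∷ m) = ∑ (pairs N) λ t → ⟦ up? u t ⟧ * (sgn k t * E↑ w (u · tr t) m)

  -- A chain can be cut at its first or at its last cover, and the two summations are interchanged.
  E↑-∷ʳ : ∀ w u m k →
    E↑ w u (m ∷ʳ k) ≈ (∑ (pairs N) λ t → covers w t * (sgn k t * E↑ (w · tr t) u m))
  E↑-∷ʳ w u [] k = ∑-cong (pairs N) λ t → begin
    ⟦ up? u t ⟧ * (sgn k t * ⟦ (u · tr t) ≈? w ⟧)
      ≈⟨ rearrange ⟦ up? u t ⟧ (sgn k t) _ ⟩
    sgn k t * (⟦ up? u t ⟧ * ⟦ (u · tr t) ≈? w ⟧)
      ≈⟨ *-congˡ (⟦⟧-× (up? u t) ((u · tr t) ≈? w)) ⟨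
    sgn k t * ⟦ up? u t ×-dec (u · tr t) ≈? w ⟧
      ≈⟨ *-congˡ (⟦⟧-⇔ (up? u t ×-dec (u · tr t) ≈? w) (down? w t ×-dec u ≈? (w · tr t))
           (λ (up-t , ut≈w) → Up⇒Down u w t ut≈w up-t ,
             λ n → ≡.trans (≡.sym (·tr-involutive u t n)) (ut≈w (to (tr t) n)))
           (λ (down-t , u≈wt) →
             Up-cong (w · tr t) u t (≈ₛ-sym u (w · tr t) u≈wt) (Down⇒Up w t down-t) ,
             λ n → ≡.trans (u≈wt (to (tr t) n)) (·tr-involutive w t n))) ⟩
    sgn k t * ⟦ down? w t ×-dec u ≈? (w · tr t) ⟧
      ≈⟨ *-congˡ (⟦⟧-× (down? w t) (u ≈? (w · tr t))) ⟩
    sgn k t * (⟦ down? w t ⟧ * ⟦ u ≈? (w · tr t) ⟧)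
      ≈⟨ rearrange ⟦ down? w t ⟧ (sgn k t) _ ⟨
    covers w t * (sgn k t * ⟦ u ≈? (w · tr t) ⟧) ∎
    where
    rearrange : ∀ x y z → x * (y * z) ≈ y * (x * z)
    rearrange = x∙yz≈y∙xz
  E↑-∷ʳ w u (l ∷ m) k = begin
    ∑ (pairs N) (λ t → ⟦ up? u t ⟧ * (sgn l t * E↑ w (u · tr t) (m ∷ʳ k)))
      ≈⟨ ∑-cong (pairs N) (λ t → trans (*-congˡ (*-congˡ (E↑-∷ʳ w (u · tr t) m k)))
           (trans (sym (*-assoc _ _ _)) (sym (∑-*ˡ (⟦ up? u t ⟧ * sgn l t) (pairs N) _)))) ⟩
    ∑ (pairs N) (λ t → ∑ (pairs N) λ t′ →
      (⟦ up? u t ⟧ * sgn l t) * (covers w t′ * (sgn k t′ * E↑ (w · tr t′) (u · tr t) m)))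
      ≈⟨ ∑-swap (pairs N) (pairs N) _ ⟩
    ∑ (pairs N) (λ t′ → ∑ (pairs N) λ t →
      (⟦ up? u t ⟧ * sgn l t) * (covers w t′ * (sgn k t′ * E↑ (w · tr t′) (u · tr t) m)))
      ≈⟨ ∑-cong (pairs N) (λ t′ → trans (∑-cong (pairs N) λ t →
           solve 5 (λ a b x y e → (a :* b) :* (x :* (y :* e)) := (x :* y) :* (a :* (b :* e))) refl
             ⟦ up? u t ⟧ (sgn l t) (covers w t′) (sgn k t′) (E↑ (w · tr t′) (u · tr t) m))
           (trans (∑-*ˡ (covers w t′ * sgn k t′) (pairs N) _) (*-assoc _ _ _))) ⟩
    ∑ (pairs N) (λ t′ → covers w t′ * (sgn k t′ * E↑ (w · tr t′) u (l ∷ m))) ∎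
    where open Solver using (solve; _:=_; _:*_)

  E↑≈E-reverse : ∀ {m} → Reverse m → ∀ w → E↑ w ε m ≈ E w (reverse m)
  E↑≈E-reverse []            w = refl
  E↑≈E-reverse (m ∶ rm ∶ʳ k) w = trans (E↑-∷ʳ w ε m k) (trans
    (∑-cong (pairs N) λ t → *-congˡ (*-congˡ (E↑≈E-reverse rm (w · tr t))))
    (reflexive (cong (E w) (≡.sym (reverse-++ m [ k ])))))

  -- Changing the reading direction reverses the monomial, and the symmetry of `E w` undoes the
  -- reversal.
  E↑≈E : ∀ w → Fixes≥ N w → ∀ m → E↑ w ε m ≈ E w m
  E↑≈E w fix m = trans (E↑≈E-reverse (reverseView m) w) (E-symmetric w fix (↭-reverse m))

  ∑-chains : ∀ m w u →
    (∑ (tuples (length m) (pairs N)) λ τ → ⟦ isChain? w u τ ⟧ * signs m τ) ≈ E↑ w u m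
  ∑-chains []      w u = trans (+-identityʳ _) (trans (*-identityʳ _)
    (⟦⟧-⇔ (isChain? w u []) (u ≈? w) (Chain-[]⁻ w u) (Chain-[]⁺ w u)))
  ∑-chains (k ∷ m) w u = trans
    (∑-product _∷_ (pairs N) (tuples (length m) (pairs N)) _)
    (∑-cong (pairs N) λ t → begin
      ∑ T (λ τ → ⟦ isChain? w u (t ∷ τ) ⟧ * (sgn k t * signs m τ))
        ≈⟨ ∑-cong T (λ τ → trans (*-congʳ (trans
             (⟦⟧-⇔ (isChain? w u (t ∷ τ)) (up? u t ×-dec isChain? w (u · tr t) τ)
               (Chain-∷⁻ w u t τ) (Chain-∷⁺ w u t τ))
             (⟦⟧-× (up? u t) (isChain? w (u · tr t) τ))))
             (solve 4 (λ a b x y → (a :* b) :* (x :* y) := (a :* x) :* (b :* y)) refl _ _ _ _)) ⟩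
      ∑ T (λ τ → (⟦ up? u t ⟧ * sgn k t) * (⟦ isChain? w (u · tr t) τ ⟧ * signs m τ))
        ≈⟨ ∑-*ˡ (⟦ up? u t ⟧ * sgn k t) T _ ⟩
      (⟦ up? u t ⟧ * sgn k t) * ∑ T (λ τ → ⟦ isChain? w (u · tr t) τ ⟧ * signs m τ)
        ≈⟨ *-congˡ (∑-chains m w (u · tr t)) ⟩
      (⟦ up? u t ⟧ * sgn k t) * E↑ w (u · tr t) m
        ≈⟨ *-assoc _ _ _ ⟩
      ⟦ up? u t ⟧ * (sgn k t * E↑ w (u · tr t) m) ∎)
    where
    open Solver using (solve; _:=_; _:*_)
    T = tuples (length m) (pairs N)

-- Partial derivatives and the pairing of monomials.

module Derivatives {c r} (K : ℚ-Algebra c r) where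

  open Polynomials K public hiding (Carrier; _≈_; 0#; 1#)
  R : CommutativeRing c r
  R = ℚ-Algebra.commutativeRing K
  open Enumerated R public
  open ≈-Reasoning

  lin : Functional → Poly → Carrier
  lin φ f = ∑ f λ (x , m) → x * φ m

  lin-cong : ∀ {φ ψ} → φ ≐ ψ → ∀ f → lin φ f ≈ lin ψ f
  lin-cong φ≐ψ f = ∑-cong f λ (x , m) → *-congˡ (φ≐ψ m)

  lin-• : ∀ φ x f → lin φ (x • f) ≈ x * lin φ f
  lin-• φ x f = trans (∑-map _ f _) (trans (∑-cong f λ _ → *-assoc _ _ _) (∑-*ˡ x f _))

  lin-sumₚ : ∀ {A : Set} φ (h : A → Poly) xs → lin φ (sumₚ (map h xs)) ≈ ∑ xs (λ x → lin φ (h x))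
  lin-sumₚ φ h []       = refl
  lin-sumₚ φ h (x ∷ xs) = trans (∑-++ (h x) _ _) (+-congˡ (lin-sumₚ φ h xs))

  ∂ᵗ : ℕ → Functional → Functional
  ∂ᵗ k φ m = ∑ (∂ᵐ k m) φ

  ∂ᵗ-∷ : ∀ k φ j m → ∂ᵗ k φ (j ∷ m) ≈ κ k j * φ m + ∂ᵗ k (φ ∘ (j ∷_)) m
  ∂ᵗ-∷ k φ j m with k ≟ j
  ... | yes k≡j = +-cong (trans (sym (*-identityˡ _)) (*-congʳ (sym (⟦⟧-yes (k ≟ j) k≡j)))) (∑-map (j ∷_) (∂ᵐ k m) φ)
  ... | no k≢j  = trans (∑-map (j ∷_) (∂ᵐ k m) φ)
    (sym (trans (+-congʳ (trans (*-congʳ (⟦⟧-no (k ≟ j) k≢j)) (zeroˡ _))) (+-identityˡ _)))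

  ∂ᵗ-cong : ∀ k {φ ψ} → φ ≐ ψ → ∂ᵗ k φ ≐ ∂ᵗ k ψ
  ∂ᵗ-cong k φ≐ψ m = ∑-cong (∂ᵐ k m) φ≐ψ

  lin-∂ : ∀ φ k f → lin φ (∂ k f) ≈ lin (∂ᵗ k φ) f
  lin-∂ φ k f = trans (∑-concatMap _ f _) (∑-cong f λ (x , m) →
    trans (∑-map (x ,_) (∂ᵐ k m) _) (∑-*ˡ x (∂ᵐ k m) φ))

  ∂ᵗ-comm : ∀ k l φ m → ∂ᵗ k (∂ᵗ l φ) m ≈ ∂ᵗ l (∂ᵗ k φ) m
  ∂ᵗ-comm k l φ []      = refl
  ∂ᵗ-comm k l φ (j ∷ m) = begin
    ∂ᵗ k (∂ᵗ l φ) (j ∷ m)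
      ≈⟨ expand k l ⟩
    (κ k j * ∂ᵗ l φ m + κ l j * ∂ᵗ k φ m) + ∂ᵗ k (∂ᵗ l (φ ∘ (j ∷_))) m
      ≈⟨ +-cong (+-comm _ _) (∂ᵗ-comm k l (φ ∘ (j ∷_)) m) ⟩
    (κ l j * ∂ᵗ k φ m + κ k j * ∂ᵗ l φ m) + ∂ᵗ l (∂ᵗ k (φ ∘ (j ∷_))) m
      ≈⟨ expand l k ⟨
    ∂ᵗ l (∂ᵗ k φ) (j ∷ m) ∎
    where
    expand : ∀ k l → ∂ᵗ k (∂ᵗ l φ) (j ∷ m) ≈
             (κ k j * ∂ᵗ l φ m + κ l j * ∂ᵗ k φ m) + ∂ᵗ k (∂ᵗ l (φ ∘ (j ∷_))) m
    expand k l = trans (∂ᵗ-∷ k (∂ᵗ l φ) j m) (trans (+-congˡ (trans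
      (∂ᵗ-cong k (∂ᵗ-∷ l φ j) m)
      (trans (∑-+ (∂ᵐ k m) _ _) (+-congʳ (∑-*ˡ (κ l j) (∂ᵐ k m) φ)))))
      (sym (+-assoc _ _ _)))

  ∂ᵗ-symmetric : ∀ k {φ} → Symmetric φ → Symmetric (∂ᵗ k φ)
  ∂ᵗ-symmetric k sφ ↭refl = refl
  ∂ᵗ-symmetric k {φ} sφ (↭prep {m} {n} j p) = trans (∂ᵗ-∷ k φ j m) (trans
    (+-cong (*-congˡ (sφ p)) (∂ᵗ-symmetric k (Symmetric-∷ j sφ) p)) (sym (∂ᵗ-∷ k φ j n)))
  ∂ᵗ-symmetric k sφ (↭trans p q) = trans (∂ᵗ-symmetric k sφ p) (∂ᵗ-symmetric k sφ q)
  ∂ᵗ-symmetric k {φ} sφ (↭swap {m} {n} i j p) = begin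
    ∂ᵗ k φ (i ∷ j ∷ m)
      ≈⟨ expand i j m ⟩
    (κ k i * φ (j ∷ m) + κ k j * φ (i ∷ m)) + ∂ᵗ k (φ ∘ (i ∷_) ∘ (j ∷_)) m
      ≈⟨ +-cong (trans (+-comm _ _) (+-cong (*-congˡ (sφ (↭prep i p))) (*-congˡ (sφ (↭prep j p)))))
           (trans (∂ᵗ-cong k (λ _ → sφ (↭swap i j ↭refl)) m)
                  (∂ᵗ-symmetric k (Symmetric-∷ i (Symmetric-∷ j sφ)) p)) ⟩
    (κ k j * φ (i ∷ n) + κ k i * φ (j ∷ n)) + ∂ᵗ k (φ ∘ (j ∷_) ∘ (i ∷_)) n
      ≈⟨ expand j i n ⟨
    ∂ᵗ k φ (j ∷ i ∷ n) ∎
    where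
    expand : ∀ i j m → ∂ᵗ k φ (i ∷ j ∷ m) ≈
      (κ k i * φ (j ∷ m) + κ k j * φ (i ∷ m)) + ∂ᵗ k (φ ∘ (i ∷_) ∘ (j ∷_)) m
    expand i j m = trans (∂ᵗ-∷ k φ i (j ∷ m)) (trans (+-congˡ (∂ᵗ-∷ k (φ ∘ (i ∷_)) j m)) (sym (+-assoc _ _ _)))

  ∂ᵗ* : List ℕ → Functional → Functional
  ∂ᵗ* []      φ = φ
  ∂ᵗ* (k ∷ m) φ = ∂ᵗ* m (∂ᵗ k φ)

  ∂ᵗ*-cong : ∀ m {φ ψ} → φ ≐ ψ → ∂ᵗ* m φ ≐ ∂ᵗ* m ψ
  ∂ᵗ*-cong []      φ≐ψ = φ≐ψ
  ∂ᵗ*-cong (k ∷ m) φ≐ψ = ∂ᵗ*-cong m (∂ᵗ-cong k φ≐ψ)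

  ∂ᵗ*-+ : ∀ m φ ψ n → ∂ᵗ* m (λ n → φ n + ψ n) n ≈ ∂ᵗ* m φ n + ∂ᵗ* m ψ n
  ∂ᵗ*-+ []      φ ψ n = refl
  ∂ᵗ*-+ (k ∷ m) φ ψ n = trans (∂ᵗ*-cong m (λ n → ∑-+ (∂ᵐ k n) φ ψ) n) (∂ᵗ*-+ m (∂ᵗ k φ) (∂ᵗ k ψ) n)

  ∂ᵗ*-*ˡ : ∀ m x φ n → ∂ᵗ* m (λ n → x * φ n) n ≈ x * ∂ᵗ* m φ n
  ∂ᵗ*-*ˡ []      x φ n = refl
  ∂ᵗ*-*ˡ (k ∷ m) x φ n = trans (∂ᵗ*-cong m (λ n → ∑-*ˡ x (∂ᵐ k n) φ) n) (∂ᵗ*-*ˡ m x (∂ᵗ k φ) n)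

  ∂ᵗ*-0 : ∀ m {φ} → (∀ n → φ n ≈ 0#) → ∀ n → ∂ᵗ* m φ n ≈ 0#
  ∂ᵗ*-0 []      φ≈0 = φ≈0
  ∂ᵗ*-0 (k ∷ m) φ≈0 = ∂ᵗ*-0 m λ n → ∑-0 (∂ᵐ k n) φ≈0

  ∂ᵗ*-[] : ∀ k m φ → ∂ᵗ* (k ∷ m) φ [] ≈ 0#
  ∂ᵗ*-[] k []      φ = refl
  ∂ᵗ*-[] k (l ∷ m) φ = ∂ᵗ*-[] l m (∂ᵗ k φ)

  ∂ᵗ*-symmetric : ∀ m {φ} → Symmetric φ → Symmetric (∂ᵗ* m φ)
  ∂ᵗ*-symmetric []      sφ = sφ
  ∂ᵗ*-symmetric (k ∷ m) sφ = ∂ᵗ*-symmetric m (∂ᵗ-symmetric k sφ)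

  ∂ᵗ*-↭ : ∀ {m n} → m ↭ n → ∀ φ → ∂ᵗ* m φ ≐ ∂ᵗ* n φ
  ∂ᵗ*-↭ ↭refl            φ l = refl
  ∂ᵗ*-↭ (↭prep k p)      φ l = ∂ᵗ*-↭ p (∂ᵗ k φ) l
  ∂ᵗ*-↭ (↭swap {m} j k p) φ l = trans (∂ᵗ*-cong m (∂ᵗ-comm k j φ) l) (∂ᵗ*-↭ p (∂ᵗ j (∂ᵗ k φ)) l)
  ∂ᵗ*-↭ (↭trans p q)     φ l = trans (∂ᵗ*-↭ p φ l) (∂ᵗ*-↭ q φ l)

  lin-∂* : ∀ φ m g → lin φ (foldr ∂ g m) ≈ lin (∂ᵗ* m φ) g
  lin-∂* φ []      g = refl
  lin-∂* φ (k ∷ m) g = trans (lin-∂ φ k (foldr ∂ g m)) (lin-∂* (∂ᵗ k φ) m g)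

  -- θ m n = ⟨ x_m , x_n ⟩

  θ : List ℕ → Functional
  θ m = ∂ᵗ* m ct

  pairing : ∀ f g → ⟨ f , g ⟩ ≈ lin (λ m → lin (θ m) g) f
  pairing f g = trans (∑-concatMap _ f _) (∑-cong f λ (x , m) →
    trans (lin-• ct x (foldr ∂ g m)) (*-congˡ (lin-∂* ct m g)))

  θ-symmetricʳ : ∀ m → Symmetric (θ m)
  θ-symmetricʳ m = ∂ᵗ*-symmetric m ct-symmetric

  -- Leibniz rule: the leading variable is linear, so at most one of the derivatives hits it, and
  -- `choices` lists which.
  ∂ᵗ*-∷ : ∀ m φ j n → ∂ᵗ* m φ (j ∷ n) ≈
    (∑ (choices m) λ (k , m′) → κ k j * ∂ᵗ* m′ φ n) + ∂ᵗ* m (φ ∘ (j ∷_)) n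
  ∂ᵗ*-∷ []      φ j n = sym (+-identityˡ _)
  ∂ᵗ*-∷ (k ∷ m) φ j n = begin
    ∂ᵗ* m (∂ᵗ k φ) (j ∷ n)
      ≈⟨ ∂ᵗ*-∷ m (∂ᵗ k φ) j n ⟩
    S + ∂ᵗ* m (∂ᵗ k φ ∘ (j ∷_)) n
      ≈⟨ +-congˡ (trans (∂ᵗ*-cong m (∂ᵗ-∷ k φ j) n)
           (trans (∂ᵗ*-+ m _ _ n) (+-congʳ (∂ᵗ*-*ˡ m (κ k j) φ n)))) ⟩
    S + (κ k j * ∂ᵗ* m φ n + ∂ᵗ* m (∂ᵗ k (φ ∘ (j ∷_))) n)
      ≈⟨ trans (sym (+-assoc _ _ _)) (+-congʳ (trans (+-comm _ _)
           (+-congˡ (sym (∑-map (λ (l , m′) → l , k ∷ m′) (choices m) _))))) ⟩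
    (∑ (choices (k ∷ m)) λ (l , m′) → κ l j * ∂ᵗ* m′ φ n) + ∂ᵗ* (k ∷ m) (φ ∘ (j ∷_)) n ∎
    where S = ∑ (choices m) λ (l , m′) → κ l j * ∂ᵗ* m′ (∂ᵗ k φ) n

  θ-∷ : ∀ m j n → θ m (j ∷ n) ≈ (∑ (choices m) λ (k , m′) → κ k j * θ m′ n)
  θ-∷ m j n = trans (∂ᵗ*-∷ m ct j n) (trans (+-congˡ (∂ᵗ*-0 m (ct-∷ j) n)) (+-identityʳ _))

  θ-↮ : ∀ m n → ¬ (m ↭ n) → θ m n ≈ 0#
  θ-↮ []      []      m↮n = contradiction ↭refl m↮n
  θ-↮ (k ∷ m) []      m↮n = ∂ᵗ*-[] k m ct
  θ-↮ m       (j ∷ n) m↮n = trans (θ-∷ m j n) (trans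
    (∑-cong∈ (choices m) λ (k , m′) km′∈ → ⟦⟧-0 (k ≟ j) λ { ≡.refl →
      θ-↮ m′ n λ m′↭n → m↮n (↭trans (↭-sym (All.lookup (choices-↭ m) km′∈)) (↭prep k m′↭n)) })
    (∑-0 (choices m) λ _ → refl))

  open Mult semiring using (×1-homo-*)

  ∑-⟦⟧ : ∀ {A : Set} {P : A → Set} (P? : ∀ x → Dec (P x)) xs → ∃ λ n → ∑ xs (λ x → ⟦ P? x ⟧) ≈ n ×ᴷ 1#
  ∑-⟦⟧ P? []       = 0 , refl
  ∑-⟦⟧ P? (x ∷ xs) with P? x | ∑-⟦⟧ P? xs
  ... | yes _ | n , eq = suc n , +-congˡ eq
  ... | no _  | n , eq = n , trans (+-identityˡ _) eq

  -- The integer is the product of the factorials of the exponents of m.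
  θ-diagonal : ∀ m → ∃ λ n → θ m m ≈ suc n ×ᴷ 1#
  θ-diagonal []      = 0 , sym (+-identityʳ 1#)
  θ-diagonal (j ∷ m) with θ-diagonal m | ∑-⟦⟧ (λ (k , _) → k ≟ j) (choices m)
  ... | n , θmm≈ | e , ∑≈ = n ℕ.+ e ℕ.* suc n , (begin
    θ (j ∷ m) (j ∷ m)
      ≈⟨ θ-∷ (j ∷ m) j m ⟩
    κ j j * θ m m + ∑ (map (λ (l , m′) → l , j ∷ m′) (choices m)) (λ (k , m′) → κ k j * θ m′ m)
      ≈⟨ +-cong (*-congʳ (trans (κ-≡ j) (sym (+-identityʳ 1#)))) (trans
           (∑-map (λ (l , m′) → l , j ∷ m′) (choices m) _)
           (∑-cong∈ (choices m) λ (k , m′) km′∈ → ⟦⟧-cong (k ≟ j) λ { ≡.refl →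
             ∂ᵗ*-↭ (All.lookup (choices-↭ m) km′∈) ct m })) ⟩
    (1 ×ᴷ 1#) * θ m m + ∑ (choices m) (λ (k , m′) → κ k j * θ m m)
      ≈⟨ +-congˡ (trans (∑-*ʳ (θ m m) (choices m) _) (*-congʳ ∑≈)) ⟩
    (1 ×ᴷ 1#) * θ m m + (e ×ᴷ 1#) * θ m m
      ≈⟨ trans (sym (distribʳ _ _ _)) (*-cong (+-congʳ (+-identityʳ 1#)) θmm≈) ⟩
    (suc e ×ᴷ 1#) * (suc n ×ᴷ 1#)
      ≈⟨ ×1-homo-* (suc e) (suc n) ⟨
    (suc e ℕ.* suc n) ×ᴷ 1# ∎)

  ×-cancel : ∀ n {x y} → x * (suc n ×ᴷ 1#) ≈ y * (suc n ×ᴷ 1#) → x ≈ y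
  ×-cancel n {x} {y} eq = trans (invert x) (trans (*-congʳ eq) (sym (invert y)))
    where
    invert : ∀ x → x ≈ x * (suc n ×ᴷ 1#) * (1/ suc n)
    invert x = sym (trans (*-assoc _ _ _) (trans (*-congˡ (n×1/n≈1 (suc n))) (*-identityʳ x)))

  exponent-↭ : ∀ {m n} → m ↭ n → m ∼ n
  exponent-↭ p i = ↭-length (filter-↭ (i ≟_) p)

  exponent-∷ : ∀ i j → ∃ λ e → ∀ m → exponent i (j ∷ m) ≡ e ℕ.+ exponent i m
  exponent-∷ i j with i ≟ j
  ... | yes i≡j = 1 , λ m → cong length (filter-accept (i ≟_) i≡j)
  ... | no i≢j  = 0 , λ m → cong length (filter-reject (i ≟_) i≢j)

  ∼⇒↭ : ∀ m n → m ∼ n → m ↭ n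
  ∼⇒↭ []      []      _   = ↭refl
  ∼⇒↭ (j ∷ m) []      m∼n = contradiction
    (≡.trans (≡.sym (cong length (filter-accept (j ≟_) ≡.refl))) (m∼n j)) λ ()
  ∼⇒↭ m       (j ∷ n) m∼n with _∈?_ _≟_ j m
  ... | no j∉m = contradiction (≡.trans (≡.sym (m∼n j)) (cong length (filter-none (j ≟_) (All.¬Any⇒All¬ m j∉m))))
                   λ eq → ℕ.1+n≢0 (≡.trans (≡.sym (cong length (filter-accept (j ≟_) ≡.refl))) eq)
  ... | yes j∈m with ∈-∃++ j∈m
  ...   | xs , ys , ≡.refl = ↭trans (shift j xs ys) (↭prep j (∼⇒↭ (xs ++ ys) n λ i →
    let e , e+ = exponent-∷ i j in ℕ.+-cancelˡ-≡ e _ _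
      (≡.trans (≡.sym (e+ (xs ++ ys))) (≡.trans (≡.sym (exponent-↭ (shift j xs ys) i)) (≡.trans (m∼n i) (e+ n))))))

  lin-θ : ∀ m f → lin (θ m) f ≈ coeff m f * θ m m
  lin-θ m f = begin
    ∑ f (λ (x , n) → x * θ m n)
      ≈⟨ ∑-cong f (λ (x , n) → term x n (n ∼? m)) ⟩
    ∑ f (λ (x , n) → (⟦ n ∼? m ⟧ * x) * θ m m)
      ≈⟨ ∑-*ʳ (θ m m) f _ ⟩
    ∑ f (λ (x , n) → ⟦ n ∼? m ⟧ * x) * θ m m
      ≈⟨ *-congʳ (∑-filter (λ t → proj₂ t ∼? m) f proj₁) ⟨
    coeff m f * θ m m ∎
    where
    term : ∀ x n (n∼?m : Dec (n ∼ m)) → x * θ m n ≈ (⟦ n∼?m ⟧ * x) * θ m m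
    term x n (yes n∼m) = *-cong (sym (*-identityˡ x)) (θ-symmetricʳ m (∼⇒↭ n m n∼m))
    term x n (no n≁m)  = trans (*-congˡ (θ-↮ m n λ p → n≁m (exponent-↭ (↭-sym p))))
      (trans (zeroʳ x) (sym (trans (*-congʳ (zeroˡ x)) (zeroˡ _))))

  -- Distinct monomials are orthogonal, so pairing with `m` gives the coefficient times `θ m m`, a
  -- positive integer and hence cancellable.
  coeff-from-θ : ∀ m f g → lin (θ m) f ≈ lin (θ m) g → coeff m f ≈ coeff m g
  coeff-from-θ m f g eq with θ-diagonal m
  ... | n , θmm≈ = ×-cancel n (trans (*-congˡ (sym θmm≈))
    (trans (sym (lin-θ m f)) (trans eq (trans (lin-θ m g) (*-congˡ θmm≈)))))

-- Pairing with the chain polynomials, duality and uniqueness.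

module Duals {c r} (K : ℚ-Algebra c r) where

  open Derivatives K public
  open ≈-Reasoning

  lin-μ : ∀ φ t f → lin φ (μ t *ₚ f) ≈ lin (λ m → φ (proj₁ t ∷ m) - φ (proj₂ t ∷ m)) f
  lin-μ φ (a , b) f = begin
    lin φ (μ (a , b) *ₚ f)
      ≈⟨ ∑-product (λ (x , m) (y , n) → x * y , m ++ n) (μ (a , b)) f _ ⟩
    ∑ f (λ (y , m) → 1# * y * φ (a ∷ m)) + (∑ f (λ (y , m) → - 1# * 1# * y * φ (b ∷ m)) + 0#)
      ≈⟨ +-congˡ (+-identityʳ _) ⟩
    ∑ f (λ (y , m) → 1# * y * φ (a ∷ m)) + ∑ f (λ (y , m) → - 1# * 1# * y * φ (b ∷ m))
      ≈⟨ ∑-+ f _ _ ⟨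
    ∑ f (λ (y , m) → 1# * y * φ (a ∷ m) + - 1# * 1# * y * φ (b ∷ m))
      ≈⟨ ∑-cong f (λ (y , m) → trans (+-cong (*-congʳ (*-identityˡ y)) (trans
           (*-congʳ (trans (*-congʳ (*-identityʳ (- 1#))) (-1*x≈-x y)))
           (trans (sym (-‿distribˡ-* y _)) (-‿distribʳ-* y _)))) (sym (distribˡ y _ _))) ⟩
    lin (λ m → φ (a ∷ m) - φ (b ∷ m)) f ∎

  θ-difference : ∀ m t n → θ m (proj₁ t ∷ n) - θ m (proj₂ t ∷ n) ≈
                 (∑ (choices m) λ (k , m′) → sgn k t * θ m′ n)
  θ-difference m (a , b) n = begin
    θ m (a ∷ n) - θ m (b ∷ n)
      ≈⟨ +-cong (θ-∷ m a n) (-‿cong (θ-∷ m b n)) ⟩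
    ∑ (choices m) (λ (k , m′) → κ k a * θ m′ n) - ∑ (choices m) (λ (k , m′) → κ k b * θ m′ n)
      ≈⟨ +-congˡ (trans (sym (-1*x≈-x _)) (sym (∑-*ˡ (- 1#) (choices m) _))) ⟩
    ∑ (choices m) (λ (k , m′) → κ k a * θ m′ n) + ∑ (choices m) (λ (k , m′) → - 1# * (κ k b * θ m′ n))
      ≈⟨ ∑-+ (choices m) _ _ ⟨
    ∑ (choices m) (λ (k , m′) → κ k a * θ m′ n + - 1# * (κ k b * θ m′ n))
      ≈⟨ ∑-cong (choices m) (λ (k , m′) → trans
           (+-congˡ (trans (-1*x≈-x _) (-‿distribˡ-* (κ k b) (θ m′ n))))
           (sym (distribʳ (θ m′ n) (κ k a) (- κ k b)))) ⟩
    ∑ (choices m) (λ (k , m′) → sgn k (a , b) * θ m′ n) ∎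

  lin-∑ : ∀ {A : Set} (xs : List A) (φ : A → Functional) f →
          lin (λ m → ∑ xs λ x → φ x m) f ≈ ∑ xs (λ x → lin (φ x) f)
  lin-∑ xs φ f = trans (∑-cong f λ (y , m) → sym (∑-*ˡ y xs _)) (∑-swap f xs _)

  lin-*ˡ : ∀ x φ f → lin (λ m → x * φ m) f ≈ x * lin φ f
  lin-*ˡ x φ f = trans (∑-cong f λ (y , m) → x∙yz≈y∙xz y x (φ m)) (∑-*ˡ x f _)

  -- Each linear form absorbs exactly one derivative, so the pairing sums over the ways to
  -- distribute the variables of `m` among the forms.
  lin-θ-product : ∀ m τ → lin (θ m) (productₚ (map μ τ)) ≈
                  ∑ (arrangements (length τ) m) (λ n → signs n τ)
  lin-θ-product []      [] = +-congʳ (*-identityʳ 1#)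
  lin-θ-product (k ∷ m) [] = trans (+-identityʳ _) (trans (*-identityˡ _) (∂ᵗ*-[] k m ct))
  lin-θ-product m (t ∷ τ)  = begin
    lin (θ m) (μ t *ₚ P)
      ≈⟨ lin-μ (θ m) t P ⟩
    lin (λ n → θ m (proj₁ t ∷ n) - θ m (proj₂ t ∷ n)) P
      ≈⟨ lin-cong (θ-difference m t) P ⟩
    lin (λ n → ∑ (choices m) λ (k , m′) → sgn k t * θ m′ n) P
      ≈⟨ lin-∑ (choices m) _ P ⟩
    ∑ (choices m) (λ (k , m′) → lin (λ n → sgn k t * θ m′ n) P)
      ≈⟨ ∑-cong (choices m) (λ (k , m′) → trans (lin-*ˡ (sgn k t) (θ m′) P) (trans
           (*-congˡ (lin-θ-product m′ τ))
           (trans (sym (∑-*ˡ (sgn k t) (arrangements (length τ) m′) _))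
                  (sym (∑-map (k ∷_) (arrangements (length τ) m′) _))))) ⟩
    ∑ (choices m) (λ (k , m′) → ∑ (map (k ∷_) (arrangements (length τ) m′)) (λ n → signs n (t ∷ τ)))
      ≈⟨ ∑-concatMap _ (choices m) _ ⟨
    ∑ (arrangements (suc (length τ)) m) (λ n → signs n (t ∷ τ)) ∎
    where P = productₚ (map μ τ)

  ∑-const : ∀ {A : Set} (xs : List A) x → ∑ xs (λ _ → x) ≈ (length xs ×ᴷ 1#) * x
  ∑-const []       x = sym (zeroˡ x)
  ∑-const (_ ∷ xs) x = trans (+-cong (sym (*-identityˡ x)) (∑-const xs x)) (sym (distribʳ x 1# _))

  length-tuples : ∀ {A : Set} p (xs : List A) → All (λ τ → length τ ≡ p) (tuples p xs)
  length-tuples zero    xs = ≡.refl ∷ []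
  length-tuples (suc p) xs = go xs
    where
    go : ∀ ys → All (λ τ → length τ ≡ suc p) (cartesianProductWith _∷_ ys (tuples p xs))
    go []       = []
    go (y ∷ ys) = All.++⁺ (All.map⁺ (All.map (cong suc) (length-tuples p xs))) (go ys)

  module _ (w : S∞) where

    private
      N = bound w
      p = ℓ w ℕ.∸ ℓ ε
      p! = p ℕ.!
      T = tuples p (pairs N)
      instance p!≢0 = ℕ._!≢0 p
    open Chains R N using (E↑; E↑≈E; ∑-chains)
    open CoverSums R N using (E; E-symmetric)

    lin-θ-𝔇 : ∀ m → lin (θ m) (𝔇 ε w) ≈
      (1/ p!) * ∑ (arrangements p m) (λ n → ∑ T λ τ → ⟦ isChain? w ε τ ⟧ * signs n τ)
    lin-θ-𝔇 m = trans (lin-• (θ m) (1/ p!) S) (*-congˡ (begin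
      lin (θ m) S
        ≈⟨ lin-sumₚ (θ m) (λ τ → productₚ (map μ τ)) (elements (chains ε w)) ⟩
      ∑ (elements (chains ε w)) (λ τ → lin (θ m) (productₚ (map μ τ)))
        ≈⟨ ∑-filter (chain? w ε) T _ ⟩
      ∑ T (λ τ → ⟦ chain? w ε τ ⟧ * lin (θ m) (productₚ (map μ τ)))
        ≈⟨ ∑-cong∈ T (λ τ τ∈ → *-cong (⟦⟧-⇔ (chain? w ε τ) (isChain? w ε τ) id id)
             (trans (lin-θ-product m τ) (reflexive (cong (λ p → ∑ (arrangements p m) (λ n → signs n τ))
               (All.lookup (length-tuples p (pairs N)) τ∈))))) ⟩
      ∑ T (λ τ → ⟦ isChain? w ε τ ⟧ * ∑ (arrangements p m) (λ n → signs n τ))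
        ≈⟨ ∑-cong T (λ τ → ∑-*ˡ ⟦ isChain? w ε τ ⟧ (arrangements p m) _) ⟨
      ∑ T (λ τ → ∑ (arrangements p m) (λ n → ⟦ isChain? w ε τ ⟧ * signs n τ))
        ≈⟨ ∑-swap T (arrangements p m) _ ⟩
      ∑ (arrangements p m) (λ n → ∑ T λ τ → ⟦ isChain? w ε τ ⟧ * signs n τ) ∎))
      where S = sumₚ (map (λ τ → productₚ (map μ τ)) (elements (chains ε w)))

    pairing-𝔇 : ∀ m → length m ≡ p → lin (θ m) (𝔇 ε w) ≈ E w m
    pairing-𝔇 m len = begin
      lin (θ m) (𝔇 ε w)
        ≈⟨ lin-θ-𝔇 m ⟩
      (1/ p!) * ∑ (arrangements p m) (λ n → ∑ T λ τ → ⟦ isChain? w ε τ ⟧ * signs n τ)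
        ≈⟨ *-congˡ (trans (∑-cong∈ (arrangements p m) λ n n∈ → evaluate-arrangement n
             (All.lookup (arrangements-length p m) n∈) (All.lookup (arrangements-↭ p m) n∈))
             (∑-const (arrangements p m) (E w m))) ⟩
      (1/ p!) * ((length (arrangements p m) ×ᴷ 1#) * E w m)
        ≈⟨ *-congˡ (*-congʳ (reflexive (cong (_×ᴷ 1#) (length-arrangements p m len)))) ⟩
      (1/ p!) * ((p! ×ᴷ 1#) * E w m)
        ≈⟨ trans (sym (*-assoc _ _ _)) (*-congʳ (trans (*-comm _ _) (n×1/n≈1 p!))) ⟩
      1# * E w m
        ≈⟨ *-identityˡ _ ⟩
      E w m ∎
      where
      evaluate-arrangement : ∀ n → length n ≡ p → n ↭ m →
                             ∑ T (λ τ → ⟦ isChain? w ε τ ⟧ * signs n τ) ≈ E w m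
      evaluate-arrangement n len n↭m = trans
        (reflexive (cong (λ p → ∑ (tuples p (pairs N)) (λ τ → ⟦ isChain? w ε τ ⟧ * signs n τ)) (≡.sym len)))
        (trans (∑-chains n w ε) (trans (E↑≈E w (fixes w) n) (E-symmetric w (fixes w) n↭m)))

    pairing-𝔇-0 : ∀ m → length m ≢ p → lin (θ m) (𝔇 ε w) ≈ 0#
    pairing-𝔇-0 m len≢ = trans (lin-θ-𝔇 m) (trans
      (*-congˡ (trans (∑-cong∈ (arrangements p m) λ n n∈ → contradiction
        (≡.trans (≡.sym (↭-length (All.lookup (arrangements-↭ p m) n∈)))
                 (All.lookup (arrangements-length p m) n∈)) len≢)
        (∑-0 (arrangements p m) λ _ → refl)))
      (zeroʳ _))

  ℓε≡0 : ℓ ε ≡ 0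
  ℓε≡0 = ℓ≡#inv ε

  length≡ℓ : ∀ w → ℓ w ℕ.∸ ℓ ε ≡ #inv w
  length≡ℓ w = cong₂ ℕ._∸_ (ℓ≡#inv w) ℓε≡0

  lin-𝔖 : ∀ φ u → lin φ (𝔖 u) ≈ ∑ (elements (compatiblePairs u)) (λ (a , i) → φ i)
  lin-𝔖 φ u = trans (lin-sumₚ φ (λ (a , i) → monomial i) (elements (compatiblePairs u)))
    (∑-cong (elements (compatiblePairs u)) λ (a , i) → trans (+-identityʳ _) (*-identityˡ _))

  private
    fixes-suc : ∀ u M → bound u ≤ M → Fixes≥ (suc M) u
    fixes-suc u M u≤M n M<n = fixes u n (ℕ.≤-trans u≤M (ℕ.<⇒≤ M<n))

  compatible-length : ∀ u {a i} → (a , i) ∈ elements (compatiblePairs u) → length i ≡ #inv u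
  compatible-length u {a} {i} x∈ = ≡.trans (Pointwise-length (proj₁ (proj₂ good)))
    (Red.minimal (Reduced⇒Red u a (proj₁ good)))
    where
    good = Enumeration.sound (compatiblePairs u) x∈

  δ≈ : ∀ u w → ⟦ u ≈? w ⟧ ≈ δ u w
  δ≈ u w = ⟦⟧-⇔ (u ≈? w) (u ≟ₛ w) id id

  duality : ∀ u w → ⟨ 𝔖 u , 𝔇 ε w ⟩ ≈ δ u w
  duality u w = begin
    ⟨ 𝔖 u , 𝔇 ε w ⟩
      ≈⟨ pairing (𝔖 u) (𝔇 ε w) ⟩
    lin (λ m → lin (θ m) (𝔇 ε w)) (𝔖 u)
      ≈⟨ lin-𝔖 (λ m → lin (θ m) (𝔇 ε w)) u ⟩
    ∑ els (λ (a , i) → lin (θ i) (𝔇 ε w))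
      ≈⟨ by-length (#inv u ≟ #inv w) ⟩
    ⟦ u ≈? w ⟧
      ≈⟨ δ≈ u w ⟩
    δ u w ∎
    where
    open CoverSums R (bound w) using (E)
    els = elements (compatiblePairs u)
    M = bound u ℕ.⊔ bound w
    -- `pairing-𝔇` covers only monomials of degree ℓ(w); for different lengths the pairing vanishes
    -- by homogeneity.
    by-length : Dec (#inv u ≡ #inv w) → ∑ els (λ (a , i) → lin (θ i) (𝔇 ε w)) ≈ ⟦ u ≈? w ⟧
    by-length (yes eq) = begin
      ∑ els (λ (a , i) → lin (θ i) (𝔇 ε w))
        ≈⟨ ∑-cong∈ els (λ (a , i) x∈ → pairing-𝔇 w i
             (≡.trans (compatible-length u x∈) (≡.trans eq (≡.sym (length≡ℓ w))))) ⟩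
      ∑ els (λ (a , i) → E w i)
        ≈⟨ ∑-compatiblePairs M u (fixes-suc u M (ℕ.m≤m⊔n (bound u) (bound w))) (E w) ⟩
      onSchubert M (E w) u
        ≈⟨ onSchubert-E (bound w) M (ℕ.m≤n⊔m (bound u) (bound w)) w (fixes w) u ⟩
      ⟦ u ≈? w ⟧ ∎
    by-length (no ≢) = trans
      (trans (∑-cong∈ els λ (a , i) x∈ → pairing-𝔇-0 w i λ len →
               ≢ (≡.trans (≡.sym (compatible-length u x∈)) (≡.trans len (length≡ℓ w))))
             (∑-0 els λ _ → refl))
      (sym (⟦⟧-no (u ≈? w) λ u≈w → ≢ (#inv-cong u w u≈w)))

  -- The difference of the two pairings, as a functional of the left argument, vanishes on every 𝔖ᵤ
  -- and hence on every monomial; the monomials then detect the coefficients.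
  uniqueness : ∀ D → DualToSchubert D → ∀ w → 𝔇 ε w ≈ₚ D w
  uniqueness D dual w m = coeff-from-θ m (𝔇 ε w) (D w)
    (x∙y⁻¹≈ε⇒x≈y _ _ (separation φ φ-symmetric φ𝔖≈0 m))
    where
    φ : Functional
    φ m = lin (θ m) (𝔇 ε w) - lin (θ m) (D w)
    φ-symmetric : Symmetric φ
    φ-symmetric p = +-cong (lin-cong (∂ᵗ*-↭ p ct) (𝔇 ε w)) (-‿cong (lin-cong (∂ᵗ*-↭ p ct) (D w)))
    φ𝔖≈0 : ∀ M u → Fixes≥ (suc M) u → onSchubert M φ u ≈ 0#
    φ𝔖≈0 M u fix = begin
      onSchubert M φ u
        ≈⟨ ∑-compatiblePairs M u fix φ ⟨
      ∑ els (λ (a , i) → φ i)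
        ≈⟨ ∑-+ els _ _ ⟩
      ∑ els (λ (a , i) → lin (θ i) (𝔇 ε w)) + ∑ els (λ (a , i) → - lin (θ i) (D w))
        ≈⟨ +-cong (value (𝔇 ε w)) (trans (∑-cong els λ (a , i) → sym (-1*x≈-x _))
             (trans (∑-*ˡ (- 1#) els _) (trans (-1*x≈-x _) (-‿cong (value (D w)))))) ⟩
      ⟨ 𝔖 u , 𝔇 ε w ⟩ - ⟨ 𝔖 u , D w ⟩
        ≈⟨ +-cong (duality u w) (-‿cong (dual u w)) ⟩
      δ u w - δ u w
        ≈⟨ -‿inverseʳ _ ⟩
      0# ∎
      where
      els = elements (compatiblePairs u)
      value : ∀ g → ∑ els (λ (a , i) → lin (θ i) g) ≈ ⟨ 𝔖 u , g ⟩
      value g = sym (trans (pairing (𝔖 u) g) (lin-𝔖 (λ m → lin (θ m) g) u))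

theorem2 : ∀ {c r} (K : ℚ-Algebra c r) → let open Polynomials K in
    (∀ u w → ⟨ 𝔖 u , 𝔇 ε w ⟩ ≈ δ u w)
    × (∀ (D : S∞ → Poly) → DualToSchubert D → ∀ w → 𝔇 ε w ≈ₚ D w)
theorem2 K = Duals.duality K , Duals.uniqueness K
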